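{- For every integer $d$ and every non-trivial finite Abelian group $G$ there exist a positive constant $\delta$ and a family $(\mathbb{A}_n)_{n\ge1}$ of unsatisfiable instances of $3\mathrm{LIN}(G)$, where $\mathbb{A}_n$ has $\Theta(n)$ variables and $\Theta(n)$ equations, such that for every sufficiently large $n$ every Frege refutation of $\mathrm{CNF}(\mathbb{A}_n,\mathbb{B}(G,3))$ of depth $d$ has size at least $2^{n^{\delta}}$.
   Context: For a finite Abelian group $G$, $\mathbb{B}(G,3)$ is the relational structure with domain $G$ having, for each distinct relation of the form $\{(g_1,g_2,g_3)\in G^3: z_1g_1+z_2g_2+z_3g_3=g\}$ with $g\in G$, $(z_1,z_2,z_3)\in\mathbb{Z}^3$, one ternary relation symbol interpreted as this relation. $3\mathrm{LIN}(G)$ is $\mathrm{CSP}(\mathbb{B}(G,3))$: an instance is a finite structure $\mathbb{A}$ in this vocabulary, i.e. a system of linear equations over $G$ with three variable positions per equation (variables = elements of $A$); it is unsatisfiable if no homomorphism to $\mathbb{B}(G,3)$ exists. $\mathrm{CNF}(\mathbb{A},\mathbb{B})$ is the set of clauses over variables $X(a,b)$: $\bigvee_{b\in B}X(a,b)$ for $a\in A$; $\overline{X(a,b_0)}\vee\overline{X(a,b_1)}$ for $a\in A$, $b_0\ne b_1$; $\bigvee_{i=1}^r\overline{X(a_i,b_i)}$ for each relation symbol $R$ of arity $r$, $(a_1,\dots,a_r)\in R(\mathbb{A})$, $(b_1,\dots,b_r)\in B^r\setminus R(\mathbb{B})$. Frege (Tait-style, negation normal form): axiom $A\vee\overline A$;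 cut $C\vee A, D\vee\overline A\vdash C\vee D$; $C\vee A,D\vee B\vdash C\vee D\vee(A\wedge B)$; weakening $C\vdash C\vee D$; a refutation derives the empty formula; size = total size of its formulas. $\Sigma_{1,k}$ = $k$-DNFs, $\Pi_{1,k}$ = $k$-CNFs, $\Sigma_{t,k}$ = disjunctions of $\Pi_{t-1,k}$-formulas, $\Pi_{t,k}$ = conjunctions of $\Sigma_{t-1,k}$-formulas; a Frege refutation of depth $d$ is one all of whose formulas lie in $\Sigma_{d,1}$. -}

module Defs where

open import Data.Nat using (ℕ; zero; suc; _+_; _*_; _^_; _≤_)
open import Data.Integer using (ℤ; +_; -[1+_])
open import Data.Fin using (Fin)
open import Data.Bool using (Bool; true; false; not)
open import Data.List using (List; []; _∷_; _++_; [_]; map; length; allFin)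
open import Data.Nat.ListAction using (sum)
open import Data.List.Membership.Propositional using (_∈_)
open import Data.List.Relation.Unary.All using (All)
open import Data.List.Relation.Unary.AllPairs using (AllPairs)
open import Data.List.Relation.Binary.Permutation.Propositional using (_↭_)
open import Data.Product using (Σ; _×_; _,_)
open import Relation.Binary.PropositionalEquality using (_≡_; _≢_)
open import Relation.Nullary using (¬_)
open import Algebra.Structures using (IsAbelianGroup)

record FinAbGroup : Set where
  field
    k   : ℕ
    _∙_ : Fin k → Fin k → Fin k
    ε   : Fin k
    _⁻¹ : Fin k → Fin k
    isAbelianGroup : IsAbelianGroup _≡_ _∙_ ε _⁻¹

module _ (G : FinAbGroup) where
  open FinAbGroup G

  natMul : ℕ → Fin k → Fin k
  natMul zero    x = ε
  natMul (suc n) x = x ∙ natMul n x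

  intMul : ℤ → Fin k → Fin k
  intMul (+ n)    x = natMul n x
  intMul -[1+ n ] x = natMul (suc n) x ⁻¹

-- Instances of 3LIN(G): structures with domain Fin N.
-- An equation is a relation symbol (given by z₁,z₂,z₃,g) together with a
-- tuple (x₁,x₂,x₃) of domain elements in its interpretation.

record Eqn (k N : ℕ) : Set where
  field
    z₁ z₂ z₃ : ℤ
    g        : Fin k
    x₁ x₂ x₃ : Fin N

module _ (G : FinAbGroup) where
  open FinAbGroup G

  -- (b₁,b₂,b₃) lies in the relation of B(G,3) named by the symbol of e
  Holds : {N : ℕ} → Eqn k N → Fin k → Fin k → Fin k → Set
  Holds e b₁ b₂ b₃ =
    (intMul G (Eqn.z₁ e) b₁ ∙ intMul G (Eqn.z₂ e) b₂) ∙ intMul G (Eqn.z₃ e) b₃ ≡ Eqn.g e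

  -- two equations are the same element of the structure: same tuple and
  -- same relation (relation symbols = distinct relations of B(G,3))
  SameEqn : {N : ℕ} → Eqn k N → Eqn k N → Set
  SameEqn e e' =
    (Eqn.x₁ e ≡ Eqn.x₁ e') × (Eqn.x₂ e ≡ Eqn.x₂ e') × (Eqn.x₃ e ≡ Eqn.x₃ e') ×
    (∀ b₁ b₂ b₃ → (Holds e b₁ b₂ b₃ → Holds e' b₁ b₂ b₃) × (Holds e' b₁ b₂ b₃ → Holds e b₁ b₂ b₃))

record Instance (G : FinAbGroup) : Set where
  field
    N        : ℕ
    eqs      : List (Eqn (FinAbGroup.k G) N)
    distinct : AllPairs (λ e e' → ¬ SameEqn G e e') eqs

module _ {G : FinAbGroup} where
  open FinAbGroup G

  Unsat : Instance G → Set
  Unsat A = ¬ (Σ (Fin N → Fin k) λ h →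
                 All (λ e → Holds G e (h (Eqn.x₁ e)) (h (Eqn.x₂ e)) (h (Eqn.x₃ e))) eqs)
    where open Instance A

data Fm (V : Set) : Set where
  lit : Bool → V → Fm V          -- lit true v = v,  lit false v = ¬v
  _∧_ : Fm V → Fm V → Fm V
  _∨_ : Fm V → Fm V → Fm V

neg : {V : Set} → Fm V → Fm V
neg (lit b v) = lit (not b) v
neg (A ∧ B)   = neg A ∨ neg B
neg (A ∨ B)   = neg A ∧ neg B

fmSize : {V : Set} → Fm V → ℕ
fmSize (lit _ _) = 1
fmSize (A ∧ B)   = suc (fmSize A + fmSize B)
fmSize (A ∨ B)   = suc (fmSize A + fmSize B)

-- A line of a Tait-style proof: a disjunction of formulas (empty = empty formula)
Line : Set → Set
Line V = List (Fm V)

lineSize : {V : Set} → Line V → ℕ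
lineSize ℓ = sum (map fmSize ℓ)

proofSize : {V : Set} → List (Line V) → ℕ
proofSize π = sum (map lineSize π)

-- depth classes Σ_{t,1}, Π_{t,1} (unbounded fan-in: maximal ∨-/∧-trees are gates)
data IsLit {V : Set} : Fm V → Set where
  isLit : (b : Bool) (v : V) → IsLit (lit b v)

data OrTree {V : Set} (P : Fm V → Set) : Fm V → Set where
  leaf : {F : Fm V} → P F → OrTree P F
  node : {A B : Fm V} → OrTree P A → OrTree P B → OrTree P (A ∨ B)

data AndTree {V : Set} (P : Fm V → Set) : Fm V → Set where
  leaf : {F : Fm V} → P F → AndTree P F
  node : {A B : Fm V} → AndTree P A → AndTree P B → AndTree P (A ∧ B)

InΣ InΠ : {V : Set} → ℕ → Fm V → Set
InΣ zero    F = IsLit F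
InΣ (suc t) F = OrTree (InΠ t) F
InΠ zero    F = IsLit F
InΠ (suc t) F = AndTree (InΣ t) F

-- a line lies in Σ_{d,1} iff the disjunction of its formulas does
LineInΣ : {V : Set} → ℕ → Line V → Set
LineInΣ d ℓ = All (InΣ d) ℓ

-- Tait-style Frege proofs.  Lines are lists of formulas read as
-- disjunctions; ∨ on lines is associative, commutative, idempotent
-- (exchange, contraction, ∨-merge/split are identity steps).

module _ {V : Set} (Init : Line V → Set) where

  data Step (prev : List (Line V)) : Line V → Set where
    hyp      : {ℓ : Line V} → Init ℓ → Step prev ℓ
    axiom    : (A : Fm V) → Step prev (A ∷ neg A ∷ [])
    cut      : (C D : Line V) (A : Fm V) →
               (C ++ [ A ]) ∈ prev → (D ++ [ neg A ]) ∈ prev → Step prev (C ++ D)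
    conj     : (C D : Line V) (A B : Fm V) →
               (C ++ [ A ]) ∈ prev → (D ++ [ B ]) ∈ prev → Step prev (C ++ D ++ [ A ∧ B ])
    weaken   : (C D : Line V) → C ∈ prev → Step prev (C ++ D)
    exchange : {C ℓ : Line V} → C ∈ prev → C ↭ ℓ → Step prev ℓ
    contract : (C : Line V) (A : Fm V) → (C ++ A ∷ A ∷ []) ∈ prev → Step prev (C ++ [ A ])
    ∨-merge  : (C : Line V) (A B : Fm V) → (C ++ A ∷ B ∷ []) ∈ prev → Step prev (C ++ [ A ∨ B ])
    ∨-split  : (C : Line V) (A B : Fm V) → (C ++ [ A ∨ B ]) ∈ prev → Step prev (C ++ A ∷ B ∷ [])

  data Deriv : List (Line V) → Set where
    []  : Deriv []
    _∷_ : {ℓ : Line V} {prev : List (Line V)} → Step prev ℓ → Deriv prev → Deriv (ℓ ∷ prev)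

  data Refutation : List (Line V) → Set where
    refutation : {prev : List (Line V)} → Deriv ([] ∷ prev) → Refutation ([] ∷ prev)

DepthAtMost : {V : Set} → ℕ → List (Line V) → Set
DepthAtMost d π = All (LineInΣ d) π

module _ {G : FinAbGroup} (A : Instance G) where
  open FinAbGroup G
  open Instance A

  CVar : Set
  CVar = Fin N × Fin k

  data CNF : Line CVar → Set where
    total      : (a : Fin N) → CNF (map (λ b → lit true (a , b)) (allFin k))
    functional : (a : Fin N) (b₀ b₁ : Fin k) → b₀ ≢ b₁ →
                 CNF (lit false (a , b₀) ∷ lit false (a , b₁) ∷ [])
    constraint : (e : Eqn k N) → e ∈ eqs → (b₁ b₂ b₃ : Fin k) → ¬ Holds G e b₁ b₂ b₃ →
                 CNF (lit false (Eqn.x₁ e , b₁) ∷ lit false (Eqn.x₂ e , b₂) ∷ lit false (Eqn.x₃ e , b₃) ∷ [])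

IsΘn : (ℕ → ℕ) → Set
IsΘn f = Σ ℕ λ a → Σ ℕ λ b → Σ ℕ λ n₀ → ∀ n → n₀ ≤ n → (n ≤ a * f n) × (f n ≤ b * n)

{-# OPTIONS --safe #-}
-- The system is the pigeonhole principle for M + 1 pigeons and M holes: a partial matching assigns
-- values to all variables near its vertices without violating an equation, although summing the
-- equations over rows and over columns gives (M + 1) g = M g.  A refutation of depth d is evaluated
-- bottom up: after a random partial matching has been fixed at each level, every conjunction is decided
-- by matching terms of size O(s) (switching lemma), where s exceeds the logarithm of the proof size.
-- Every line is then forced to be true by small matchings, but the empty line is not.
-- The switching lemma is proved by encoding: a matching ρ with a long path σ in the canonical decision
-- process is recovered from ρ ∪ σ with few bits of advice, and there are far fewer matchings of the
-- larger size.
module Submission where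

open import Defs
open import Algebra.Bundles using (AbelianGroup)
import Algebra.Properties.CommutativeMonoid.Sum as CommutativeMonoidSum
import Algebra.Properties.Group as GroupProperties
open import Data.Bool using (Bool; true; false; not)
open import Data.Empty using (⊥; ⊥-elim)
open import Data.Fin as Fin using (Fin; zero; suc; toℕ)
import Data.Fin.Properties as Fin
open import Data.Integer as ℤ using (ℤ)
open import Data.List using (List; []; _∷_; _++_; [_]; map; concatMap; length; allFin; filter; deduplicate; take; cartesianProduct; tabulate)
open import Data.List.Properties using (length-++; length-map; length-tabulate; length-take; ++-assoc; ++-identityʳ)
open import Data.List.Membership.Propositional using (_∈_; _∉_; lose; find)
open import Data.List.Membership.Propositional.Properties using (∈-++⁺ˡ; ∈-++⁺ʳ; ∈-++⁻; ∈-map⁺; ∈-map⁻; ∈-concatMap⁺; ∈-concatMap⁻; ∈-filter⁺; ∈-filter⁻; ∈-allFin; ∈-∃++; ∈-cartesianProduct⁺; ∈-cartesianProduct⁻; ∈-deduplicate⁺; ∈-deduplicate⁻; ∈-tabulate⁻; ∈-length)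
open import Data.List.Relation.Binary.Permutation.Propositional using (_↭_; ↭⇒↭ₛ; ↭-sym; ↭-trans; ↭-refl; prep; swap; ↭-reflexive)
import Data.List.Relation.Binary.Permutation.Propositional.Properties as ↭
import Data.List.Relation.Binary.Permutation.Setoid.Properties as ↭ₛ
open import Data.List.Relation.Binary.Subset.Propositional using (_⊆_)
open import Data.List.Relation.Unary.All as All using (All; []; _∷_)
import Data.List.Relation.Unary.All.Properties as All
open import Data.List.Relation.Unary.AllPairs using ([]; _∷_)
import Data.List.Relation.Unary.AllPairs.Properties as AllPairs
open import Data.List.Relation.Unary.Any as Any using (Any; here; there)
open import Data.List.Relation.Unary.Unique.Propositional using (Unique)
import Data.List.Relation.Unary.Unique.Propositional.Properties as Unique
open import Data.Maybe using (Maybe; just; nothing)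
open import Data.Nat using (ℕ; >-nonZero; zero; suc; _+_; _*_; _∸_; _^_; _≤_; _<_; z≤n; s≤s; _⊔_; _≤?_; _<?_)
open import Data.Nat.Properties
open import Data.Nat.Solver using (module +-*-Solver)
open import Data.Product using (Σ; ∃; _×_; _,_; proj₁; proj₂)
open import Data.Product.Properties using (≡-dec)
open import Data.Sum using (_⊎_; inj₁; inj₂; [_,_]′)
open import Function using (_∘_; id)
open import Relation.Binary using (DecidableEquality)
open import Relation.Binary.PropositionalEquality hiding ([_])
open import Relation.Nullary using (¬_; Dec; yes; no)
open import Relation.Nullary.Decidable using (_×-dec_; _→-dec_; ¬?; map′)
import Data.List.Membership.DecPropositional as DecMem
import Data.List.Relation.Unary.Unique.DecPropositional.Properties as DecUnique

-- An equation has three positions, yet a variable must be decided by a single edge. Row and column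
-- sums are therefore cut into partial sums: each depends only on the edge at its own pigeon or
-- hole, and takes only the values ε and a fixed g, so the argument is the same for every group.
-- Being true under small matchings is not by itself preserved along a proof: two premises used in
-- turn need a matching larger than either. The size is reset at every line, because the terms of
-- the line itself are also subjected to the switching lemma: a line whose terms are decided by few
-- edges, and which no small matching falsifies, is made true by few edges. Probabilities become
-- counts of sequences. A bad restriction of m edges can be interleaved with its path of s edges in
-- at least (m + 1)^s ways, while with l holes left free each extra edge costs about l² choices, and
-- its advice about s l² more. The switching lemma thus needs m of order s l⁴, so each round takes
-- about a fifth root of the number of free holes. With d + 1 rounds for the conjunctions and one
-- for the lines this gives the exponent 5^(d+2).

^-distribʳ-* : ∀ k a b → (a * b) ^ k ≡ a ^ k * b ^ k
^-distribʳ-* zero    a b = refl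
^-distribʳ-* (suc k) a b = trans (cong (a * b *_) (^-distribʳ-* k a b))
  (solve 4 (λ a b x y → a :* b :* (x :* y) := a :* x :* (b :* y)) refl a b (a ^ k) (b ^ k))
  where open +-*-Solver

-- Counting with duplicate-free lists.

module _ {A : Set} where

  -- Encoding arguments are run through this inequality: the encoded objects form a duplicate-free
  -- list that is included in a list of codes of bounded length.
  length-mono-⊆ : {xs ys : List A} → Unique xs → xs ⊆ ys → length xs ≤ length ys
  length-mono-⊆ {[]} _ _ = z≤n
  length-mono-⊆ {x ∷ xs} (x∉ ∷ u) s with ∈-∃++ (s (here refl))
  ... | as , bs , refl = subst (suc (length xs) ≤_) (sym len) (s≤s (length-mono-⊆ u drop-x))
    where
    len : length (as ++ x ∷ bs) ≡ suc (length (as ++ bs))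
    len = trans (length-++ as) (trans (+-suc (length as) _) (cong suc (sym (length-++ as))))
    drop-x : xs ⊆ as ++ bs
    drop-x {y} y∈ with ∈-++⁻ as (s (there y∈))
    ... | inj₁ p           = ∈-++⁺ˡ p
    ... | inj₂ (here refl) = ⊥-elim (All.lookup x∉ y∈ refl)
    ... | inj₂ (there p)   = ∈-++⁺ʳ as p

  ⊆-++ : {xs ys zs : List A} → xs ⊆ zs → ys ⊆ zs → xs ++ ys ⊆ zs
  ⊆-++ {xs} p q x∈ = [ p , q ]′ (∈-++⁻ xs x∈)

module _ {A B : Set} where

  ∈-concatMap : (f : A → List B) {x : A} {xs : List A} {y : B} → x ∈ xs → y ∈ f x → y ∈ concatMap f xs
  ∈-concatMap f x∈ y∈ = ∈-concatMap⁺ f (lose x∈ y∈)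

  ∈-concatMap⁻′ : (f : A → List B) (xs : List A) {y : B} → y ∈ concatMap f xs → ∃ λ x → x ∈ xs × y ∈ f x
  ∈-concatMap⁻′ f xs p = find (∈-concatMap⁻ f {xs} p)

  length-concatMap-≤ : (f : A → List B) (xs : List A) {b : ℕ} → (∀ {x} → x ∈ xs → length (f x) ≤ b) →
    length (concatMap f xs) ≤ length xs * b
  length-concatMap-≤ f [] _ = z≤n
  length-concatMap-≤ f (x ∷ xs) h = ≤-trans (≤-reflexive (length-++ (f x)))
    (+-mono-≤ (h (here refl)) (length-concatMap-≤ f xs (h ∘ there)))

  length-concatMap-≥ : (f : A → List B) (xs : List A) {b : ℕ} → (∀ {x} → x ∈ xs → b ≤ length (f x)) →
    length xs * b ≤ length (concatMap f xs)
  length-concatMap-≥ f [] _ = z≤n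
  length-concatMap-≥ f (x ∷ xs) h = ≤-trans
    (+-mono-≤ (h (here refl)) (length-concatMap-≥ f xs (h ∘ there)))
    (≤-reflexive (sym (length-++ (f x))))

  unique-concatMap : (f : A → List B) (g : B → A) {xs : List A} → Unique xs →
    (∀ {x} → x ∈ xs → Unique (f x)) → (∀ {x y} → x ∈ xs → y ∈ f x → g y ≡ x) → Unique (concatMap f xs)
  unique-concatMap f g {[]} _ _ _ = []
  unique-concatMap f g {x ∷ xs} (x∉ ∷ u) uf inv =
    Unique.++⁺ (uf (here refl)) (unique-concatMap f g u (uf ∘ there) (inv ∘ there)) disjoint
    where
    disjoint : ∀ {y} → ¬ (y ∈ f x × y ∈ concatMap f xs)
    disjoint (p , q) with ∈-concatMap⁻′ f xs q
    ... | x′ , x′∈ , q′ = All.lookup x∉ x′∈ (trans (sym (inv (here refl) p)) (inv (there x′∈) q′))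

  unique-map : (f : A → B) {xs : List A} → Unique xs →
    (∀ {x y} → x ∈ xs → y ∈ xs → f x ≡ f y → x ≡ y) → Unique (map f xs)
  unique-map f {[]} _ _ = []
  unique-map f {x ∷ xs} (x∉ ∷ u) inj = All.tabulate fresh ∷ unique-map f u (λ p q → inj (there p) (there q))
    where
    fresh : ∀ {y} → y ∈ map f xs → f x ≢ y
    fresh y∈ e with ∈-map⁻ f y∈
    ... | x′ , x′∈ , refl = All.lookup x∉ x′∈ (inj (here refl) (there x′∈) e)

  length-cartesianProduct : (xs : List A) (ys : List B) → length (cartesianProduct xs ys) ≡ length xs * length ys
  length-cartesianProduct []       ys = refl
  length-cartesianProduct (x ∷ xs) ys =
    trans (length-++ (map (x ,_) ys)) (cong₂ _+_ (length-map _ ys) (length-cartesianProduct xs ys))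

module _ {A : Set} where

  words : List A → ℕ → List (List A)
  words as zero    = [ [] ]
  words as (suc h) = [] ∷ concatMap (λ x → map (x ∷_) (words as h)) as

  ∈-words : (as : List A) (h : ℕ) {xs : List A} → length xs ≤ h → (∀ {x} → x ∈ xs → x ∈ as) → xs ∈ words as h
  ∈-words as zero    {[]}     _       _ = here refl
  ∈-words as (suc h) {[]}     _       _ = here refl
  ∈-words as (suc h) {x ∷ xs} (s≤s l) s =
    there (∈-concatMap (λ x → map (x ∷_) (words as h)) (s (here refl)) (∈-map⁺ (x ∷_) (∈-words as h l (s ∘ there))))

  words-length : (as : List A) (h : ℕ) {xs : List A} → xs ∈ words as h → length xs ≤ h
  words-length as zero    (here refl) = z≤n
  words-length as (suc h) (here refl) = z≤n
  words-length as (suc h) (there p) with ∈-concatMap⁻′ (λ x → map (x ∷_) (words as h)) as p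
  ... | x , _ , q with ∈-map⁻ (x ∷_) q
  ...   | ys , ys∈ , refl = s≤s (words-length as h ys∈)

  insertions : A → List A → List (List A)
  insertions e []       = [ [ e ] ]
  insertions e (x ∷ xs) = (e ∷ x ∷ xs) ∷ map (x ∷_) (insertions e xs)

  length-insertions : (e : A) (xs : List A) → length (insertions e xs) ≡ suc (length xs)
  length-insertions e []       = refl
  length-insertions e (x ∷ xs) = cong suc (trans (length-map _ (insertions e xs)) (length-insertions e xs))

  insertions-↭ : (e : A) (xs : List A) {ys : List A} → ys ∈ insertions e xs → ys ↭ e ∷ xs
  insertions-↭ e []       (here refl) = ↭-refl
  insertions-↭ e (x ∷ xs) (here refl) = ↭-refl
  insertions-↭ e (x ∷ xs) (there p) with ∈-map⁻ (x ∷_) p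
  ... | zs , zs∈ , refl = ↭-trans (prep x (insertions-↭ e xs zs∈)) (swap x e ↭-refl)

  insertions-unique : (e : A) (xs : List A) → e ∉ xs → Unique (insertions e xs)
  insertions-unique e []       _  = [] ∷ []
  insertions-unique e (x ∷ xs) e∉ = All.tabulate fresh ∷ Unique.map⁺ (λ { refl → refl }) (insertions-unique e xs (e∉ ∘ there))
    where
    fresh : ∀ {ys} → ys ∈ map (x ∷_) (insertions e xs) → e ∷ x ∷ xs ≢ ys
    fresh p refl with ∈-map⁻ (x ∷_) p
    ... | zs , zs∈ , refl = e∉ (here refl)

  -- The order of `ρ` is kept while the entries of `σ` may land anywhere, in any order. Deleting `σ`
  -- therefore gives `ρ` back, and each inserted entry has at least `suc (length ρ)` positions.
  shuffles : List A → List A → List (List A)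
  shuffles []      ρ = [ ρ ]
  shuffles (e ∷ σ) ρ = concatMap (insertions e) (shuffles σ ρ)

  shuffles-↭ : (σ ρ : List A) {τ : List A} → τ ∈ shuffles σ ρ → τ ↭ σ ++ ρ
  shuffles-↭ []      ρ (here refl) = ↭-refl
  shuffles-↭ (e ∷ σ) ρ p with ∈-concatMap⁻′ (insertions e) (shuffles σ ρ) p
  ... | υ , υ∈ , q = ↭-trans (insertions-↭ e υ q) (prep e (shuffles-↭ σ ρ υ∈))

  length-shuffles : (σ ρ : List A) → suc (length ρ) ^ length σ ≤ length (shuffles σ ρ)
  length-shuffles []      ρ = ≤-refl
  length-shuffles (e ∷ σ) ρ = ≤-trans (≤-reflexive (*-comm (suc (length ρ)) _)) (≤-trans
    (*-monoˡ-≤ _ (length-shuffles σ ρ))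
    (length-concatMap-≥ (insertions e) (shuffles σ ρ) bound))
    where
    bound : ∀ {τ} → τ ∈ shuffles σ ρ → suc (length ρ) ≤ length (insertions e τ)
    bound {τ} τ∈ = ≤-trans
      (s≤s (≤-trans (m≤n+m _ (length σ)) (≤-reflexive (sym (trans (↭.↭-length (shuffles-↭ σ ρ τ∈)) (length-++ σ))))))
      (≤-reflexive (sym (length-insertions e τ)))

module _ {A : Set} (_≟_ : DecidableEquality A) where
  open DecMem _≟_ using (_∈?_)

  _∖_ : List A → List A → List A
  xs ∖ ys = filter (λ x → ¬? (x ∈? ys)) xs

  ∈-∖⁺ : {x : A} {xs ys : List A} → x ∈ xs → x ∉ ys → x ∈ xs ∖ ys
  ∈-∖⁺ = ∈-filter⁺ (λ x → ¬? (x ∈? _))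

  ∈-∖⁻ : {x : A} (xs ys : List A) → x ∈ xs ∖ ys → x ∈ xs × x ∉ ys
  ∈-∖⁻ xs ys = ∈-filter⁻ (λ x → ¬? (x ∈? ys)) {xs = xs}

  ∖-fresh : (xs ys : List A) → (∀ {x} → x ∈ xs → x ∉ ys) → xs ∖ ys ≡ xs
  ∖-fresh []       ys h = refl
  ∖-fresh (x ∷ xs) ys h with x ∈? ys
  ... | yes p = ⊥-elim (h (here refl) p)
  ... | no _  = cong (x ∷_) (∖-fresh xs ys (h ∘ there))

  insertions-∖ : (e : A) (xs ys : List A) → e ∈ ys → ∀ {zs} → zs ∈ insertions e xs → zs ∖ ys ≡ xs ∖ ys
  insertions-∖ e []       ys e∈ (here refl) with e ∈? ys
  ... | yes _ = refl
  ... | no ¬p = ⊥-elim (¬p e∈)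
  insertions-∖ e (x ∷ xs) ys e∈ (here refl) with e ∈? ys
  ... | yes _ = refl
  ... | no ¬p = ⊥-elim (¬p e∈)
  insertions-∖ e (x ∷ xs) ys e∈ (there p) with ∈-map⁻ (x ∷_) p
  ... | zs , zs∈ , refl with x ∈? ys
  ...   | yes _ = insertions-∖ e xs ys e∈ zs∈
  ...   | no _  = cong (x ∷_) (insertions-∖ e xs ys e∈ zs∈)

  shuffles-∖ : (σ ρ ys : List A) → σ ⊆ ys → ∀ {τ} → τ ∈ shuffles σ ρ → τ ∖ ys ≡ ρ ∖ ys
  shuffles-∖ []      ρ ys _ (here refl) = refl
  shuffles-∖ (e ∷ σ) ρ ys s p with ∈-concatMap⁻′ (insertions e) (shuffles σ ρ) p
  ... | υ , υ∈ , q = trans (insertions-∖ e υ ys (s (here refl)) q) (shuffles-∖ σ ρ ys (s ∘ there) υ∈)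

  unique-shuffles : (σ ρ : List A) → Unique (σ ++ ρ) → Unique (shuffles σ ρ)
  unique-shuffles []      ρ _        = [] ∷ []
  unique-shuffles (e ∷ σ) ρ (e∉ ∷ u) = unique-concatMap (insertions e) (_∖ [ e ]) (unique-shuffles σ ρ u)
    (λ {υ} υ∈ → insertions-unique e υ (fresh υ∈))
    (λ {υ} υ∈ p → trans (insertions-∖ e υ [ e ] (here refl) p) (∖-fresh υ [ e ] (λ { x∈ (here refl) → fresh υ∈ x∈ })))
    where
    fresh : ∀ {υ} → υ ∈ shuffles σ ρ → e ∉ υ
    fresh υ∈ p = All.lookup e∉ (↭.∈-resp-↭ (shuffles-↭ σ ρ υ∈) p) refl

  unique-∖ : {xs : List A} (ys : List A) → Unique xs → Unique (xs ∖ ys)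
  unique-∖ ys = Unique.filter⁺ (λ x → ¬? (x ∈? ys))

  length-∖ : {xs ys : List A} → Unique xs → Unique ys → ys ⊆ xs → length ys + length (xs ∖ ys) ≡ length xs
  length-∖ {xs} {ys} ux uy s = trans (sym (length-++ ys)) (≤-antisym
    (length-mono-⊆ (Unique.++⁺ uy (unique-∖ ys ux) (λ (p , q) → proj₂ (∈-∖⁻ xs ys q) p))
      (⊆-++ s (proj₁ ∘ ∈-∖⁻ xs ys)))
    (length-mono-⊆ ux λ {x} → split x))
    where
    split : ∀ x → x ∈ xs → x ∈ ys ++ (xs ∖ ys)
    split x x∈ with x ∈? ys
    ... | yes p = ∈-++⁺ˡ p
    ... | no ¬p = ∈-++⁺ʳ ys (∈-∖⁺ x∈ ¬p)

module _ {A : Set} {P Q : A → Set} (P? : ∀ x → Dec (P x)) (Q? : ∀ x → Dec (Q x)) where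

  length-filter-filter : (xs : List A) → length (filter P? (filter Q? xs)) ≤ length (filter P? xs)
  length-filter-filter [] = z≤n
  length-filter-filter (x ∷ xs) with Q? x
  length-filter-filter (x ∷ xs) | yes _ with P? x
  ... | yes _ = s≤s (length-filter-filter xs)
  ... | no _  = length-filter-filter xs
  length-filter-filter (x ∷ xs) | no _ with P? x
  ... | yes _ = ≤-trans (length-filter-filter xs) (n≤1+n _)
  ... | no _  = length-filter-filter xs

module _ {A : Set} {P : A → Set} (P? : ∀ x → Dec (P x)) where

  length-filter-¬ : (xs : List A) → length xs ≡ length (filter P? xs) + length (filter (¬? ∘ P?) xs)
  length-filter-¬ [] = refl
  length-filter-¬ (x ∷ xs) with P? x
  ... | yes _ = cong suc (length-filter-¬ xs)
  ... | no _  = trans (cong suc (length-filter-¬ xs)) (sym (+-suc _ _))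

module _ {A I : Set} {P : I → A → Set} (P? : ∀ i x → Dec (P i x)) where

  -- `b / (a * length xs)` bounds the probability of each event; it is multiplied out to stay in the
  -- naturals. The induction discards the entries hit by one event, which can only lower the counts
  -- of the others.
  union-bound : (is : List I) (xs : List A) {a b : ℕ} → (∀ {i} → i ∈ is → length (filter (P? i) xs) * a ≤ b) →
    length is * b < length xs * a → ∃ λ x → x ∈ xs × (∀ {i} → i ∈ is → ¬ P i x)
  union-bound []       (x ∷ xs) _ _ = x , here refl , λ ()
  union-bound (i ∷ is) xs {a} {b} rare few with union-bound is (filter (¬? ∘ P? i) xs)
    (λ {j} j∈ → ≤-trans (*-monoˡ-≤ a (length-filter-filter (P? j) (¬? ∘ P? i) xs)) (rare (there j∈)))
    (+-cancelˡ-< b _ _ (<-≤-trans few (begin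
      length xs * a
        ≡⟨ cong (_* a) (length-filter-¬ (P? i) xs) ⟩
      (length (filter (P? i) xs) + length (filter (¬? ∘ P? i) xs)) * a
        ≡⟨ *-distribʳ-+ a (length (filter (P? i) xs)) _ ⟩
      length (filter (P? i) xs) * a + length (filter (¬? ∘ P? i) xs) * a
        ≤⟨ +-monoˡ-≤ _ (rare (here refl)) ⟩
      b + length (filter (¬? ∘ P? i) xs) * a ∎)))
    where open ≤-Reasoning
  ... | x , x∈ , avoid with ∈-filter⁻ (¬? ∘ P? i) {xs = xs} x∈
  ...   | x∈′ , ¬p = x , x∈′ , λ { (here refl) → ¬p ; (there j∈) → avoid j∈ }

-- Formulas: disjuncts, ranks and conjunctions.

module _ {V : Set} where

  -- The truth of a disjunction is read off from these parts, which are literals and conjunctions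
  -- only. The structural rules on lines then merely permute, repeat, merge or enlarge lists of
  -- parts.
  disjuncts : Fm V → List (Fm V)
  disjuncts (lit b v) = [ lit b v ]
  disjuncts (A ∧ B)   = [ A ∧ B ]
  disjuncts (A ∨ B)   = disjuncts A ++ disjuncts B

  line-disjuncts : Line V → List (Fm V)
  line-disjuncts = concatMap disjuncts

  neg-involutive : (A : Fm V) → neg (neg A) ≡ A
  neg-involutive (lit true v)  = refl
  neg-involutive (lit false v) = refl
  neg-involutive (A ∧ B)       = cong₂ _∧_ (neg-involutive A) (neg-involutive B)
  neg-involutive (A ∨ B)       = cong₂ _∨_ (neg-involutive A) (neg-involutive B)

  -- Least t with A in Σ_t, up to one; rankΠ is its dual.
  rankΣ rankΠ : Fm V → ℕ
  rankΣ (lit _ _) = 0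
  rankΣ (A ∧ B)   = suc (rankΠ A ⊔ rankΠ B)
  rankΣ (A ∨ B)   = rankΣ A ⊔ rankΣ B
  rankΠ (lit _ _) = 0
  rankΠ (A ∧ B)   = rankΠ A ⊔ rankΠ B
  rankΠ (A ∨ B)   = suc (rankΣ A ⊔ rankΣ B)

  rankΣ-neg : (A : Fm V) → rankΣ (neg A) ≡ rankΠ A
  rankΠ-neg : (A : Fm V) → rankΠ (neg A) ≡ rankΣ A
  rankΣ-neg (lit _ _) = refl
  rankΣ-neg (A ∧ B)   = cong₂ _⊔_ (rankΣ-neg A) (rankΣ-neg B)
  rankΣ-neg (A ∨ B)   = cong suc (cong₂ _⊔_ (rankΠ-neg A) (rankΠ-neg B))
  rankΠ-neg (lit _ _) = refl
  rankΠ-neg (A ∧ B)   = cong suc (cong₂ _⊔_ (rankΣ-neg A) (rankΣ-neg B))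
  rankΠ-neg (A ∨ B)   = cong₂ _⊔_ (rankΠ-neg A) (rankΠ-neg B)

  rankΣ≤ : (A : Fm V) → rankΣ A ≤ suc (rankΠ A)
  rankΠ≤ : (A : Fm V) → rankΠ A ≤ suc (rankΣ A)
  rankΣ≤ (lit _ _) = z≤n
  rankΣ≤ (A ∧ B)   = ≤-refl
  rankΣ≤ (A ∨ B)   = ≤-trans (n≤1+n _) (n≤1+n _)
  rankΠ≤ (lit _ _) = z≤n
  rankΠ≤ (A ∧ B)   = ≤-trans (n≤1+n _) (n≤1+n _)
  rankΠ≤ (A ∨ B)   = ≤-refl

  InΣ⇒rankΣ : ∀ t {A : Fm V} → InΣ t A → rankΣ A ≤ t
  InΠ⇒rankΠ : ∀ t {A : Fm V} → InΠ t A → rankΠ A ≤ t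
  InΣ⇒rankΣ zero    (isLit _ _) = z≤n
  InΣ⇒rankΣ (suc t) (leaf {F} p) = ≤-trans (rankΣ≤ F) (s≤s (InΠ⇒rankΠ t p))
  InΣ⇒rankΣ (suc t) (node p q)  = ⊔-lub (InΣ⇒rankΣ (suc t) p) (InΣ⇒rankΣ (suc t) q)
  InΠ⇒rankΠ zero    (isLit _ _) = z≤n
  InΠ⇒rankΠ (suc t) (leaf {F} p) = ≤-trans (rankΠ≤ F) (s≤s (InΣ⇒rankΣ t p))
  InΠ⇒rankΠ (suc t) (node p q)  = ⊔-lub (InΠ⇒rankΠ (suc t) p) (InΠ⇒rankΠ (suc t) q)

  disjuncts-rankΣ : (A : Fm V) {Y : Fm V} → Y ∈ disjuncts A → rankΣ Y ≤ rankΣ A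
  disjuncts-rankΣ (lit _ _) (here refl) = ≤-refl
  disjuncts-rankΣ (A ∧ B)   (here refl) = ≤-refl
  disjuncts-rankΣ (A ∨ B)   Y∈ with ∈-++⁻ (disjuncts A) Y∈
  ... | inj₁ p = ≤-trans (disjuncts-rankΣ A p) (m≤m⊔n _ _)
  ... | inj₂ p = ≤-trans (disjuncts-rankΣ B p) (m≤n⊔m (rankΣ A) _)

  data Conjunction : Fm V → Set where
    conjunction : ∀ A B → Conjunction (A ∧ B)

  -- The strict drop is what allows a conjunction to be evaluated from formulas that were evaluated
  -- at an earlier stage.
  disjuncts-neg-rankΣ : ∀ {A Y : Fm V} → Conjunction A → Y ∈ disjuncts (neg A) → rankΣ Y < rankΣ A
  disjuncts-neg-rankΣ (conjunction A B) Y∈ =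
    s≤s (≤-trans (disjuncts-rankΣ (neg (A ∧ B)) Y∈) (≤-reflexive (rankΣ-neg (A ∧ B))))

  -- A disjunction contributes its dual conjunction, because the soundness of cut and of the axioms
  -- compares a formula with its negation. One entry per connective keeps the list within the size
  -- of the formula; passing to the dual can raise the rank by one.
  conjunctions : Fm V → List (Fm V)
  conjunctions (lit _ _) = []
  conjunctions (A ∧ B)   = (A ∧ B) ∷ conjunctions A ++ conjunctions B
  conjunctions (A ∨ B)   = (neg A ∧ neg B) ∷ conjunctions A ++ conjunctions B

  length-conjunctions : (A : Fm V) → length (conjunctions A) ≤ fmSize A
  length-conjunctions (lit _ _) = z≤n
  length-conjunctions (A ∧ B)   = s≤s (≤-trans (≤-reflexive (length-++ (conjunctions A)))
    (+-mono-≤ (length-conjunctions A) (length-conjunctions B)))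
  length-conjunctions (A ∨ B)   = s≤s (≤-trans (≤-reflexive (length-++ (conjunctions A)))
    (+-mono-≤ (length-conjunctions A) (length-conjunctions B)))

  conjunctions-conjunction : (A : Fm V) {Z : Fm V} → Z ∈ conjunctions A → Conjunction Z
  conjunctions-conjunction (A ∧ B) (here refl) = conjunction A B
  conjunctions-conjunction (A ∧ B) (there p)   = [ conjunctions-conjunction A , conjunctions-conjunction B ]′ (∈-++⁻ (conjunctions A) p)
  conjunctions-conjunction (A ∨ B) (here refl) = conjunction (neg A) (neg B)
  conjunctions-conjunction (A ∨ B) (there p)   = [ conjunctions-conjunction A , conjunctions-conjunction B ]′ (∈-++⁻ (conjunctions A) p)

  conjunctions-rank : (A : Fm V) {Z : Fm V} → Z ∈ conjunctions A → rankΣ Z ≤ rankΣ A ⊔ rankΠ A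
  conjunctions-rank (A ∧ B) (here refl) = m≤m⊔n (rankΣ (A ∧ B)) (rankΠ (A ∧ B))
  conjunctions-rank (A ∧ B) (there p) with ∈-++⁻ (conjunctions A) p
  ... | inj₁ q = ≤-trans (conjunctions-rank A q) (≤-trans (⊔-lub (rankΣ≤ A) (n≤1+n _)) (≤-trans (s≤s (m≤m⊔n (rankΠ A) (rankΠ B))) (m≤m⊔n (rankΣ (A ∧ B)) (rankΠ (A ∧ B)))))
  ... | inj₂ q = ≤-trans (conjunctions-rank B q) (≤-trans (⊔-lub (rankΣ≤ B) (n≤1+n _)) (≤-trans (s≤s (m≤n⊔m (rankΠ A) (rankΠ B))) (m≤m⊔n (rankΣ (A ∧ B)) (rankΠ (A ∧ B)))))
  conjunctions-rank (A ∨ B) (here refl) = ≤-trans (≤-reflexive (rankΣ-neg (A ∨ B))) (m≤n⊔m (rankΣ (A ∨ B)) _)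
  conjunctions-rank (A ∨ B) (there p) with ∈-++⁻ (conjunctions A) p
  ... | inj₁ q = ≤-trans (conjunctions-rank A q) (≤-trans (⊔-lub (n≤1+n _) (rankΠ≤ A)) (≤-trans (s≤s (m≤m⊔n (rankΣ A) (rankΣ B))) (m≤n⊔m (rankΣ (A ∨ B)) _)))
  ... | inj₂ q = ≤-trans (conjunctions-rank B q) (≤-trans (⊔-lub (n≤1+n _) (rankΠ≤ B)) (≤-trans (s≤s (m≤n⊔m (rankΣ A) (rankΣ B))) (m≤n⊔m (rankΣ (A ∨ B)) _)))


  proof-conjunctions : List (Line V) → List (Fm V)
  proof-conjunctions π = concatMap (concatMap conjunctions) π

  length-proof-conjunctions : (π : List (Line V)) → length (proof-conjunctions π) ≤ proofSize π
  length-proof-conjunctions []      = z≤n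
  length-proof-conjunctions (ℓ ∷ π) = ≤-trans (≤-reflexive (length-++ (concatMap conjunctions ℓ)))
    (+-mono-≤ (line ℓ) (length-proof-conjunctions π))
    where
    line : (ℓ : Line V) → length (concatMap conjunctions ℓ) ≤ lineSize ℓ
    line []      = z≤n
    line (A ∷ ℓ) = ≤-trans (≤-reflexive (length-++ (conjunctions A))) (+-mono-≤ (length-conjunctions A) (line ℓ))

  fmSize-positive : (A : Fm V) → 1 ≤ fmSize A
  fmSize-positive (lit _ _) = s≤s z≤n
  fmSize-positive (_ ∧ _)   = s≤s z≤n
  fmSize-positive (_ ∨ _)   = s≤s z≤n

  -- Empty lines have size 0, so only the nonempty ones are bounded by the size of a proof.
  nonempty-lines : List (Line V) → List (Line V)
  nonempty-lines []             = []
  nonempty-lines ([] ∷ π)       = nonempty-lines π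
  nonempty-lines ((A ∷ ℓ) ∷ π)  = (A ∷ ℓ) ∷ nonempty-lines π

  length-nonempty-lines : (π : List (Line V)) → length (nonempty-lines π) ≤ proofSize π
  length-nonempty-lines []            = z≤n
  length-nonempty-lines ([] ∷ π)      = length-nonempty-lines π
  length-nonempty-lines ((A ∷ ℓ) ∷ π) = +-mono-≤ (≤-trans (fmSize-positive A) (m≤m+n _ _)) (length-nonempty-lines π)

  ∈-nonempty-lines : ∀ {A ℓ} (π : List (Line V)) → A ∷ ℓ ∈ π → A ∷ ℓ ∈ nonempty-lines π
  ∈-nonempty-lines ([] ∷ π)      (there p)   = ∈-nonempty-lines π p
  ∈-nonempty-lines ((A ∷ ℓ) ∷ π) (here refl) = here refl
  ∈-nonempty-lines ((A ∷ ℓ) ∷ π) (there p)   = there (∈-nonempty-lines π p)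

-- Partial matchings of n + 1 pigeons to n holes.

module Board (n : ℕ) where

  Edge : Set
  Edge = Fin (suc n) × Fin n

  Edges : Set
  Edges = List Edge

  infix 4 _≟ᴱ_
  _≟ᴱ_ : DecidableEquality Edge
  _≟ᴱ_ = ≡-dec Fin._≟_ Fin._≟_

  open DecMem _≟ᴱ_ using (_∈?_)

  infixl 5 _-_
  _-_ : Edges → Edges → Edges
  _-_ = _∖_ _≟ᴱ_

  Compat : Edge → Edge → Set
  Compat e f = (proj₁ e ≡ proj₁ f → e ≡ f) × (proj₂ e ≡ proj₂ f → e ≡ f)

  compat? : ∀ e f → Dec (Compat e f)
  compat? e f = ((proj₁ e Fin.≟ proj₁ f) →-dec (e ≟ᴱ f)) ×-dec ((proj₂ e Fin.≟ proj₂ f) →-dec (e ≟ᴱ f))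

  compat-refl : ∀ {e} → Compat e e
  compat-refl = (λ _ → refl) , (λ _ → refl)

  compat-sym : ∀ {e f} → Compat e f → Compat f e
  compat-sym (p , q) = (λ x → sym (p (sym x))) , (λ x → sym (q (sym x)))

  Cross : Edges → Edges → Set
  Cross t π = ∀ {e f} → e ∈ t → f ∈ π → Compat e f

  cross? : ∀ t π → Dec (Cross t π)
  cross? t π = map′ (λ a e∈ f∈ → All.lookup (All.lookup a e∈) f∈) (λ c → All.tabulate (λ e∈ → All.tabulate (c e∈)))
    (All.all? (λ e → All.all? (compat? e) π) t)

  -- Repeated edges are allowed: being a matching only depends on the set of entries.
  Matching : Edges → Set
  Matching π = Cross π π

  -- `π` itself is not asked to be a matching, so the test also makes sense for arbitrary candidate
  -- words.
  Consistent : Edges → Edges → Set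
  Consistent t π = Cross t (t ++ π)

  matching-⊆ : ∀ {π π′} → π ⊆ π′ → Matching π′ → Matching π
  matching-⊆ s m e∈ f∈ = m (s e∈) (s f∈)

  matching-++ : ∀ {π ρ} → Matching π → Cross π ρ → Matching ρ → Matching (π ++ ρ)
  matching-++ {π} mπ x mρ e∈ f∈ with ∈-++⁻ π e∈ | ∈-++⁻ π f∈
  ... | inj₁ a | inj₁ b = mπ a b
  ... | inj₁ a | inj₂ b = x a b
  ... | inj₂ a | inj₁ b = compat-sym (x b a)
  ... | inj₂ a | inj₂ b = mρ a b

  consistent-mono : ∀ {t π π′} → π ⊆ π′ → Consistent t π′ → Consistent t π
  consistent-mono {t} s c e∈ f∈ = c e∈ ([ ∈-++⁺ˡ , ∈-++⁺ʳ t ∘ s ]′ (∈-++⁻ t f∈))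

  ⊆-consistent : ∀ {t π π′} → Matching π′ → t ⊆ π′ → π ⊆ π′ → Consistent t π
  ⊆-consistent m s s′ e∈ f∈ = m (s e∈) (⊆-++ s s′ f∈)

  first : List Edges → Edges → Maybe Edges
  first []      π = nothing
  first (t ∷ F) π with cross? t (t ++ π)
  ... | yes _ = just t
  ... | no _  = first F π

  first-just : ∀ F {π t} → first F π ≡ just t → t ∈ F × Consistent t π
  first-just (t ∷ F) {π} eq with cross? t (t ++ π)
  first-just (t ∷ F) refl | yes c = here refl , c
  first-just (t ∷ F) eq   | no _  = there (proj₁ (first-just F eq)) , proj₂ (first-just F eq)

  first-nothing : ∀ F {π} → first F π ≡ nothing → ∀ {t} → t ∈ F → ¬ Consistent t π
  first-nothing (t ∷ F) {π} eq t∈ with cross? t (t ++ π)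
  first-nothing (t ∷ F) ()  t∈          | yes _
  first-nothing (t ∷ F) eq  (here refl) | no ¬c = ¬c
  first-nothing (t ∷ F) eq  (there t∈)  | no _  = first-nothing F eq t∈

  -- Terms rejected at `π` stay rejected at every larger `π′`. This is the key to decoding: a term
  -- met by the decision process is found again from the larger matching alone.
  first-mono : ∀ F {π π′ t} → π ⊆ π′ → first F π ≡ just t → Consistent t π′ → first F π′ ≡ just t
  first-mono (u ∷ F) {π} {π′} s eq c with cross? u (u ++ π) | cross? u (u ++ π′)
  first-mono (u ∷ F) s eq   c | yes _ | yes _  = eq
  first-mono (u ∷ F) s refl c | yes _ | no ¬c  = ⊥-elim (¬c c)
  first-mono (u ∷ F) s eq   c | no ¬c | yes c′ = ⊥-elim (¬c (consistent-mono s c′))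
  first-mono (u ∷ F) s eq   c | no _  | no _   = first-mono F s eq c

  resid : Edges → Edges → Edges
  resid t π = deduplicate _≟ᴱ_ (t - π)

  ∈-resid⁺ : ∀ {t π e} → e ∈ t → e ∉ π → e ∈ resid t π
  ∈-resid⁺ p q = ∈-deduplicate⁺ _≟ᴱ_ (∈-∖⁺ _≟ᴱ_ p q)

  ∈-resid⁻ : ∀ t π {e} → e ∈ resid t π → e ∈ t × e ∉ π
  ∈-resid⁻ t π p = ∈-∖⁻ _≟ᴱ_ t π (∈-deduplicate⁻ _≟ᴱ_ (t - π) p)

  resid-unique : ∀ t π → Unique (resid t π)
  resid-unique t π = DecUnique.deduplicate-! _≟ᴱ_ (t - π)

  -- The answers to the queries made for a term: for every unset edge, the partners of its pigeon
  -- and of its hole. With both endpoints matched, the edge is either present or violated, so the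
  -- term is decided. The two answers may be the same edge.
  data Cover : Edges → Edges → Set where
    []   : Cover [] []
    cons : ∀ {u v σ c} w w′ → Cover σ c → Cover ((u , v) ∷ σ) ((u , w) ∷ (w′ , v) ∷ c)

  coverings : List (Fin n) → List (Fin (suc n)) → Edges → List Edges
  coverings hs ps []            = [ [] ]
  coverings hs ps ((u , v) ∷ σ) =
    concatMap (λ w → concatMap (λ w′ → map (λ c → (u , w) ∷ (w′ , v) ∷ c) (coverings hs ps σ)) ps) hs

  ∈-coverings : ∀ {hs ps σ c} → Cover σ c → (∀ {e} → e ∈ c → proj₁ e ∈ ps × proj₂ e ∈ hs) → c ∈ coverings hs ps σ
  ∈-coverings []            s = here refl
  ∈-coverings (cons w w′ k) s =
    ∈-concatMap _ (proj₂ (s (here refl))) (∈-concatMap _ (proj₁ (s (there (here refl))))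
      (∈-map⁺ _ (∈-coverings k (s ∘ there ∘ there))))

  coverings-Cover : ∀ {hs ps} σ {c} → c ∈ coverings hs ps σ → Cover σ c
  coverings-Cover []            (here refl) = []
  coverings-Cover {hs} {ps} ((u , v) ∷ σ) p with ∈-concatMap⁻′ _ hs p
  ... | w , _ , q with ∈-concatMap⁻′ _ ps q
  ...   | w′ , _ , r with ∈-map⁻ _ r
  ...     | c , c∈ , refl = cons w w′ (coverings-Cover σ c∈)

  length-coverings : ∀ hs ps σ {l} → length hs ≤ l → length ps ≤ l → length (coverings hs ps σ) ≤ (l * l) ^ length σ
  length-coverings hs ps []      _ _ = ≤-refl
  length-coverings hs ps (e ∷ σ) {l} lh lp = begin
    length (coverings hs ps (e ∷ σ)) ≤⟨ length-concatMap-≤ _ hs (λ _ → inner) ⟩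
    length hs * (l * (l * l) ^ length σ) ≤⟨ *-monoˡ-≤ _ lh ⟩
    l * (l * (l * l) ^ length σ) ≡⟨ *-assoc l l _ ⟨
    l * l * (l * l) ^ length σ ∎
    where
    open ≤-Reasoning
    glue : Fin n → Fin (suc n) → Edges → Edges
    glue w w′ c = (proj₁ e , w) ∷ (w′ , proj₂ e) ∷ c
    inner : ∀ {w} → length (concatMap (λ w′ → map (glue w w′) (coverings hs ps σ)) ps) ≤ l * (l * l) ^ length σ
    inner {w} = ≤-trans
      (length-concatMap-≤ (λ w′ → map (glue w w′) (coverings hs ps σ)) ps
        (λ {w′} _ → ≤-trans (≤-reflexive (length-map (glue w w′) (coverings hs ps σ))) (length-coverings hs ps σ lh lp)))
      (*-monoˡ-≤ _ lp)

  cover-fst : ∀ {σ c u v} → Cover σ c → (u , v) ∈ σ → ∃ λ w → (u , w) ∈ c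
  cover-fst (cons w w′ k) (here refl) = w , here refl
  cover-fst (cons w w′ k) (there p)   = proj₁ (cover-fst k p) , there (there (proj₂ (cover-fst k p)))

  cover-snd : ∀ {σ c u v} → Cover σ c → (u , v) ∈ σ → ∃ λ w → (w , v) ∈ c
  cover-snd (cons w w′ k) (here refl) = w′ , there (here refl)
  cover-snd (cons w w′ k) (there p)   = proj₁ (cover-snd k p) , there (there (proj₂ (cover-snd k p)))

  cover-edge : ∀ {σ c e} → Cover σ c → e ∈ c → ∃ λ f → f ∈ σ × (proj₁ e ≡ proj₁ f ⊎ proj₂ e ≡ proj₂ f)
  cover-edge (cons w w′ k) (here refl)         = _ , here refl , inj₁ refl
  cover-edge (cons w w′ k) (there (here refl)) = _ , here refl , inj₂ refl
  cover-edge (cons w w′ k) (there (there p)) with cover-edge k p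
  ... | f , f∈ , q = f , there f∈ , q

  extend-pigeon : ∀ {π} p → Matching π → length π < n → ∃ λ h → Matching ((p , h) ∷ π)
  extend-pigeon {π} p m l with Any.any? (λ e → p Fin.≟ proj₁ e) π
  ... | yes a with find a
  ...   | (_ , h) , e∈ , refl = h , matching-⊆ (λ { (here refl) → e∈ ; (there q) → q }) m
  extend-pigeon {π} p m l | no ¬a with Any.any? (λ h → ¬? (DecMem._∈?_ Fin._≟_ h (map proj₂ π))) (allFin n)
  ... | yes b with find b
  ...   | h , _ , h∉ = h , matching-++ {[ p , h ]} (λ { (here refl) (here refl) → compat-refl })
          (λ { {f = f} (here refl) f∈ → (λ eq → ⊥-elim (¬a (lose f∈ eq))) , (λ { refl → ⊥-elim (h∉ (∈-map⁺ proj₂ f∈)) }) }) m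
  extend-pigeon {π} p m l | no ¬a | no ¬b = ⊥-elim (<-irrefl refl (<-≤-trans l all-used))
    where
    used : ∀ h → h ∈ map proj₂ π
    used h with DecMem._∈?_ Fin._≟_ h (map proj₂ π)
    ... | yes q = q
    ... | no ¬q = ⊥-elim (¬b (lose (∈-allFin h) ¬q))
    all-used : n ≤ length π
    all-used = subst₂ _≤_ (length-tabulate id) (length-map proj₂ π)
      (length-mono-⊆ (Unique.allFin⁺ n) (λ {h} _ → used h))

  extend-hole : ∀ {π} h → Matching π → length π < n → ∃ λ p → Matching ((p , h) ∷ π)
  extend-hole {π} h m l with Any.any? (λ e → h Fin.≟ proj₂ e) π
  ... | yes a with find a
  ...   | (p , _) , e∈ , refl = p , matching-⊆ (λ { (here refl) → e∈ ; (there q) → q }) m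
  extend-hole {π} h m l | no ¬a with Any.any? (λ p → ¬? (DecMem._∈?_ Fin._≟_ p (map proj₁ π))) (allFin (suc n))
  ... | yes b with find b
  ...   | p , _ , p∉ = p , matching-++ {[ p , h ]} (λ { (here refl) (here refl) → compat-refl })
          (λ { {f = f} (here refl) f∈ → (λ { refl → ⊥-elim (p∉ (∈-map⁺ proj₁ f∈)) }) , (λ eq → ⊥-elim (¬a (lose f∈ eq))) }) m
  extend-hole {π} h m l | no ¬a | no ¬b = ⊥-elim (<-irrefl refl (<-≤-trans l (≤-trans (n≤1+n n) all-used)))
    where
    used : ∀ p → p ∈ map proj₁ π
    used p with DecMem._∈?_ Fin._≟_ p (map proj₁ π)
    ... | yes q = q
    ... | no ¬q = ⊥-elim (¬b (lose (∈-allFin p) ¬q))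
    all-used : suc n ≤ length π
    all-used = subst₂ _≤_ (length-tabulate id) (length-map proj₁ π)
      (length-mono-⊆ (Unique.allFin⁺ (suc n)) (λ {p} _ → used p))

  extend-cover : ∀ {π} σ → Matching π → length π + 2 * length σ ≤ n →
    ∃ λ c → Cover σ c × Matching (c ++ π) × length c ≡ 2 * length σ
  extend-cover []            m _ = [] , [] , m , refl
  extend-cover {π} ((u , v) ∷ σ) m l
    with l′ ← subst (_≤ n) (trans (cong (length π +_) (*-suc 2 (length σ))) (trans (+-suc _ _) (cong suc (+-suc _ _)))) l
    with h , m₁ ← extend-pigeon u m (≤-trans (s≤s (m≤m+n _ _)) (≤-trans (n≤1+n _) l′))
    with p , m₂ ← extend-hole v m₁ (≤-trans (s≤s (s≤s (m≤m+n _ _))) l′)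
    with c , k , m₃ , lc ← extend-cover σ m₂ l′
    = (u , h) ∷ (p , v) ∷ c , cons h p k , matching-⊆ shift m₃ , trans (cong (2 +_) lc) (sym (*-suc 2 (length σ)))
    where
    shift : (u , h) ∷ (p , v) ∷ c ++ π ⊆ c ++ (p , v) ∷ (u , h) ∷ π
    shift (here refl)         = ∈-++⁺ʳ c (there (here refl))
    shift (there (here refl)) = ∈-++⁺ʳ c (here refl)
    shift (there (there q))   = [ ∈-++⁺ˡ , ∈-++⁺ʳ c ∘ there ∘ there ]′ (∈-++⁻ c q)

  -- The canonical decision process.

  matching? : ∀ π → Dec (Matching π)
  matching? π = cross? π π

  -- Bad j π says that the canonical decision process for the disjunction F, started at π, has a
  -- branch along which the terms it meets contribute at least j unset edges.
  data Bad (F : List Edges) : ℕ → Edges → Set where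
    stop : ∀ {j π t} → first F π ≡ just t → j ≤ length (resid t π) → Bad F j π
    step : ∀ {j π t c} → first F π ≡ just t → 1 ≤ length (resid t π) → length (resid t π) < j →
           Cover (resid t π) c → Matching (c ++ π) → Bad F (j ∸ length (resid t π)) (c ++ π) → Bad F j π

  just-≡ : {A : Set} {m : Maybe A} {x y : A} → m ≡ just x → m ≡ just y → x ≡ y
  just-≡ refl refl = refl

  -- `k` is fuel: every step meets at least one unset edge and so lowers `j`. Decidability lets the
  -- bad restrictions be filtered out of a list and counted.
  bad? : ∀ F k {j} → j ≤ k → ∀ π → Dec (Bad F j π)
  bad? F k {j} j≤k π with first F π in eq
  ... | nothing = no λ { (stop eq′ _) → absurd eq′ ; (step eq′ _ _ _ _ _) → absurd eq′ }
    where
    absurd : ∀ {t} → first F π ≡ just t → ⊥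
    absurd eq′ with trans (sym eq) eq′
    ... | ()
  ... | just t with j ≤? length (resid t π) | 1 ≤? length (resid t π)
  ...   | yes j≤ | _ = yes (stop eq j≤)
  ...   | no j≰  | no 1≰ = no λ { (stop eq′ p) → j≰ (subst (λ t → _ ≤ length (resid t π)) (just-≡ eq′ eq) p)
                               ; (step eq′ p _ _ _ _) → 1≰ (subst (λ t → _ ≤ length (resid t π)) (just-≡ eq′ eq) p) }
  bad? F zero    {j} j≤k π | just t | no j≰ | yes _ = ⊥-elim (j≰ (≤-trans j≤k z≤n))
  bad? F (suc k) {j} j≤k π | just t | no j≰ | yes 1≤ =
    map′ to from (Any.any? (λ c → matching? (c ++ π) ×-dec bad? F k small (c ++ π)) (coverings (allFin n) (allFin (suc n)) (resid t π)))
    where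
    small : j ∸ length (resid t π) ≤ k
    small = ≤-trans (∸-monoʳ-≤ j 1≤) (∸-monoˡ-≤ 1 j≤k)
    to : Any (λ c → Matching (c ++ π) × Bad F (j ∸ length (resid t π)) (c ++ π)) (coverings (allFin n) (allFin (suc n)) (resid t π)) → Bad F j π
    to a with find a
    ... | c , c∈ , m , b = step eq 1≤ (≰⇒> j≰) (coverings-Cover (resid t π) c∈) m b
    from : Bad F j π → Any (λ c → Matching (c ++ π) × Bad F (j ∸ length (resid t π)) (c ++ π)) (coverings (allFin n) (allFin (suc n)) (resid t π))
    from (stop eq′ p) = ⊥-elim (j≰ (subst (λ t → _ ≤ length (resid t π)) (just-≡ eq′ eq) p))
    from (step eq′ _ _ cov m b) with just-≡ eq′ eq
    ... | refl = lose (∈-coverings cov (λ _ → ∈-allFin _ , ∈-allFin _)) (m , b)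

  Settled : List Edges → Edges → Set
  Settled F π = (∃ λ t → t ∈ F × t ⊆ π) ⊎ (∀ {t} → t ∈ F → ¬ Consistent t π)

  -- The process starts from `ρ`, but its queries are answered compatibly with a larger `π`. The
  -- answers are collected in `y`, so that the disjunction is settled by `y ++ ρ` alone,
  -- independently of `π`; this makes `y` usable as a short term.
  record Decision (F : List Edges) (ρ π : Edges) (h : ℕ) : Set where
    constructor decision
    field
      {π′ y}   : Edges
      extends  : π ⊆ π′
      matching : Matching π′
      size     : length π′ ≤ h + length π
      size-y   : length y ≤ h
      reached  : y ++ ρ ⊆ π′
      settled  : Settled F (y ++ ρ)

  prolong : ∀ {F ρ π} c a b {j} → length c ≡ 2 * a → b + a ≡ j →
    Decision F (c ++ ρ) (c ++ π) (2 * b) → Decision F ρ π (2 * j)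
  prolong {F} {ρ} {π} c a b lc refl (decision {y = y} ext m sz szy re se) = decision {y = y ++ c} (ext ∘ ∈-++⁺ʳ c) m
    (≤-trans sz (≤-reflexive (begin
      2 * b + length (c ++ π)        ≡⟨ cong (2 * b +_) (trans (length-++ c) (cong (_+ length π) lc)) ⟩
      2 * b + (2 * a + length π)     ≡⟨ +-assoc (2 * b) (2 * a) _ ⟨
      2 * b + 2 * a + length π       ≡⟨ cong (_+ length π) (*-distribˡ-+ 2 b a) ⟨
      2 * (b + a) + length π         ∎)))
    (≤-trans (≤-reflexive (trans (length-++ y) (cong (length y +_) lc)))
      (≤-trans (+-monoˡ-≤ (2 * a) szy) (≤-reflexive (sym (*-distribˡ-+ 2 b a)))))
    (re ∘ subst (_ ∈_) (++-assoc y c ρ))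
    (subst (Settled F) (sym (++-assoc y c ρ)) se)
    where open ≡-Reasoning

  resid-empty : ∀ t π → ¬ 1 ≤ length (resid t π) → t ⊆ π
  resid-empty t π l {e} e∈ with e ∈? π
  ... | yes p = p
  ... | no ¬p = ⊥-elim (l (∈-length (∈-resid⁺ e∈ ¬p)))

  decide-step : ∀ F {t j ρ π} → first F ρ ≡ just t → 1 ≤ length (resid t ρ) → length (resid t ρ) < j →
    ¬ Bad F j ρ → ρ ⊆ π → Matching π → length π + 2 * j ≤ n →
    (∀ {π′ ρ′} → ¬ Bad F (j ∸ length (resid t ρ)) ρ′ → ρ′ ⊆ π′ → Matching π′ →
      length π′ + 2 * (j ∸ length (resid t ρ)) ≤ n → Decision F ρ′ π′ (2 * (j ∸ length (resid t ρ)))) →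
    Decision F ρ π (2 * j)
  decide-step F {t} {j} {ρ} {π} eq 1≤a a<j ¬b s m l ih =
    finish (extend-cover (resid t ρ) m (≤-trans (+-monoʳ-≤ (length π) (*-monoʳ-≤ 2 (<⇒≤ a<j))) l))
    where
    a : ℕ
    a = length (resid t ρ)
    finish : (∃ λ c → Cover (resid t ρ) c × Matching (c ++ π) × length c ≡ 2 * a) → Decision F ρ π (2 * j)
    finish (c , cov , mc , lc) = prolong c a (j ∸ a) lc (m∸n+n≡m (<⇒≤ a<j))
      (ih (λ b → ¬b (step eq 1≤a a<j cov (matching-⊆ s′ mc) b)) s′ mc (≤-trans (≤-reflexive room) l))
      where
      s′ : c ++ ρ ⊆ c ++ π
      s′ = ⊆-++ ∈-++⁺ˡ (∈-++⁺ʳ c ∘ s)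
      room : length (c ++ π) + 2 * (j ∸ a) ≡ length π + 2 * j
      room = begin
        length (c ++ π) + 2 * (j ∸ a)      ≡⟨ cong (_+ 2 * (j ∸ a)) (trans (length-++ c) (trans (+-comm (length c) _) (cong (length π +_) lc))) ⟩
        length π + 2 * a + 2 * (j ∸ a)     ≡⟨ +-assoc (length π) (2 * a) _ ⟩
        length π + (2 * a + 2 * (j ∸ a))   ≡⟨ cong (length π +_) (*-distribˡ-+ 2 a (j ∸ a)) ⟨
        length π + 2 * (a + (j ∸ a))       ≡⟨ cong (λ z → length π + 2 * z) (m+[n∸m]≡n (<⇒≤ a<j)) ⟩
        length π + 2 * j                   ∎
        where open ≡-Reasoning

  -- Since no branch is long, any answers will do, and they can be chosen to fit `π`. A term with
  -- `a` unset edges uses up `a` of the budget `j` and costs `2 * a` answers, whence the total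
  -- `2 * j`.
  ¬bad-decides : ∀ F k {j ρ π} → j ≤ k → ¬ Bad F j ρ → ρ ⊆ π → Matching π → length π + 2 * j ≤ n → Decision F ρ π (2 * j)
  ¬bad-decides F k {j} {ρ} {π} j≤k ¬b s m l with first F ρ in eq
  ... | nothing = decision {y = []} id m (m≤n+m _ _) z≤n s (inj₂ (first-nothing F eq))
  ... | just t with j ≤? length (resid t ρ) | 1 ≤? length (resid t ρ)
  ...   | yes j≤ | _      = ⊥-elim (¬b (stop eq j≤))
  ...   | no _   | no 1≰a = decision {y = []} id m (m≤n+m _ _) z≤n s (inj₁ (t , proj₁ (first-just F eq) , resid-empty t ρ 1≰a))
  ¬bad-decides F zero    j≤k ¬b s m l | just t | no j≰ | yes _   = ⊥-elim (j≰ (≤-trans j≤k z≤n))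
  ¬bad-decides F (suc k) {j} j≤k ¬b s m l | just t | no j≰ | yes 1≤a =
    decide-step F eq 1≤a (≰⇒> j≰) ¬b s m l (¬bad-decides F k (≤-trans (∸-monoʳ-≤ j 1≤a) (∸-monoˡ-≤ 1 j≤k)))

  -- The edges collected are those of the terms met, not the answers of the branch: adding them to
  -- the restriction makes these terms consistent again, so that the decoder can recognise them. The
  -- last term is truncated to make the length exactly `j`.
  path : ∀ {F j π} → Bad F j π → Edges
  path {j = j} {π} (stop {t = t} _ _)     = take j (resid t π)
  path {π = π} (step {t = t} _ _ _ _ _ b) = resid t π ++ path b

  record Fresh (σ π : Edges) : Set where
    constructor fresh
    field
      unique   : Unique σ
      new      : ∀ {e} → e ∈ σ → e ∉ π
      matching : Matching (σ ++ π)

  take-⊆ : ∀ {A : Set} j (xs : List A) → take j xs ⊆ xs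
  take-⊆ (suc j) (x ∷ xs) (here refl) = here refl
  take-⊆ (suc j) (x ∷ xs) (there p)   = there (take-⊆ j xs p)

  length-path : ∀ {F j π} (b : Bad F j π) → length (path b) ≡ j
  length-path {j = j} {π} (stop {t = t} _ j≤) = trans (length-take j (resid t π)) (m≤n⇒m⊓n≡m j≤)
  length-path {π = π} (step {t = t} _ _ a<j _ _ b) =
    trans (length-++ (resid t π)) (trans (cong (length (resid t π) +_) (length-path b)) (m+[n∸m]≡n (<⇒≤ a<j)))

  -- Every endpoint of the residual edges is covered by c, so later edges of the branch avoid them.
  covered-apart : ∀ {σ c σ′ π e f} → Cover σ c → Fresh σ′ (c ++ π) → e ∈ σ → f ∈ σ′ →
    proj₁ e ≢ proj₁ f × proj₂ e ≢ proj₂ f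
  covered-apart {σ} {c} {σ′} {e = u , v} {f} cov fr e∈ f∈ = fst-apart , snd-apart
    where
    open Fresh fr
    fst-apart : u ≢ proj₁ f
    fst-apart refl with cover-fst cov e∈
    ... | w , w∈ = new f∈ (∈-++⁺ˡ (subst (_∈ c) (proj₁ (matching (∈-++⁺ʳ σ′ (∈-++⁺ˡ w∈)) (∈-++⁺ˡ f∈)) refl) w∈))
    snd-apart : v ≢ proj₂ f
    snd-apart refl with cover-snd cov e∈
    ... | w , w∈ = new f∈ (∈-++⁺ˡ (subst (_∈ c) (proj₂ (matching (∈-++⁺ʳ σ′ (∈-++⁺ˡ w∈)) (∈-++⁺ˡ f∈)) refl) w∈))

  fresh-step : ∀ {F π t c σ′} → first F π ≡ just t → Matching π → Cover (resid t π) c →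
    Fresh σ′ (c ++ π) → Fresh (resid t π ++ σ′) π
  fresh-step {F} {π} {t} {c} {σ′} eq m cov fr = fresh
    (Unique.++⁺ (resid-unique t π) unique (λ { (p , q) → proj₁ (covered-apart cov fr p q) refl }))
    (λ e∈ → [ proj₂ ∘ ∈-resid⁻ t π , (λ q → new q ∘ ∈-++⁺ʳ c) ]′ (∈-++⁻ (resid t π) e∈))
    (subst Matching (sym (++-assoc (resid t π) σ′ π)) (matching-++
      (λ e∈ f∈ → agree (proj₁ (∈-resid⁻ t π e∈)) (∈-++⁺ˡ (proj₁ (∈-resid⁻ t π f∈))))
      (λ e∈ f∈ → [ (λ q → (λ p → ⊥-elim (proj₁ (covered-apart cov fr e∈ q) p)) , (λ p → ⊥-elim (proj₂ (covered-apart cov fr e∈ q) p)))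
                 , (λ q → agree (proj₁ (∈-resid⁻ t π e∈)) (∈-++⁺ʳ t q)) ]′ (∈-++⁻ σ′ f∈))
      (matching-⊆ (⊆-++ ∈-++⁺ˡ (∈-++⁺ʳ σ′ ∘ ∈-++⁺ʳ c)) matching)))
    where
    open Fresh fr
    agree : Consistent t π
    agree = proj₂ (first-just F eq)

  path-fresh : ∀ {F j π} → Matching π → (b : Bad F j π) → Fresh (path b) π
  path-fresh {F} {j} {π} m (stop {t = t} eq _) = fresh
    (Unique.take⁺ j (resid-unique t π))
    (λ e∈ → proj₂ (∈-resid⁻ t π (take-⊆ j _ e∈)))
    (matching-++ (λ e∈ f∈ → agree (in-t e∈) (∈-++⁺ˡ (in-t f∈))) (λ e∈ f∈ → agree (in-t e∈) (∈-++⁺ʳ t f∈)) m)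
    where
    agree : Consistent t π
    agree = proj₂ (first-just F eq)
    in-t : take j (resid t π) ⊆ t
    in-t e∈ = proj₁ (∈-resid⁻ t π (take-⊆ j _ e∈))
  path-fresh {F} m (step eq _ _ cov mc b) = fresh-step {F} eq m cov (path-fresh mc b)

  -- Recovering the path from the enlarged matching.

  module Decode (F : List Edges) (ps : List (Fin (suc n))) (hs : List (Fin n)) where

    options : Edges → List Edges
    options σ = coverings (hs ++ map proj₂ σ) (ps ++ map proj₁ σ) σ

    -- The decoder returns all paths that some advice could produce, so the length of the list
    -- bounds the advice. It takes the first term consistent with `τ` and lets `grow` guess the
    -- edges of the path in that term one by one. Either the path ends there, or a covering is
    -- guessed and put in place of these edges, which exposes the next term. Starting `grow` with
    -- one edge makes every round use up part of `j`.
    decode   : ℕ → Edges → List Edges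
    decodeAt : ℕ → Edges → Maybe Edges → List Edges
    grow     : ℕ → Edges → Edges → Edges → List Edges

    decode j τ = decodeAt j τ (first F τ)

    decodeAt _       τ nothing  = []
    decodeAt zero    τ (just t) = []
    decodeAt (suc j) τ (just t) = concatMap (λ e → grow j t [ e ] τ) t

    grow zero    t σ τ = [ σ ]
    grow (suc j) t σ τ = concatMap (λ e → grow j t (σ ++ [ e ]) τ) t
                      ++ concatMap (λ c → map (σ ++_) (decode (suc j) (c ++ (τ - σ)))) (options σ)

    ∈-grow-stop : ∀ xs {t σ τ} → xs ⊆ t → σ ++ xs ∈ grow (length xs) t σ τ
    ∈-grow-stop []       {σ = σ} s = here (++-identityʳ σ)
    ∈-grow-stop (x ∷ xs) {t} {σ} {τ} s = ∈-++⁺ˡ (∈-concatMap (λ e → grow (length xs) t (σ ++ [ e ]) τ) (s (here refl))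
      (subst (_∈ grow (length xs) t (σ ++ [ x ]) τ) (++-assoc σ [ x ] xs) (∈-grow-stop xs (s ∘ there))))

    ∈-grow-step : ∀ xs {t σ τ j c σ′} → xs ⊆ t → c ∈ options (σ ++ xs) → σ′ ∈ decode (suc j) (c ++ (τ - (σ ++ xs))) →
      (σ ++ xs) ++ σ′ ∈ grow (length xs + suc j) t σ τ
    ∈-grow-step [] {t} {σ} {τ} {j} s c∈ p rewrite ++-identityʳ σ = ∈-++⁺ʳ (concatMap (λ e → grow j t (σ ++ [ e ]) τ) t)
      (∈-concatMap (λ c → map (σ ++_) (decode (suc j) (c ++ (τ - σ)))) c∈ (∈-map⁺ (σ ++_) p))
    ∈-grow-step (x ∷ xs) {t} {σ} {τ} {j} {c} {σ′} s c∈ p rewrite sym (++-assoc σ [ x ] xs) =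
      ∈-++⁺ˡ (∈-concatMap (λ e → grow (length xs + suc j) t (σ ++ [ e ]) τ) (s (here refl)) (∈-grow-step xs (s ∘ there) c∈ p))

    ∈-decode-stop : ∀ σ {t τ} → first F τ ≡ just t → 1 ≤ length σ → σ ⊆ t → σ ∈ decode (length σ) τ
    ∈-decode-stop (x ∷ xs) {t} {τ} eq _ s rewrite eq =
      ∈-concatMap (λ e → grow (length xs) t [ e ] τ) (s (here refl)) (∈-grow-stop xs (s ∘ there))

    ∈-decode-step : ∀ σ {t τ j c σ′} → first F τ ≡ just t → 1 ≤ length σ → σ ⊆ t → c ∈ options σ → 1 ≤ j →
      σ′ ∈ decode j (c ++ (τ - σ)) → σ ++ σ′ ∈ decode (length σ + j) τ
    ∈-decode-step (x ∷ xs) {t} {τ} {suc j} eq _ s c∈ _ p rewrite eq =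
      ∈-concatMap (λ e → grow (length xs + suc j) t [ e ] τ) (s (here refl)) (∈-grow-step xs (s ∘ there) c∈ p)

    -- An invariant that keeps the advice independent of `n`. An endpoint of a guessed covering
    -- cannot be used by the rest of the matching, so it is a vertex free at the start, in `ps` or
    -- `hs`, or one released by removing the current edges. The covering touches all the released
    -- vertices again, so the same `ps` and `hs` serve in every round.
    Touching : Edges → Set
    Touching τ = (∀ p → p ∈ ps ⊎ p ∈ map proj₁ τ) × (∀ h → h ∈ hs ⊎ h ∈ map proj₂ τ)

    -- The first term consistent with τ is the one the process met at π: τ contains all of its residual
    -- edges, except at the end of the path, where every further edge of τ belongs to that term.
    path-decoded : ∀ {j π τ} (b : Bad F j π) → 1 ≤ j → Matching π → τ ⊆ path b ++ π → path b ++ π ⊆ τ →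
      Touching τ → path b ∈ decode j τ
    path-decoded {j} {π} {τ} b@(stop {t = t} eq j≤) 1≤j m τ⊆ ⊆τ _ =
      subst (λ i → path b ∈ decode i τ) (length-path b)
        (∈-decode-stop (path b) (first-mono F (⊆τ ∘ ∈-++⁺ʳ (path b)) eq agree) (subst (1 ≤_) (sym (length-path b)) 1≤j) in-t)
      where
      in-t : path b ⊆ t
      in-t e∈ = proj₁ (∈-resid⁻ t π (take-⊆ j _ e∈))
      agree : Consistent t τ
      agree e∈ f∈ with ∈-++⁻ t f∈
      ... | inj₁ q = proj₂ (first-just F eq) e∈ (∈-++⁺ˡ q)
      ... | inj₂ q = proj₂ (first-just F eq) e∈ ([ ∈-++⁺ˡ ∘ in-t , ∈-++⁺ʳ t ]′ (∈-++⁻ (path b) (τ⊆ q)))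
    path-decoded {j} {π} {τ} (step {t = t} {c} eq 1≤a a<j cov mc b) 1≤j m τ⊆ ⊆τ (tp , th) =
      subst (λ i → σ ++ path b ∈ decode i τ) (m+[n∸m]≡n (<⇒≤ a<j))
        (∈-decode-step σ (first-mono F (⊆τ ∘ ∈-++⁺ʳ (σ ++ path b)) eq agree) 1≤a (proj₁ ∘ ∈-resid⁻ t π)
          (∈-coverings cov (λ e∈ → fst-option e∈ , snd-option e∈)) (m<n⇒0<n∸m a<j)
          (path-decoded b (m<n⇒0<n∸m a<j) mc τ′⊆ ⊆τ′
            ((λ p → [ inj₁ , inj₂ ∘ fst-kept ]′ (tp p)) , (λ h → [ inj₁ , inj₂ ∘ snd-kept ]′ (th h)))))
      where
      σ : Edges
      σ = resid t π
      fr : Fresh (path b) (c ++ π)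
      fr = path-fresh mc b
      whole : Fresh (σ ++ path b) π
      whole = fresh-step {F} eq m cov fr
      t⊆ : t ⊆ σ ++ π
      t⊆ {e} e∈ with e ∈? π
      ... | yes p = ∈-++⁺ʳ σ p
      ... | no ¬p = ∈-++⁺ˡ (∈-resid⁺ e∈ ¬p)
      agree : Consistent t τ
      agree = ⊆-consistent (Fresh.matching whole) ([ ∈-++⁺ˡ ∘ ∈-++⁺ˡ , ∈-++⁺ʳ (σ ++ path b) ]′ ∘ ∈-++⁻ σ ∘ t⊆) τ⊆
      split : ∀ {e} → e ∈ τ → e ∈ σ ⊎ e ∈ path b ⊎ e ∈ π
      split e∈ with ∈-++⁻ (σ ++ path b) (τ⊆ e∈)
      ... | inj₂ q = inj₂ (inj₂ q)
      ... | inj₁ q with ∈-++⁻ σ q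
      ...   | inj₁ r = inj₁ r
      ...   | inj₂ r = inj₂ (inj₁ r)
      τ′ : Edges
      τ′ = c ++ (τ - σ)
      τ′⊆ : τ′ ⊆ path b ++ c ++ π
      τ′⊆ e∈ with ∈-++⁻ c e∈
      ... | inj₁ q = ∈-++⁺ʳ (path b) (∈-++⁺ˡ q)
      ... | inj₂ q with ∈-∖⁻ _≟ᴱ_ τ σ q
      ...   | r , e∉ with split r
      ...     | inj₁ x        = ⊥-elim (e∉ x)
      ...     | inj₂ (inj₁ x) = ∈-++⁺ˡ x
      ...     | inj₂ (inj₂ x) = ∈-++⁺ʳ (path b) (∈-++⁺ʳ c x)
      ⊆τ′ : path b ++ c ++ π ⊆ τ′
      ⊆τ′ e∈ with ∈-++⁻ (path b) e∈
      ... | inj₁ q = ∈-++⁺ʳ c (∈-∖⁺ _≟ᴱ_ (⊆τ (∈-++⁺ˡ (∈-++⁺ʳ σ q))) (λ x → proj₁ (covered-apart cov fr x q) refl))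
      ... | inj₂ q with ∈-++⁻ c q
      ...   | inj₁ r = ∈-++⁺ˡ r
      ...   | inj₂ r = ∈-++⁺ʳ c (∈-∖⁺ _≟ᴱ_ (⊆τ (∈-++⁺ʳ (σ ++ path b) r)) (λ x → proj₂ (∈-resid⁻ t π x) r))
      kept : ∀ {e} → e ∈ τ → e ∈ σ ⊎ e ∈ τ′
      kept {e} e∈ with e ∈? σ
      ... | yes x = inj₁ x
      ... | no ¬x = inj₂ (∈-++⁺ʳ c (∈-∖⁺ _≟ᴱ_ e∈ ¬x))
      fst-kept : ∀ {p} → p ∈ map proj₁ τ → p ∈ map proj₁ τ′
      fst-kept p∈ with ∈-map⁻ proj₁ p∈
      ... | e , e∈ , refl = [ (λ x → ∈-map⁺ proj₁ (∈-++⁺ˡ (proj₂ (cover-fst cov x)))) , ∈-map⁺ proj₁ ]′ (kept e∈)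
      snd-kept : ∀ {h} → h ∈ map proj₂ τ → h ∈ map proj₂ τ′
      snd-kept h∈ with ∈-map⁻ proj₂ h∈
      ... | e , e∈ , refl = [ (λ x → ∈-map⁺ proj₂ (∈-++⁺ˡ (proj₂ (cover-snd cov x)))) , ∈-map⁺ proj₂ ]′ (kept e∈)
      c-new : ∀ {e} → e ∈ c → e ∉ path b ++ π
      c-new e∈ q with ∈-++⁻ (path b) q
      ... | inj₁ x = Fresh.new fr x (∈-++⁺ˡ e∈)
      ... | inj₂ x with cover-edge cov e∈
      ...   | f , f∈ , inj₁ p = Fresh.new whole (∈-++⁺ˡ f∈) (subst (_∈ π) (proj₁ (Fresh.matching whole (∈-++⁺ʳ (σ ++ path b) x) (∈-++⁺ˡ (∈-++⁺ˡ f∈))) p) x)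
      ...   | f , f∈ , inj₂ p = Fresh.new whole (∈-++⁺ˡ f∈) (subst (_∈ π) (proj₂ (Fresh.matching whole (∈-++⁺ʳ (σ ++ path b) x) (∈-++⁺ˡ (∈-++⁺ˡ f∈))) p) x)
      in-c : ∀ {e} → e ∈ c → e ∈ path b ++ c ++ π
      in-c e∈ = ∈-++⁺ʳ (path b) (∈-++⁺ˡ e∈)
      rest : ∀ {e} → e ∈ path b ⊎ e ∈ π → e ∈ path b ++ c ++ π
      rest = [ ∈-++⁺ˡ , ∈-++⁺ʳ (path b) ∘ ∈-++⁺ʳ c ]′
      fst-option : ∀ {e} → e ∈ c → proj₁ e ∈ ps ++ map proj₁ σ
      fst-option {e} e∈ with tp (proj₁ e)
      ... | inj₁ p = ∈-++⁺ˡ p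
      ... | inj₂ q with ∈-map⁻ proj₁ q
      ...   | f , f∈ , p with split f∈
      ...     | inj₁ x = ∈-++⁺ʳ ps (subst (_∈ map proj₁ σ) (sym p) (∈-map⁺ proj₁ x))
      ...     | inj₂ x = ⊥-elim (c-new e∈ (subst (_∈ path b ++ π) (sym (proj₁ (Fresh.matching fr (in-c e∈) (rest x)) p)) ([ ∈-++⁺ˡ , ∈-++⁺ʳ (path b) ]′ x)))
      snd-option : ∀ {e} → e ∈ c → proj₂ e ∈ hs ++ map proj₂ σ
      snd-option {e} e∈ with th (proj₂ e)
      ... | inj₁ p = ∈-++⁺ˡ p
      ... | inj₂ q with ∈-map⁻ proj₂ q
      ...   | f , f∈ , p with split f∈
      ...     | inj₁ x = ∈-++⁺ʳ hs (subst (_∈ map proj₂ σ) (sym p) (∈-map⁺ proj₂ x))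
      ...     | inj₂ x = ⊥-elim (c-new e∈ (subst (_∈ path b ++ π) (sym (proj₂ (Fresh.matching fr (in-c e∈) (rest x)) p)) ([ ∈-++⁺ˡ , ∈-++⁺ʳ (path b) ]′ x)))

    module _ (r s l : ℕ) (1≤s : 1 ≤ s) (len-ps : length ps ≤ l) (len-hs : length hs ≤ l)
             (len-F : ∀ {t} → t ∈ F → length t ≤ r) where

      width : ℕ
      width = (l + s) * (l + s)

      -- The price of one edge of the path: `r` choices in its term, `width` choices for the new
      -- partners of its two endpoints, and a factor 2 for closing the group of edges or going on.
      branching : ℕ
      branching = 2 * (r * width)

      1≤width^ : ∀ a → 1 ≤ width ^ a
      1≤width^ a = ≤-trans (≤-reflexive (sym (^-zeroˡ a))) (^-monoˡ-≤ a (*-mono-≤ 1≤ 1≤))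
        where
        1≤ : 1 ≤ l + s
        1≤ = ≤-trans 1≤s (m≤n+m s l)

      length-options : ∀ σ → length σ ≤ s → length (options σ) ≤ width ^ length σ
      length-options σ σ≤ = length-coverings (hs ++ map proj₂ σ) (ps ++ map proj₁ σ) σ
        (≤-trans (≤-reflexive (length-++ hs)) (+-mono-≤ len-hs (≤-trans (≤-reflexive (length-map proj₂ σ)) σ≤)))
        (≤-trans (≤-reflexive (length-++ ps)) (+-mono-≤ len-ps (≤-trans (≤-reflexive (length-map proj₁ σ)) σ≤)))

      -- The covering of `σ` is guessed only when its group is closed, so `width ^ length σ` records
      -- the factors still owed for the edges guessed so far.
      length-grow : ∀ j t σ τ → length t ≤ r → length σ + j ≤ s → length (grow j t σ τ) ≤ width ^ length σ * branching ^ j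
      length-decode : ∀ j τ → suc j ≤ s → length (decode (suc j) τ) ≤ r * (width * branching ^ j)

      length-grow zero    t σ τ _   _ = ≤-trans (1≤width^ (length σ)) (≤-reflexive (sym (*-identityʳ _)))
      length-grow (suc j) t σ τ len fit = begin
        length (concatMap more t ++ concatMap again (options σ))
          ≡⟨ length-++ (concatMap more t) ⟩
        length (concatMap more t) + length (concatMap again (options σ))
          ≤⟨ +-mono-≤ (length-concatMap-≤ more t len-more) (length-concatMap-≤ again (options σ) len-again) ⟩
        length t * (w * W * b) + length (options σ) * (r * (w * b))
          ≤⟨ +-mono-≤ (*-monoˡ-≤ _ len) (*-monoˡ-≤ _ (length-options σ (≤-trans (m≤m+n _ _) fit))) ⟩
        r * (w * W * b) + W * (r * (w * b))
          ≡⟨ solve 4 (λ r w W b → r :* (w :* W :* b) :+ W :* (r :* (w :* b)) := W :* (con 2 :* (r :* w) :* b)) refl r w W b ⟩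
        W * (branching * b) ∎
        where
        open ≤-Reasoning
        open +-*-Solver
        w W b : ℕ
        w = width
        W = width ^ length σ
        b = branching ^ j
        more : Edge → List Edges
        more e = grow j t (σ ++ [ e ]) τ
        again : Edges → List Edges
        again c = map (σ ++_) (decode (suc j) (c ++ (τ - σ)))
        len-σe : ∀ e → length (σ ++ [ e ]) ≡ suc (length σ)
        len-σe e = trans (length-++ σ) (+-comm _ 1)
        len-more : ∀ {e} → e ∈ t → length (more e) ≤ w * W * b
        len-more {e} _ = ≤-trans
          (length-grow j t (σ ++ [ e ]) τ len (≤-trans (≤-reflexive (trans (cong (_+ j) (len-σe e)) (sym (+-suc (length σ) j)))) fit))
          (≤-reflexive (cong (λ a → width ^ a * b) (len-σe e)))
        len-again : ∀ {c} → c ∈ options σ → length (again c) ≤ r * (w * b)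
        len-again {c} _ = ≤-trans (≤-reflexive (length-map (σ ++_) (decode (suc j) (c ++ (τ - σ)))))
          (length-decode j (c ++ (τ - σ)) (≤-trans (m≤n+m _ (length σ)) fit))

      length-decode j τ fit with first F τ in eq
      ... | nothing = z≤n
      ... | just t  = ≤-trans (length-concatMap-≤ (λ e → grow j t [ e ] τ) t
              (λ {e} _ → ≤-trans (length-grow j t [ e ] τ len fit) (≤-reflexive (cong (_* branching ^ j) (*-identityʳ width)))))
              (*-monoˡ-≤ _ len)
        where
        len : length t ≤ r
        len = len-F (proj₁ (first-just F eq))

      length-decode-≤ : ∀ j τ → j ≤ s → length (decode j τ) ≤ branching ^ j
      length-decode-≤ zero    τ _   with first F τ
      ... | nothing = z≤n
      ... | just _  = z≤n
      length-decode-≤ (suc j) τ fit = ≤-trans (length-decode j τ fit) (≤-trans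
        (≤-reflexive (sym (*-assoc r width (branching ^ j))))
        (*-monoˡ-≤ _ (m≤m+n (r * width) _)))

  -- Restrictions and their number.

  record Exact (π : Edges) : Set where
    constructor exact
    field
      unique   : Unique π
      matching : Matching π

  free-pigeons : Edges → List (Fin (suc n))
  free-pigeons π = _∖_ Fin._≟_ (allFin (suc n)) (map proj₁ π)

  free-holes : Edges → List (Fin n)
  free-holes π = _∖_ Fin._≟_ (allFin n) (map proj₂ π)

  length-free-pigeons : ∀ {π} → Exact π → length π + length (free-pigeons π) ≡ suc n
  length-free-pigeons {π} (exact u m) = trans (cong (_+ length (free-pigeons π)) (sym (length-map proj₁ π))) (trans
    (length-∖ Fin._≟_ (Unique.allFin⁺ (suc n)) (unique-map proj₁ u (λ p q → proj₁ (m p q))) (λ _ → ∈-allFin _))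
    (length-tabulate {n = suc n} id))

  length-free-holes : ∀ {π} → Exact π → length π + length (free-holes π) ≡ n
  length-free-holes {π} (exact u m) = trans (cong (_+ length (free-holes π)) (sym (length-map proj₂ π))) (trans
    (length-∖ Fin._≟_ (Unique.allFin⁺ n) (unique-map proj₂ u (λ p q → proj₂ (m p q))) (λ _ → ∈-allFin _))
    (length-tabulate {n = n} id))

  free-edges : Edges → Edges
  free-edges π = cartesianProduct (free-pigeons π) (free-holes π)

  free-edge : ∀ {π e} → e ∈ free-edges π → proj₁ e ∉ map proj₁ π × proj₂ e ∉ map proj₂ π
  free-edge {π} e∈ with ∈-cartesianProduct⁻ (free-pigeons π) (free-holes π) e∈
  ... | p∈ , h∈ = proj₂ (∈-∖⁻ Fin._≟_ (allFin (suc n)) (map proj₁ π) p∈) , proj₂ (∈-∖⁻ Fin._≟_ (allFin n) (map proj₂ π) h∈)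

  exact-∷ : ∀ {π e} → e ∈ free-edges π → Exact π → Exact (e ∷ π)
  exact-∷ {π} {e} e∈ (exact u m) = exact (All.tabulate (λ { f∈ refl → proj₁ (free-edge e∈) (∈-map⁺ proj₁ f∈) }) ∷ u)
    (matching-++ {[ e ]} (λ { (here refl) (here refl) → compat-refl })
      (λ { (here refl) f∈ → (λ { q → ⊥-elim (proj₁ (free-edge {π} e∈) (subst (_∈ map proj₁ π) (sym q) (∈-map⁺ proj₁ f∈))) })
                          , (λ { q → ⊥-elim (proj₂ (free-edge {π} e∈) (subst (_∈ map proj₂ π) (sym q) (∈-map⁺ proj₂ f∈))) }) }) m)

  exact-tail : ∀ {π e} → Exact (e ∷ π) → Exact π × e ∈ free-edges π
  exact-tail {π} {e} (exact (e∉ ∷ u) m) = exact u (matching-⊆ there m)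
    , ∈-cartesianProduct⁺ (∈-∖⁺ Fin._≟_ (∈-allFin _) fst-new) (∈-∖⁺ Fin._≟_ (∈-allFin _) snd-new)
    where
    fst-new : proj₁ e ∉ map proj₁ π
    fst-new p with ∈-map⁻ proj₁ p
    ... | f , f∈ , q = All.lookup e∉ f∈ (proj₁ (m (here refl) (there f∈)) q)
    snd-new : proj₂ e ∉ map proj₂ π
    snd-new p with ∈-map⁻ proj₂ p
    ... | f , f∈ , q = All.lookup e∉ f∈ (proj₂ (m (here refl) (there f∈)) q)

  module Restrict (ρ : Edges) (exact-ρ : Exact ρ) where

    -- Restrictions are counted as sequences of edges, in order of choice.
    restrictions : ℕ → List Edges
    restrictions zero    = [ [] ]
    restrictions (suc m) = concatMap (λ xs → map (_∷ xs) (free-edges (xs ++ ρ))) (restrictions m)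

    ∈-restrictions⁻ : ∀ m {xs} → xs ∈ restrictions m → length xs ≡ m × Exact (xs ++ ρ)
    ∈-restrictions⁻ zero    (here refl) = refl , exact-ρ
    ∈-restrictions⁻ (suc m) p with ∈-concatMap⁻′ (λ xs → map (_∷ xs) (free-edges (xs ++ ρ))) (restrictions m) p
    ... | xs , xs∈ , q with ∈-map⁻ (_∷ xs) q
    ...   | e , e∈ , refl with ∈-restrictions⁻ m xs∈
    ...     | len , ex = cong suc len , exact-∷ e∈ ex

    ∈-restrictions⁺ : ∀ xs → Exact (xs ++ ρ) → xs ∈ restrictions (length xs)
    ∈-restrictions⁺ []       _  = here refl
    ∈-restrictions⁺ (e ∷ xs) ex with exact-tail ex
    ... | ex′ , e∈ = ∈-concatMap (λ xs → map (_∷ xs) (free-edges (xs ++ ρ))) (∈-restrictions⁺ xs ex′) (∈-map⁺ (_∷ xs) e∈)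

    unique-restrictions : ∀ m → Unique (restrictions m)
    unique-restrictions zero    = [] ∷ []
    unique-restrictions (suc m) = unique-concatMap (λ xs → map (_∷ xs) (free-edges (xs ++ ρ))) tail (unique-restrictions m)
      (λ {xs} _ → Unique.map⁺ (λ { refl → refl }) (Unique.cartesianProduct⁺
        (unique-∖ Fin._≟_ (map proj₁ (xs ++ ρ)) (Unique.allFin⁺ (suc n))) (unique-∖ Fin._≟_ (map proj₂ (xs ++ ρ)) (Unique.allFin⁺ n))))
      inv
      where
      tail : Edges → Edges
      tail []       = []
      tail (_ ∷ xs) = xs
      inv : ∀ {xs ys} → xs ∈ restrictions m → ys ∈ map (_∷ xs) (free-edges (xs ++ ρ)) → tail ys ≡ xs
      inv {xs} _ p with ∈-map⁻ (_∷ xs) p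
      ... | e , _ , refl = refl

    -- After at least `m` choices at most `l` holes and `suc l` pigeons are free, which bounds the
    -- number of continuations by one more edge.
    restrictions-growth : ∀ m l j → length ρ + (m + l) ≡ n →
      length (restrictions (j + m)) ≤ length (restrictions m) * (suc l * l) ^ j
    restrictions-growth m l zero    eq = ≤-reflexive (sym (*-identityʳ _))
    restrictions-growth m l (suc j) eq = begin
      length (restrictions (suc j + m))
        ≤⟨ length-concatMap-≤ (λ xs → map (_∷ xs) (free-edges (xs ++ ρ))) (restrictions (j + m)) bound ⟩
      length (restrictions (j + m)) * (suc l * l)
        ≤⟨ *-monoˡ-≤ _ (restrictions-growth m l j eq) ⟩
      length (restrictions m) * (suc l * l) ^ j * (suc l * l)
        ≡⟨ *-assoc (length (restrictions m)) _ _ ⟩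
      length (restrictions m) * ((suc l * l) ^ j * (suc l * l))
        ≡⟨ cong (length (restrictions m) *_) (*-comm _ (suc l * l)) ⟩
      length (restrictions m) * (suc l * l) ^ suc j ∎
      where
      open ≤-Reasoning
      bound : ∀ {xs} → xs ∈ restrictions (j + m) → length (map (_∷ xs) (free-edges (xs ++ ρ))) ≤ suc l * l
      bound {xs} xs∈ with ∈-restrictions⁻ (j + m) xs∈
      ... | len , ex = ≤-trans (≤-reflexive (trans (length-map (_∷ xs) (free-edges (xs ++ ρ)))
              (length-cartesianProduct (free-pigeons (xs ++ ρ)) (free-holes (xs ++ ρ)))))
              (*-mono-≤ (cap (suc l) (≤-trans (≤-reflexive (trans (length-free-pigeons ex) (cong suc (sym eq)))) (≤-reflexive (sym (trans (cong (length ρ +_) (+-suc m l)) (+-suc (length ρ) _))))))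
                        (cap l (≤-reflexive (trans (length-free-holes ex) (sym eq)))))
        where
        cap : ∀ {x} y → length (xs ++ ρ) + x ≤ length ρ + (m + y) → x ≤ y
        cap {x} y q = +-cancelˡ-≤ (length ρ + m) x y (begin
          length ρ + m + x         ≤⟨ +-monoˡ-≤ x (+-monoʳ-≤ (length ρ) (≤-trans (m≤n+m m j) (≤-reflexive (sym len)))) ⟩
          length ρ + length xs + x ≡⟨ cong (_+ x) (trans (+-comm (length ρ) _) (sym (length-++ xs))) ⟩
          length (xs ++ ρ) + x     ≤⟨ q ⟩
          length ρ + (m + y)       ≡⟨ +-assoc (length ρ) m y ⟨
          length ρ + m + y         ∎)

    restriction-exists : ∀ m → length ρ + m ≤ n → ∃ λ xs → xs ∈ restrictions m
    restriction-exists zero    _ = [] , here refl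
    restriction-exists (suc m) l with restriction-exists m (≤-trans (+-monoʳ-≤ (length ρ) (n≤1+n m)) l)
    ... | xs , xs∈ with ∈-restrictions⁻ m xs∈
    ...   | len , ex = nonempty (free-edges (xs ++ ρ)) refl
      where
      open ≤-Reasoning
      room : length (xs ++ ρ) < n
      room = begin-strict
        length (xs ++ ρ)     ≡⟨ trans (length-++ xs) (trans (cong (_+ length ρ) len) (+-comm m _)) ⟩
        length ρ + m         <⟨ ≤-reflexive (sym (+-suc (length ρ) m)) ⟩
        length ρ + suc m     ≤⟨ l ⟩
        n                    ∎
      positive : ∀ {x k} → length (xs ++ ρ) + x ≡ k → n ≤ k → 1 ≤ x
      positive {zero}  refl q = ⊥-elim (<⇒≱ room (≤-trans q (≤-reflexive (+-identityʳ _))))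
      positive {suc _} _    _ = s≤s z≤n
      some : 1 ≤ length (free-edges (xs ++ ρ))
      some = ≤-trans (*-mono-≤ (positive (length-free-pigeons ex) (n≤1+n n)) (positive (length-free-holes ex) ≤-refl))
        (≤-reflexive (sym (length-cartesianProduct (free-pigeons (xs ++ ρ)) (free-holes (xs ++ ρ)))))
      nonempty : ∀ es → free-edges (xs ++ ρ) ≡ es → ∃ λ ys → ys ∈ restrictions (suc m)
      nonempty []      eq with subst (λ es → 1 ≤ length es) eq some
      ... | ()
      nonempty (e ∷ _) eq = e ∷ xs , ∈-concatMap (λ xs → map (_∷ xs) (free-edges (xs ++ ρ))) xs∈ (∈-map⁺ (_∷ xs) (subst (e ∈_) (sym eq) (here refl)))

    touching : ∀ F τ → Decode.Touching F (free-pigeons τ) (free-holes τ) τ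
    touching F τ = (λ p → tp p) , (λ h → th h)
      where
      tp : ∀ p → p ∈ free-pigeons τ ⊎ p ∈ map proj₁ τ
      tp p with DecMem._∈?_ Fin._≟_ p (map proj₁ τ)
      ... | yes q = inj₂ q
      ... | no ¬q = inj₁ (∈-∖⁺ Fin._≟_ (∈-allFin p) ¬q)
      th : ∀ h → h ∈ free-holes τ ⊎ h ∈ map proj₂ τ
      th h with DecMem._∈?_ Fin._≟_ h (map proj₂ τ)
      ... | yes q = inj₂ q
      ... | no ¬q = inj₁ (∈-∖⁺ Fin._≟_ (∈-allFin h) ¬q)

    -- Encoding bad restrictions.

    module _ (F : List Edges) (s : ℕ) where

      bad-at? : ∀ xs → Dec (Bad F s (xs ++ ρ))
      bad-at? xs = bad? F s ≤-refl (xs ++ ρ)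

      -- A bad restriction may have many bad branches; taking the one found by the decision
      -- procedure makes the encoding a function of `xs`.
      path-at : Edges → Edges
      path-at xs with bad-at? xs
      ... | yes b = path b
      ... | no _  = []

      path-at-bad : ∀ xs → Bad F s (xs ++ ρ) → ∃ λ (b : Bad F s (xs ++ ρ)) → path-at xs ≡ path b
      path-at-bad xs b with bad-at? xs
      ... | yes b′ = b′ , refl
      ... | no ¬b  = ⊥-elim (¬b b)

      decode-at : Edges → List Edges
      decode-at τ = Decode.decode F (free-pigeons (τ ++ ρ)) (free-holes (τ ++ ρ)) s (τ ++ ρ)

      bads : ℕ → List Edges
      bads m = filter bad-at? (restrictions m)

      -- Double counting of pairs formed by a bad restriction and one of its shuffles. Each
      -- restriction contributes many pairs through `merge`; each shuffle admits few partners, those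
      -- listed by `unmerge`.
      merge : Edges → List (Edges × Edges)
      merge xs = map (xs ,_) (shuffles (path-at xs) xs)

      unmerge : Edges → List (Edges × Edges)
      unmerge τ = map (λ σ → (τ - σ) , τ) (decode-at τ)

      module _ (1≤s : 1 ≤ s) {m : ℕ} {xs : Edges} (xs∈ : xs ∈ bads m) where

        private
          in-bads : xs ∈ restrictions m × Bad F s (xs ++ ρ)
          in-bads = ∈-filter⁻ bad-at? {xs = restrictions m} xs∈

          σ : Edges
          σ = path-at xs

          b : Bad F s (xs ++ ρ)
          b = proj₁ (path-at-bad xs (proj₂ in-bads))

          σ≡ : σ ≡ path b
          σ≡ = proj₂ (path-at-bad xs (proj₂ in-bads))

          ex : Exact (xs ++ ρ)
          ex = proj₂ (∈-restrictions⁻ m (proj₁ in-bads))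

          fr : Fresh σ (xs ++ ρ)
          fr = subst (λ σ → Fresh σ (xs ++ ρ)) (sym σ≡) (path-fresh (Exact.matching ex) b)

        path-at-length : length σ ≡ s
        path-at-length = trans (cong length σ≡) (length-path b)

        path-at-exact : Exact (σ ++ xs ++ ρ)
        path-at-exact = exact (Unique.++⁺ (Fresh.unique fr) (Exact.unique ex) (λ { (p , q) → Fresh.new fr p q })) (Fresh.matching fr)

        module _ {τ : Edges} (τ∈ : τ ∈ shuffles σ xs) where

          private
            τ↭ : τ ++ ρ ↭ σ ++ xs ++ ρ
            τ↭ = ↭-trans (↭.++⁺ʳ ρ (shuffles-↭ σ xs τ∈)) (↭-reflexive (++-assoc σ xs ρ))

          shuffle-length : length τ ≡ s + m
          shuffle-length = trans (↭.↭-length (shuffles-↭ σ xs τ∈)) (trans (length-++ σ)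
            (cong₂ _+_ path-at-length (proj₁ (∈-restrictions⁻ m (proj₁ in-bads)))))

          shuffle-exact : Exact (τ ++ ρ)
          shuffle-exact = exact (↭ₛ.Unique-resp-↭ (setoid Edge) (↭⇒↭ₛ (↭-sym τ↭)) (Exact.unique path-at-exact))
            (matching-⊆ (↭.∈-resp-↭ τ↭) (Exact.matching path-at-exact))

          shuffle-restriction : τ ∈ restrictions (s + m)
          shuffle-restriction = subst (λ k → τ ∈ restrictions k) shuffle-length (∈-restrictions⁺ τ shuffle-exact)

          shuffle-decoded : σ ∈ decode-at τ
          shuffle-decoded = subst (_∈ decode-at τ) (sym σ≡) (Decode.path-decoded F (free-pigeons (τ ++ ρ)) (free-holes (τ ++ ρ))
            b 1≤s (Exact.matching ex)
            (λ p → subst (λ σ → _ ∈ σ ++ xs ++ ρ) σ≡ (↭.∈-resp-↭ τ↭ p))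
            (λ p → ↭.∈-resp-↭ (↭-sym τ↭) (subst (λ σ → _ ∈ σ ++ xs ++ ρ) (sym σ≡) p))
            (touching F (τ ++ ρ)))

          shuffle-undone : xs ≡ τ - σ
          shuffle-undone = sym (trans (shuffles-∖ _≟ᴱ_ σ xs σ id τ∈) (∖-fresh _≟ᴱ_ xs σ (λ p q → Fresh.new fr q (∈-++⁺ˡ p))))

        merge-unique : Unique (merge xs)
        merge-unique = Unique.map⁺ (λ { refl → refl }) (unique-shuffles _≟ᴱ_ σ xs
          (++-unique⁻ (subst Unique (sym (++-assoc σ xs ρ)) (Exact.unique path-at-exact))))
          where
          ++-unique⁻ : ∀ {as bs : Edges} → Unique (as ++ bs) → Unique as
          ++-unique⁻ {[]}     _        = []
          ++-unique⁻ {a ∷ as} (a∉ ∷ u) = All.++⁻ˡ as a∉ ∷ ++-unique⁻ u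

        merge-⊆ : merge xs ⊆ concatMap unmerge (restrictions (s + m))
        merge-⊆ p with ∈-map⁻ (xs ,_) p
        ... | τ , τ∈ , refl = ∈-concatMap unmerge (shuffle-restriction τ∈)
              (subst (λ ys → (ys , τ) ∈ unmerge τ) (sym (shuffle-undone τ∈)) (∈-map⁺ (λ σ → (τ - σ) , τ) (shuffle-decoded τ∈)))

        length-merge : suc m ^ s ≤ length (merge xs)
        length-merge = ≤-trans (≤-reflexive (cong₂ (λ a b → suc a ^ b) (sym (proj₁ (∈-restrictions⁻ m (proj₁ in-bads)))) (sym path-at-length)))
          (≤-trans (length-shuffles σ xs) (≤-reflexive (sym (length-map (xs ,_) (shuffles σ xs)))))

      -- A bad restriction is recovered from any shuffle of it with its bad path, given a short advice string.
      bads-count : ∀ r m l → 1 ≤ s → length ρ + (m + l) ≡ n → (∀ {t} → t ∈ F → length t ≤ r) →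
        length (bads m) * suc m ^ s ≤
        length (restrictions m) * ((suc l * l) ^ s * (2 * (r * ((suc l + s) * (suc l + s)))) ^ s)
      bads-count r m l 1≤s eq len-F = begin
        length (bads m) * suc m ^ s
          ≤⟨ length-concatMap-≥ merge (bads m) (λ xs∈ → length-merge 1≤s {m} xs∈) ⟩
        length (concatMap merge (bads m))
          ≤⟨ length-mono-⊆ pairs-unique pairs-⊆ ⟩
        length (concatMap unmerge (restrictions (s + m)))
          ≤⟨ length-concatMap-≤ unmerge (restrictions (s + m)) advice ⟩
        length (restrictions (s + m)) * c ^ s
          ≤⟨ *-monoˡ-≤ (c ^ s) (restrictions-growth m l s eq) ⟩
        length (restrictions m) * (suc l * l) ^ s * c ^ s
          ≡⟨ *-assoc (length (restrictions m)) _ _ ⟩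
        length (restrictions m) * ((suc l * l) ^ s * c ^ s) ∎
        where
        open ≤-Reasoning
        c : ℕ
        c = 2 * (r * ((suc l + s) * (suc l + s)))
        pairs-unique : Unique (concatMap merge (bads m))
        pairs-unique = unique-concatMap merge proj₁ (Unique.filter⁺ bad-at? (unique-restrictions m))
          (λ xs∈ → merge-unique 1≤s {m} xs∈) (λ {xs} _ p → cong proj₁ (proj₂ (proj₂ (∈-map⁻ (xs ,_) p))))
        pairs-⊆ : concatMap merge (bads m) ⊆ concatMap unmerge (restrictions (s + m))
        pairs-⊆ p with ∈-concatMap⁻′ merge (bads m) p
        ... | xs , xs∈ , q = merge-⊆ 1≤s xs∈ q
        free-≤ : ∀ {τ x k} → length τ ≡ s + m → length (τ ++ ρ) + x ≡ k → k ≤ suc n → x ≤ suc l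
        free-≤ {τ} {x} len refl q = +-cancelˡ-≤ (length ρ + m) x (suc l) (begin
          length ρ + m + x            ≤⟨ +-monoˡ-≤ x (+-monoʳ-≤ (length ρ) (m≤n+m m s)) ⟩
          length ρ + (s + m) + x      ≡⟨ cong (λ z → length ρ + z + x) len ⟨
          length ρ + length τ + x     ≡⟨ cong (_+ x) (trans (+-comm (length ρ) _) (sym (length-++ τ))) ⟩
          length (τ ++ ρ) + x         ≤⟨ q ⟩
          suc n                       ≡⟨ cong suc eq ⟨
          suc (length ρ + (m + l))    ≡⟨ cong suc (+-assoc (length ρ) m l) ⟨
          suc (length ρ + m + l)      ≡⟨ +-suc (length ρ + m) l ⟨
          length ρ + m + suc l        ∎)
        advice : ∀ {τ} → τ ∈ restrictions (s + m) → length (unmerge τ) ≤ c ^ s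
        advice {τ} τ∈ with ∈-restrictions⁻ (s + m) τ∈
        ... | len , ex = ≤-trans (≤-reflexive (length-map _ (decode-at τ)))
          (Decode.length-decode-≤ F (free-pigeons (τ ++ ρ)) (free-holes (τ ++ ρ)) r s (suc l) 1≤s
            (free-≤ {τ} len (length-free-pigeons ex) ≤-refl) (free-≤ {τ} len (length-free-holes ex) (n≤1+n n)) len-F s (τ ++ ρ) ≤-refl)

    -- The switching lemma, simultaneously for fewer than 2^s disjunctions.
    switching : ∀ (𝓕 : List (List Edges)) r s m l → 1 ≤ s → 1 ≤ r → 1 ≤ l → length ρ + (m + l) ≡ n →
      (∀ {F t} → F ∈ 𝓕 → t ∈ F → length t ≤ r) → length 𝓕 < 2 ^ s →
      2 * (suc l * l * (2 * (r * ((suc l + s) * (suc l + s))))) ≤ suc m →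
      ∃ λ xs → length xs ≡ m × Exact (xs ++ ρ) × (∀ {F} → F ∈ 𝓕 → ¬ Bad F s (xs ++ ρ))
    switching 𝓕 r s m l 1≤s 1≤r 1≤l eq len-𝓕 few big
      with union-bound (λ F → bad-at? F s) 𝓕 (restrictions m) rare fewer
      where
      open ≤-Reasoning
      x : ℕ
      x = suc l * l * (2 * (r * ((suc l + s) * (suc l + s))))
      1≤x : 1 ≤ x
      1≤x = *-mono-≤ (*-mono-≤ {1} {suc l} (s≤s z≤n) 1≤l) (*-mono-≤ {1} {2} (s≤s z≤n) (*-mono-≤ 1≤r (*-mono-≤ {1} {suc l + s} (s≤s z≤n) (s≤s z≤n))))
      1≤x^ : 1 ≤ x ^ s
      1≤x^ = ≤-trans (≤-reflexive (sym (^-zeroˡ s))) (^-monoˡ-≤ s 1≤x)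
      k : ℕ
      k = length (restrictions m)
      -- The proportion of bad restrictions is at most (x / (m + 1))^s, and `big` makes this at most
      -- 2^-s.
      rare : ∀ {F} → F ∈ 𝓕 → length (bads F s m) * 2 ^ s ≤ k
      rare {F} F∈ = *-cancelʳ-≤ _ _ (x ^ s) {{>-nonZero 1≤x^}} (begin
        length (bads F s m) * 2 ^ s * x ^ s     ≡⟨ *-assoc (length (bads F s m)) _ _ ⟩
        length (bads F s m) * (2 ^ s * x ^ s)   ≡⟨ cong (length (bads F s m) *_) (^-distribʳ-* s 2 x) ⟨
        length (bads F s m) * (2 * x) ^ s       ≤⟨ *-monoʳ-≤ (length (bads F s m)) (^-monoˡ-≤ s big) ⟩
        length (bads F s m) * suc m ^ s         ≤⟨ bads-count F s r m l 1≤s eq (len-𝓕 F∈) ⟩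
        k * ((suc l * l) ^ s * (2 * (r * ((suc l + s) * (suc l + s)))) ^ s)
          ≡⟨ cong (k *_) (^-distribʳ-* s (suc l * l) _) ⟨
        k * x ^ s ∎)
      fewer : length 𝓕 * k < k * 2 ^ s
      fewer = ≤-trans (*-monoˡ-< k {{>-nonZero 1≤k}} few) (≤-reflexive (*-comm (2 ^ s) k))
        where
        1≤k : 1 ≤ k
        1≤k = ∈-length (proj₂ (restriction-exists m (≤-trans (+-monoʳ-≤ (length ρ) (m≤m+n m l)) (≤-reflexive eq))))
    ... | xs , xs∈ , good = xs , proj₁ (∈-restrictions⁻ m xs∈) , proj₂ (∈-restrictions⁻ m xs∈) , good

  -- The interface between the linear system and the matchings: the evaluation of formulas knows the
  -- variables through these properties, without reference to the group.
  record Literals (V : Set) : Set where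
    field
      terms      : Bool → V → List Edges
      singletons : ∀ {b v t} → t ∈ terms b v → length t ≤ 1
      exclusive  : ∀ {b v t t′ π} → t ∈ terms b v → t′ ∈ terms (not b) v → t ⊆ π → t′ ⊆ π → ¬ Matching π
      exhaustive : ∀ b v {π} → Matching π → length π < n →
        ∃ λ π′ → π ⊆ π′ × Matching π′ × length π′ ≤ 1 + length π × ∃ λ t → (t ∈ terms b v ⊎ t ∈ terms (not b) v) × t ⊆ π′

  -- Evaluating formulas by matching terms.

  module Evaluation {V : Set} (L : Literals V) (s : ℕ) where
    open Literals L

    height : ℕ
    height = 2 * s

    -- The terms forcing a formula to be true, and those forcing it to be false.
    Valuation : Set
    Valuation = Fm V → List Edges × List Edges

    family : Valuation → List (Fm V) → List Edges
    family e = concatMap (proj₁ ∘ e)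

    -- Words that are no matchings are included; they are harmless, because truth is compared only
    -- inside a matching that contains the word.
    candidates : List Edges
    candidates = words (cartesianProduct (allFin (suc n)) (allFin n)) height

    satisfied? : ∀ F π → Dec (Any (λ t → All (_∈ π) t) F)
    satisfied? F π = Any.any? (All.all? (_∈? π)) F

    refuted? : ∀ F π → Dec (All (λ t → ¬ Consistent t π) F)
    refuted? F π = All.all? (λ t → ¬? (cross? t (t ++ π))) F

    forcing refuting : List Edges → Edges → List Edges
    forcing F ρ  = filter (λ y → satisfied? F (y ++ ρ)) candidates
    refuting F ρ = filter (λ y → refuted? F (y ++ ρ)) candidates

    ∈-candidates : ∀ {y} → length y ≤ height → y ∈ candidates
    ∈-candidates l = ∈-words _ height l (λ _ → ∈-cartesianProduct⁺ (∈-allFin _) (∈-allFin _))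

    ∈-forcing⁻ : ∀ F ρ {y} → y ∈ forcing F ρ → ∃ λ t → t ∈ F × t ⊆ y ++ ρ
    ∈-forcing⁻ F ρ {y} y∈ with find (proj₂ (∈-filter⁻ (λ y → satisfied? F (y ++ ρ)) {v = y} {xs = candidates} y∈))
    ... | t , t∈ , a = t , t∈ , All.lookup a

    ∈-refuting⁻ : ∀ F ρ {y} → y ∈ refuting F ρ → ∀ {t} → t ∈ F → ¬ Consistent t (y ++ ρ)
    ∈-refuting⁻ F ρ {y} y∈ t∈ = All.lookup (proj₂ (∈-filter⁻ (λ y → refuted? F (y ++ ρ)) {v = y} {xs = candidates} y∈)) t∈

    settled-∈ : ∀ F ρ {y} → length y ≤ height → Settled F (y ++ ρ) → y ∈ forcing F ρ ⊎ y ∈ refuting F ρ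
    settled-∈ F ρ l (inj₁ (t , t∈ , s)) = inj₁ (∈-filter⁺ (λ y → satisfied? F (y ++ ρ)) (∈-candidates l) (lose t∈ (All.tabulate s)))
    settled-∈ F ρ l (inj₂ r)            = inj₂ (∈-filter⁺ (λ y → refuted? F (y ++ ρ)) (∈-candidates l) (All.tabulate r))

    record Forces (T : Edges → Set) (π : Edges) : Set where
      constructor forces
      field
        {π′ t}   : Edges
        extends  : π ⊆ π′
        matching : Matching π′
        size     : length π′ ≤ height + length π
        forced   : T t
        reached  : t ⊆ π′

    Dense : (Edges → Set) → Edges → Set
    Dense T ρ = ∀ {π} → ρ ⊆ π → Matching π → length π + height ≤ n → Forces T π

    -- The terms of a conjunction are branches of a decision tree for its negation: those that
    -- exclude every term of the negation, and those that contain one. Formulating this with terms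
    -- over `ρ`, instead of truth values, lets it survive later enlargements of `ρ`.
    record Sound (e : Valuation) (ρ : Edges) (A : Fm V) : Set where
      field
        true-terms  : ∀ {x Y t} → x ∈ proj₁ (e A) → Y ∈ disjuncts (neg A) → t ∈ proj₁ (e Y) → ¬ Consistent t (x ++ ρ)
        false-terms : ∀ {x} → x ∈ proj₂ (e A) → ∃ λ Y → Y ∈ disjuncts (neg A) × ∃ λ t → t ∈ proj₁ (e Y) × t ⊆ x ++ ρ
        decided     : Dense (λ t → t ∈ proj₁ (e A) ⊎ t ∈ proj₂ (e A)) ρ

    sound-mono : ∀ {e e′ ρ ρ′ A} → ρ ⊆ ρ′ → e′ A ≡ e A → (∀ {Y} → Y ∈ disjuncts (neg A) → e′ Y ≡ e Y) →
      Sound e ρ A → Sound e′ ρ′ A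
    sound-mono {e} {e′} {ρ} {ρ′} {A} s eqA eqY sd = record
      { true-terms  = λ {x} x∈ Y∈ t∈ c → true-terms (subst (λ z → x ∈ proj₁ z) eqA x∈) Y∈ (subst (λ z → _ ∈ proj₁ z) (eqY Y∈) t∈)
                        (consistent-mono (grow x) c)
      ; false-terms = λ {x} x∈ → lower x (false-terms (subst (λ z → x ∈ proj₂ z) eqA x∈))
      ; decided     = λ s′ m l → subst (λ z → Forces (λ t → t ∈ proj₁ z ⊎ t ∈ proj₂ z) _) (sym eqA) (decided (s′ ∘ s) m l)
      }
      where
      open Sound sd
      grow : ∀ x → x ++ ρ ⊆ x ++ ρ′
      grow x = ⊆-++ ∈-++⁺ˡ (∈-++⁺ʳ x ∘ s)
      lower : ∀ x → (∃ λ Y → Y ∈ disjuncts (neg A) × ∃ λ t → t ∈ proj₁ (e Y) × t ⊆ x ++ ρ) →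
        ∃ λ Y → Y ∈ disjuncts (neg A) × ∃ λ t → t ∈ proj₁ (e′ Y) × t ⊆ x ++ ρ′
      lower x (Y , Y∈ , t , t∈ , t⊆) = Y , Y∈ , t , subst (λ z → t ∈ proj₁ z) (sym (eqY Y∈)) t∈ , grow x ∘ t⊆

    initial : Valuation
    initial (lit b v) = terms b v , terms (not b) v
    initial (_ ∧ _)   = [] , []
    initial (_ ∨ _)   = [] , []

    -- A conjunction of rank t + 1 is evaluated through its negation.
    refine : ℕ → Edges → Valuation → Valuation
    refine t ρ e A with rankΣ A ≤? t
    ... | yes _ = e A
    ... | no _  = refuting (family e (disjuncts (neg A))) ρ , forcing (family e (disjuncts (neg A))) ρ

    refine-low : ∀ t ρ e A → rankΣ A ≤ t → refine t ρ e A ≡ e A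
    refine-low t ρ e A l with rankΣ A ≤? t
    ... | yes _ = refl
    ... | no ¬l = ⊥-elim (¬l l)

    refine-high : ∀ t ρ e A → ¬ rankΣ A ≤ t →
      refine t ρ e A ≡ (refuting (family e (disjuncts (neg A))) ρ , forcing (family e (disjuncts (neg A))) ρ)
    refine-high t ρ e A ¬l with rankΣ A ≤? t
    ... | yes l = ⊥-elim (¬l l)
    ... | no _  = refl

    record Stage (Γ : List (Fm V)) (t : ℕ) (ρ : Edges) : Set where
      field
        e       : Valuation
        literal : ∀ b v → e (lit b v) ≡ (terms b v , terms (not b) v)
        short   : ∀ A {x} → x ∈ proj₁ (e A) → length x ≤ height
        sound   : ∀ {A} → A ∈ Γ → rankΣ A ≤ t → Sound e ρ A

    module _ (1≤s : 1 ≤ s) (Γ : List (Fm V)) (conj-Γ : ∀ {A} → A ∈ Γ → Conjunction A) where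

      stage-0 : ∀ ρ → Stage Γ 0 ρ
      stage-0 ρ = record { e = initial ; literal = λ _ _ → refl ; short = sh ; sound = λ A∈ → ⊥-elim ∘ no-rank (conj-Γ A∈) }
        where
        sh : ∀ A {x} → x ∈ proj₁ (initial A) → length x ≤ height
        sh (lit b v) x∈ = ≤-trans (singletons {b} {v} x∈) (≤-trans 1≤s (m≤m+n s _))
        no-rank : ∀ {A} → Conjunction A → ¬ rankΣ A ≤ 0
        no-rank (conjunction A B) ()

      -- The disjuncts of the negation already have short terms, and at `ρ′` their union is decided
      -- within `height` further edges. The deciding branches become the terms of the conjunction,
      -- with true and false exchanged because the negation was decided.
      stage-suc : ∀ {t ρ ρ′} → ρ ⊆ ρ′ → (st : Stage Γ t ρ) →
        (∀ {A} → A ∈ Γ → ¬ Bad (family (Stage.e st) (disjuncts (neg A))) s ρ′) → Stage Γ (suc t) ρ′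
      stage-suc {t} {ρ} {ρ′} ρ⊆ st good = record { e = e′ ; literal = λ b v → trans (refine-low t ρ′ e (lit b v) z≤n) (literal b v) ; short = sh ; sound = sd }
        where
        open Stage st
        e′ : Valuation
        e′ = refine t ρ′ e
        sh : ∀ A {x} → x ∈ proj₁ (e′ A) → length x ≤ height
        sh A {x} x∈ with rankΣ A ≤? t
        ... | yes _ = short A x∈
        ... | no _  = words-length _ height (proj₁ (∈-filter⁻ (λ y → refuted? (family e (disjuncts (neg A))) (y ++ ρ′)) {v = x} {xs = candidates} x∈))
        new : ∀ {A} → A ∈ Γ → rankΣ A ≤ suc t → ¬ rankΣ A ≤ t → Sound e′ ρ′ A
        new {A} A∈ l ¬l = record
          { true-terms  = λ {x} x∈ Y∈ t∈ → ∈-refuting⁻ F ρ′ (subst (λ z → x ∈ proj₁ z) eqA x∈)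
              (∈-concatMap (proj₁ ∘ e) Y∈ (subst (λ z → _ ∈ proj₁ z) (low Y∈) t∈))
          ; false-terms = λ {x} x∈ → back x (∈-forcing⁻ F ρ′ (subst (λ z → x ∈ proj₂ z) eqA x∈))
          ; decided     = λ s′ m room → found (¬bad-decides F s ≤-refl (good A∈) s′ m room)
          }
          where
          F : List Edges
          F = family e (disjuncts (neg A))
          eqA : e′ A ≡ (refuting F ρ′ , forcing F ρ′)
          eqA = refine-high t ρ′ e A ¬l
          low : ∀ {Y} → Y ∈ disjuncts (neg A) → e′ Y ≡ e Y
          low {Y} Y∈ = refine-low t ρ′ e Y (≤-pred (≤-trans (disjuncts-neg-rankΣ (conj-Γ A∈) Y∈) l))
          back : ∀ x → (∃ λ t → t ∈ F × t ⊆ x ++ ρ′) → ∃ λ Y → Y ∈ disjuncts (neg A) × ∃ λ t → t ∈ proj₁ (e′ Y) × t ⊆ x ++ ρ′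
          back x (t , t∈ , t⊆) with ∈-concatMap⁻′ (proj₁ ∘ e) (disjuncts (neg A)) t∈
          ... | Y , Y∈ , q = Y , Y∈ , t , subst (λ z → t ∈ proj₁ z) (sym (low Y∈)) q , t⊆
          found : ∀ {π} → Decision F ρ′ π height → Forces (λ t → t ∈ proj₁ (e′ A) ⊎ t ∈ proj₂ (e′ A)) π
          found (decision ext m sz szy re se) = forces ext m sz
            (subst (λ z → _ ∈ proj₁ z ⊎ _ ∈ proj₂ z) (sym eqA) ([ inj₂ , inj₁ ]′ (settled-∈ F ρ′ szy se)))
            (re ∘ ∈-++⁺ˡ)
        sd : ∀ {A} → A ∈ Γ → rankΣ A ≤ suc t → Sound e′ ρ′ A
        sd {A} A∈ l with rankΣ A ≤? t
        ... | yes l′ = sound-mono ρ⊆ (refine-low t ρ′ e A l′)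
              (λ {Y} Y∈ → refine-low t ρ′ e Y (≤-trans (<⇒≤ (disjuncts-neg-rankΣ (conj-Γ A∈) Y∈)) l′)) (sound A∈ l′)
        ... | no ¬l  = new A∈ l ¬l

    -- Soundness of the proof rules under small matchings.

    module Rules (e : Valuation) (ρ : Edges) (literal : ∀ b v → e (lit b v) ≡ (terms b v , terms (not b) v)) where

      Known : Fm V → Set
      Known A = ∀ {Z} → Z ∈ conjunctions A → Sound e ρ Z

      True : Fm V → Edges → Set
      True A π = ∃ λ Y → Y ∈ disjuncts A × ∃ λ t → t ∈ proj₁ (e Y) × t ⊆ π

      True-line : Line V → Edges → Set
      True-line ℓ π = ∃ λ Y → Y ∈ line-disjuncts ℓ × ∃ λ t → t ∈ proj₁ (e Y) × t ⊆ π

      Falsified : Line V → Edges → Set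
      Falsified ℓ q = ∀ {π} → q ⊆ π → Matching π → ¬ True-line ℓ π

      conj-exclusive : ∀ A B {π} → Sound e ρ (A ∧ B) → ρ ⊆ π → Matching π → True (A ∧ B) π → ¬ True (neg (A ∧ B)) π
      conj-exclusive A B sd s m (_ , here refl , x , x∈ , x⊆) (Y , Y∈ , t , t∈ , t⊆) =
        Sound.true-terms sd x∈ Y∈ t∈ (⊆-consistent m t⊆ (⊆-++ x⊆ s))

      true-exclusive : ∀ A {π} → Known A → ρ ⊆ π → Matching π → True A π → ¬ True (neg A) π
      true-exclusive (lit b v) k s m (_ , here refl , t , t∈ , t⊆) (_ , here refl , t′ , t′∈ , t′⊆) =
        exclusive (subst (λ z → t ∈ proj₁ z) (literal b v) t∈) (subst (λ z → t′ ∈ proj₁ z) (literal (not b) v) t′∈) t⊆ t′⊆ m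
      true-exclusive (A ∧ B) k s m p q = conj-exclusive A B (k (here refl)) s m p q
      true-exclusive (A ∨ B) {π} k s m p q = conj-exclusive (neg A) (neg B) (k (here refl)) s m q
        (subst (λ C → True C π) (sym (neg-involutive (A ∨ B))) p)

      record Reaches (T : Edges → Set) (π : Edges) : Set where
        constructor reaches
        field
          {π′}     : Edges
          extends  : π ⊆ π′
          matching : Matching π′
          size     : length π′ ≤ height + length π
          holds    : T π′

      reaches-map : ∀ {T T′ : Edges → Set} {π} → (∀ {π′} → π ⊆ π′ → T π′ → T′ π′) → Reaches T π → Reaches T′ π
      reaches-map f (reaches ext m sz h) = reaches ext m sz (f ext h)

      conj-exhaustive : ∀ A B {π} → Sound e ρ (A ∧ B) → ρ ⊆ π → Matching π → length π + height ≤ n →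
        Reaches (λ π′ → True (A ∧ B) π′ ⊎ True (neg (A ∧ B)) π′) π
      conj-exhaustive A B sd s m l with Sound.decided sd s m l
      ... | forces {t = t} ext m′ sz (inj₁ t∈) re = reaches ext m′ sz (inj₁ (A ∧ B , here refl , t , t∈ , re))
      ... | forces {t = t} ext m′ sz (inj₂ t∈) re with Sound.false-terms sd t∈
      ...   | Y , Y∈ , x , x∈ , x⊆ = reaches ext m′ sz (inj₂ (Y , Y∈ , x , x∈ , ⊆-++ re (ext ∘ s) ∘ x⊆))

      true-exhaustive : 1 ≤ s → ∀ A {π} → Known A → ρ ⊆ π → Matching π → length π + height ≤ n →
        Reaches (λ π′ → True A π′ ⊎ True (neg A) π′) π
      true-exhaustive 1≤s (lit b v) {π} k s′ m l
        with exhaustive b v m (<-≤-trans (m<m+n (length π) (≤-trans 1≤s (m≤m+n s _))) l)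
      ... | π′ , ext , m′ , sz , t , t∈ , re = reaches ext m′ (≤-trans sz (+-monoˡ-≤ (length π) (≤-trans 1≤s (m≤m+n s _)))) (side t∈)
        where
        side : t ∈ terms b v ⊎ t ∈ terms (not b) v → True (lit b v) π′ ⊎ True (lit (not b) v) π′
        side (inj₁ p) = inj₁ (lit b v , here refl , t , subst (λ z → t ∈ proj₁ z) (sym (literal b v)) p , re)
        side (inj₂ p) = inj₂ (lit (not b) v , here refl , t , subst (λ z → t ∈ proj₁ z) (sym (literal (not b) v)) p , re)
      true-exhaustive 1≤s (A ∧ B) k s′ m l = conj-exhaustive A B (k (here refl)) s′ m l
      true-exhaustive 1≤s (A ∨ B) k s′ m l = reaches-map
        (λ {π′} _ → [ inj₂ , inj₁ ∘ subst (λ C → True C π′) (neg-involutive (A ∨ B)) ]′)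
        (conj-exhaustive (neg A) (neg B) (k (here refl)) s′ m l)

      Forced : Line V → Set
      Forced ℓ = ∀ {π} → ρ ⊆ π → Matching π → length π + height ≤ n → Reaches (True-line ℓ) π

      Irrefutable : Line V → Set
      Irrefutable ℓ = ∀ {q} → ρ ⊆ q → Matching q → length q ≤ height + length ρ → ¬ Falsified ℓ q

      -- This resets the size bound at each line. Deciding the terms of the line over any large `π`
      -- uses a short `y`, and whether they are settled depends on `y ++ ρ` only. A negative outcome
      -- would therefore make the small matching `y ++ ρ` falsify the line, so excluding small
      -- falsifying matchings suffices.
      irrefutable-forced : ∀ ℓ → ¬ Bad (family e (line-disjuncts ℓ)) s ρ → Irrefutable ℓ → Forced ℓ
      irrefutable-forced ℓ good irr s′ m l with ¬bad-decides (family e (line-disjuncts ℓ)) s ≤-refl good s′ m l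
      ... | decision ext m′ sz szy re (inj₁ (t , t∈ , t⊆)) with ∈-concatMap⁻′ (proj₁ ∘ e) (line-disjuncts ℓ) t∈
      ...   | Y , Y∈ , q = reaches ext m′ sz (Y , Y∈ , t , q , re ∘ t⊆)
      irrefutable-forced ℓ good irr s′ m l | decision {y = y} ext m′ sz szy re (inj₂ no-term) =
        ⊥-elim (irr (∈-++⁺ʳ y) (matching-⊆ re m′) (≤-trans (≤-reflexive (length-++ y)) (+-monoˡ-≤ _ szy))
          λ { q⊆ mπ (Y , Y∈ , t , t∈ , t⊆) → no-term (∈-concatMap (proj₁ ∘ e) Y∈ t∈) (⊆-consistent mπ t⊆ q⊆) })

      true-line-++ : ∀ C {D π} → True-line (C ++ D) π → True-line C π ⊎ True-line D π
      true-line-++ C (Y , Y∈ , r) with ∈-concatMap⁻′ disjuncts (C ++ _) Y∈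
      ... | A , A∈ , q with ∈-++⁻ C A∈
      ...   | inj₁ p = inj₁ (Y , ∈-concatMap disjuncts p q , r)
      ...   | inj₂ p = inj₂ (Y , ∈-concatMap disjuncts p q , r)

      line-of : ∀ A ℓ {π} → A ∈ ℓ → True A π → True-line ℓ π
      line-of A ℓ A∈ (Y , Y∈ , r) = Y , ∈-concatMap disjuncts A∈ Y∈ , r

      line-single : ∀ {A π} → True-line [ A ] π → True A π
      line-single {A} (Y , Y∈ , r) = Y , subst (Y ∈_) (++-identityʳ (disjuncts A)) Y∈ , r

      line-⊆ : ∀ ℓ ℓ′ {π} → line-disjuncts ℓ ⊆ line-disjuncts ℓ′ → True-line ℓ π → True-line ℓ′ π
      line-⊆ ℓ ℓ′ s′ (Y , Y∈ , r) = Y , s′ Y∈ , r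

      ⊆-disjuncts : ∀ (ℓ ℓ′ : Line V) → ℓ ⊆ ℓ′ → line-disjuncts ℓ ⊆ line-disjuncts ℓ′
      ⊆-disjuncts ℓ ℓ′ s′ Y∈ with ∈-concatMap⁻′ disjuncts ℓ Y∈
      ... | A , A∈ , q = ∈-concatMap disjuncts (s′ A∈) q

      ++-disjuncts : ∀ (C ℓ ℓ′ : Line V) → line-disjuncts ℓ ⊆ line-disjuncts ℓ′ →
        line-disjuncts (C ++ ℓ) ⊆ line-disjuncts (C ++ ℓ′)
      ++-disjuncts C ℓ ℓ′ s′ Y∈ with ∈-concatMap⁻′ disjuncts (C ++ ℓ) Y∈
      ... | A , A∈ , q with ∈-++⁻ C A∈
      ...   | inj₁ p = ∈-concatMap disjuncts {xs = C ++ ℓ′} (∈-++⁺ˡ p) q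
      ...   | inj₂ p = ⊆-disjuncts ℓ′ (C ++ ℓ′) (∈-++⁺ʳ C) (s′ (∈-concatMap disjuncts p q))

      module _ (Init : Line V → Set) (2≤s : 2 ≤ s) (room : length ρ + 4 * height ≤ n)
               (init-true : ∀ {ℓ π} → Init ℓ → Matching π → length π + 3 ≤ n →
                 ∃ λ π′ → π ⊆ π′ × Matching π′ × ∃ λ b → ∃ λ v → lit b v ∈ ℓ × ∃ λ t → t ∈ terms b v × t ⊆ π′)
               where

        within : ∀ k (q : Edges) → k ≤ 3 → length q ≤ k * height + length ρ → length q + height ≤ n
        within k q k≤ l = begin
          length q + height                 ≤⟨ +-monoˡ-≤ height l ⟩
          k * height + length ρ + height    ≤⟨ +-monoˡ-≤ height (+-monoˡ-≤ (length ρ) (*-monoˡ-≤ height k≤)) ⟩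
          3 * height + length ρ + height    ≡⟨ solve 2 (λ h r → con 3 :* h :+ r :+ h := r :+ con 4 :* h) refl height (length ρ) ⟩
          length ρ + 4 * height             ≤⟨ room ⟩
          n                                 ∎
          where
          open ≤-Reasoning
          open +-*-Solver

        within₁ : ∀ (q : Edges) → length q ≤ height + length ρ → length q + height ≤ n
        within₁ q l = within 1 q (s≤s z≤n) (≤-trans l (≤-reflexive (cong (_+ length ρ) (sym (+-identityʳ height)))))

        within₂ : ∀ (q q′ : Edges) → length q ≤ height + length ρ → length q′ ≤ height + length q → length q′ + height ≤ n
        within₂ q q′ l l′ = within 2 q′ (s≤s (s≤s z≤n)) (≤-trans l′ (≤-trans (+-monoʳ-≤ height l)
          (≤-reflexive (trans (sym (+-assoc height height _)) (cong (λ h → height + h + length ρ) (sym (+-identityʳ height)))))))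

        step-irrefutable : ∀ {prev ℓ} → Step Init prev ℓ → (∀ {ℓ′} → ℓ′ ∈ prev → Forced ℓ′) →
          (∀ {ℓ′} → ℓ′ ∈ prev → All Known ℓ′) → All Known ℓ → Irrefutable ℓ
        inherit : ∀ ℓ ℓ′ → Forced ℓ → line-disjuncts ℓ ⊆ line-disjuncts ℓ′ → Irrefutable ℓ′

        inherit ℓ ℓ′ f s′ {q} ρ⊆ m l fal with f ρ⊆ m (within₁ q l)
        ... | reaches ext m′ _ h = fal ext m′ (line-⊆ ℓ ℓ′ s′ h)

        step-irrefutable (hyp i) _ _ _ {q} ρ⊆ m l fal
          with init-true i m (≤-trans (+-monoʳ-≤ (length q) three) (within₂ q q l (m≤n+m _ height)))
          where
          -- An initial clause is made true by adding up to three edges, one for each variable of an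
          -- equation.
          three : 3 ≤ height
          three = ≤-trans (n≤1+n 3) (*-monoʳ-≤ 2 2≤s)
        ... | π′ , ext , m′ , b , v , A∈ , t , t∈ , t⊆ =
          fal ext m′ (lit b v , ∈-concatMap disjuncts A∈ (here refl) , t , subst (λ z → t ∈ proj₁ z) (sym (literal b v)) t∈ , t⊆)
        step-irrefutable (axiom A) _ _ (k ∷ _) {q} ρ⊆ m l fal with true-exhaustive (≤-trans (n≤1+n 1) 2≤s) A k ρ⊆ m (within₁ q l)
        ... | reaches ext m′ _ (inj₁ p) = fal ext m′ (line-of A (A ∷ neg A ∷ []) (here refl) p)
        ... | reaches ext m′ _ (inj₂ p) = fal ext m′ (line-of (neg A) (A ∷ neg A ∷ []) (there (here refl)) p)
        -- Both premises are made true in one growing matching. Unless a side formula becomes true,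
        -- `A` and `neg A` then hold in the same matching.
        step-irrefutable (cut C D A C∈ D∈) f k _ {q} ρ⊆ m l fal with f C∈ ρ⊆ m (within₁ q l)
        ... | reaches {π₁} ext₁ m₁ sz₁ h₁ with true-line-++ C h₁ | f D∈ (ext₁ ∘ ρ⊆) m₁ (within₂ q π₁ l sz₁)
        ...   | inj₁ p | _ = fal ext₁ m₁ (line-⊆ C (C ++ D) (⊆-disjuncts C (C ++ D) ∈-++⁺ˡ) p)
        ...   | inj₂ p | reaches ext₂ m₂ _ h₂ with true-line-++ D h₂
        ...     | inj₁ r = fal (ext₂ ∘ ext₁) m₂ (line-⊆ D (C ++ D) (⊆-disjuncts D (C ++ D) (∈-++⁺ʳ C)) r)
        ...     | inj₂ r = true-exclusive A (All.lookup (k C∈) (∈-++⁺ʳ C (here refl))) (ext₂ ∘ ext₁ ∘ ρ⊆) m₂ 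
                  (keep (line-single {A} p)) (line-single {neg A} r)
                  where
                  keep : True A _ → True A _
                  keep (Y , Y∈ , t , t∈ , t⊆) = Y , Y∈ , t , t∈ , ext₂ ∘ t⊆
        -- The new conjunction is decided before any premise is used: if it comes out false, a term
        -- of `neg A` or of `neg B` holds, and this selects the one premise that is contradicted.
        step-irrefutable (conj C D A B C∈ D∈) f k kℓ {q} ρ⊆ m l fal
          with conj-exhaustive A B (All.lookup kℓ (∈-++⁺ʳ C (∈-++⁺ʳ D (here refl))) (here refl)) ρ⊆ m (within₁ q l)
        ... | reaches {π′} ext m′ sz (inj₁ p) = fal ext m′ (line-of (A ∧ B) (C ++ D ++ [ A ∧ B ]) (∈-++⁺ʳ C (∈-++⁺ʳ D (here refl))) p)
        ... | reaches {π′} ext m′ sz (inj₂ (Y , Y∈ , t , t∈ , t⊆)) with ∈-++⁻ (disjuncts (neg A)) Y∈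
        ...   | inj₁ Y∈A with f C∈ (ext ∘ ρ⊆) m′ (within₂ q π′ l sz)
        ...     | reaches ext₁ m₁ _ h₁ with true-line-++ C h₁
        ...       | inj₁ p = fal (ext₁ ∘ ext) m₁ (line-⊆ C (C ++ D ++ [ A ∧ B ]) (⊆-disjuncts C (C ++ D ++ [ A ∧ B ]) ∈-++⁺ˡ) p)
        ...       | inj₂ p = true-exclusive A (All.lookup (k C∈) (∈-++⁺ʳ C (here refl))) (ext₁ ∘ ext ∘ ρ⊆) m₁ (line-single {A} p)
                    (Y , Y∈A , t , t∈ , ext₁ ∘ t⊆)
        step-irrefutable (conj C D A B C∈ D∈) f k kℓ {q} ρ⊆ m l fal | reaches {π′} ext m′ sz (inj₂ (Y , Y∈ , t , t∈ , t⊆)) | inj₂ Y∈B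
            with f D∈ (ext ∘ ρ⊆) m′ (within₂ q π′ l sz)
        ...     | reaches ext₁ m₁ _ h₁ with true-line-++ D h₁
        ...       | inj₁ p = fal (ext₁ ∘ ext) m₁ (line-⊆ D (C ++ D ++ [ A ∧ B ]) (⊆-disjuncts D (C ++ D ++ [ A ∧ B ]) (∈-++⁺ʳ C ∘ ∈-++⁺ˡ)) p)
        ...       | inj₂ p = true-exclusive B (All.lookup (k D∈) (∈-++⁺ʳ D (here refl))) (ext₁ ∘ ext ∘ ρ⊆) m₁ (line-single {B} p)
                    (Y , Y∈B , t , t∈ , ext₁ ∘ t⊆)
        step-irrefutable (weaken C D C∈) f _ _ = inherit C (C ++ D) (f C∈) (⊆-disjuncts C (C ++ D) ∈-++⁺ˡ)
        step-irrefutable (exchange {C} {ℓ} C∈ p) f _ _ = inherit C ℓ (f C∈) (⊆-disjuncts C ℓ (↭.∈-resp-↭ p))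
        step-irrefutable (contract C A C∈) f _ _ = inherit (C ++ A ∷ A ∷ []) (C ++ [ A ]) (f C∈)
          (++-disjuncts C (A ∷ A ∷ []) [ A ] (⊆-disjuncts (A ∷ A ∷ []) [ A ] (λ { (here refl) → here refl ; (there q) → q })))
        step-irrefutable (∨-merge C A B C∈) f _ _ = inherit (C ++ A ∷ B ∷ []) (C ++ [ A ∨ B ]) (f C∈)
          (++-disjuncts C (A ∷ B ∷ []) [ A ∨ B ] (λ {Y} → subst (Y ∈_) (sym (++-assoc (disjuncts A) (disjuncts B) []))))
        step-irrefutable (∨-split C A B C∈) f _ _ = inherit (C ++ [ A ∨ B ]) (C ++ A ∷ B ∷ []) (f C∈)
          (++-disjuncts C [ A ∨ B ] (A ∷ B ∷ []) (λ {Y} → subst (Y ∈_) (++-assoc (disjuncts A) (disjuncts B) [])))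

        derivation-forced : ∀ {π} → Deriv Init π → (∀ {ℓ} → ℓ ∈ π → All Known ℓ) →
          (∀ {ℓ} → ℓ ∈ π → ¬ Bad (family e (line-disjuncts ℓ)) s ρ) → ∀ {ℓ} → ℓ ∈ π → Forced ℓ
        derivation-forced (st ∷ d) k good (there p)   = derivation-forced d (k ∘ there) (good ∘ there) p
        derivation-forced {ℓ ∷ _} (st ∷ d) k good (here refl) = irrefutable-forced ℓ (good (here refl))
          (step-irrefutable st (derivation-forced d (k ∘ there) (good ∘ there)) (k ∘ there) (k (here refl)))

        no-refutation : ∀ {π} → Matching ρ → Refutation Init π → (∀ {ℓ} → ℓ ∈ π → All Known ℓ) →
          (∀ {ℓ} → ℓ ∈ π → ¬ Bad (family e (line-disjuncts ℓ)) s ρ) → ⊥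
        no-refutation m (refutation d) k good
          with derivation-forced d k good (here refl) id m (within₁ ρ (m≤n+m _ height))
        ... | reaches _ _ _ (_ , () , _)

    -- The empty line has size 0 and is absent from the families that are counted; its own family is
    -- empty, so it needs no restriction.
    ¬bad-[] : ∀ {j ρ} → ¬ Bad [] j ρ
    ¬bad-[] (stop () _)
    ¬bad-[] (step () _ _ _ _ _)

    -- live t is the number of free holes when t more applications of the switching lemma are to come.
    record Schedule : Set where
      field
        live gap : ℕ → ℕ
        live-suc : ∀ t → live (suc t) ≡ gap t + live t
        positive : ∀ t → 1 ≤ live t
        large    : ∀ t → 2 * (suc (live t) * live t * (2 * (height * ((suc (live t) + s) * (suc (live t) + s))))) ≤ suc (gap t)
        enough   : 4 * height ≤ live 0

    -- Iterating the switching lemma along the ranks.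

    module LowerBound (sch : Schedule) (2≤s : 2 ≤ s) where
      open Schedule sch

      1≤s : 1 ≤ s
      1≤s = ≤-trans (n≤1+n 1) 2≤s

      Live : ℕ → Edges → Set
      Live t ρ = Exact ρ × length ρ + live t ≡ n

      record Restriction (ρ : Edges) (t : ℕ) (𝓕 : List (List Edges)) : Set where
        constructor restriction
        field
          {ρ′}    : Edges
          extends : ρ ⊆ ρ′
          is-live : Live t ρ′
          good    : ∀ {F} → F ∈ 𝓕 → ¬ Bad F s ρ′

      restrict : ∀ t {ρ} (𝓕 : List (List Edges)) → Live (suc t) ρ →
        (∀ {F x} → F ∈ 𝓕 → x ∈ F → length x ≤ height) → length 𝓕 < 2 ^ s → Restriction ρ t 𝓕
      restrict t {ρ} 𝓕 (ex , eq) short few = result (Restrict.switching ρ ex 𝓕 height s (gap t) (live t)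
        1≤s (≤-trans 1≤s (m≤m+n s _)) (positive t) (trans (cong (length ρ +_) (sym (live-suc t))) eq) short few (large t))
        where
        result : (∃ λ xs → length xs ≡ gap t × Exact (xs ++ ρ) × (∀ {F} → F ∈ 𝓕 → ¬ Bad F s (xs ++ ρ))) → Restriction ρ t 𝓕
        result (xs , len , ex′ , good) = restriction (∈-++⁺ʳ xs) (ex′ , live-eq) good
          where
          live-eq : length (xs ++ ρ) + live t ≡ n
          live-eq = begin
            length (xs ++ ρ) + live t        ≡⟨ cong (_+ live t) (trans (length-++ xs) (trans (+-comm _ (length ρ)) (cong (length ρ +_) len))) ⟩
            length ρ + gap t + live t        ≡⟨ +-assoc (length ρ) _ _ ⟩
            length ρ + (gap t + live t)      ≡⟨ cong (length ρ +_) (live-suc t) ⟨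
            length ρ + live (suc t)          ≡⟨ eq ⟩
            n                                ∎
            where open ≡-Reasoning

      restrict-families : ∀ {Γ t ρ} u (st : Stage Γ t ρ) (Xss : List (List (Fm V))) → Live (suc u) ρ → length Xss < 2 ^ s →
        Restriction ρ u (map (family (Stage.e st)) Xss)
      restrict-families u st Xss lv few = restrict u (map (family e) Xss) lv short-𝓕 (subst (_< 2 ^ s) (sym (length-map (family e) Xss)) few)
        where
        open Stage st
        short-𝓕 : ∀ {F x} → F ∈ map (family e) Xss → x ∈ F → length x ≤ height
        short-𝓕 F∈ x∈ with ∈-map⁻ (family e) F∈
        ... | Xs , _ , refl with ∈-concatMap⁻′ (proj₁ ∘ e) Xs x∈
        ...   | Y , _ , q = short Y q

      module _ (Γ : List (Fm V)) (conj-Γ : ∀ {A} → A ∈ Γ → Conjunction A) (few : length Γ < 2 ^ s) where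

        -- `t` is the rank evaluated so far and `u` the number of rounds still to come.
        record Evaluated (t u : ℕ) : Set where
          constructor evaluated
          field
            {ρ}     : Edges
            is-live : Live u ρ
            stage   : Stage Γ t ρ

        evaluate-suc : ∀ t u → Evaluated t (suc u) → Evaluated (suc t) u
        evaluate-suc t u (evaluated lv st) = advance (restrict-families u st (map (disjuncts ∘ neg) Γ) lv
          (subst (_< 2 ^ s) (sym (length-map (disjuncts ∘ neg) Γ)) few))
          where
          advance : Restriction _ u (map (family (Stage.e st)) (map (disjuncts ∘ neg) Γ)) → Evaluated (suc t) u
          advance (restriction ρ⊆ lv′ good) = evaluated lv′
            (stage-suc 1≤s Γ conj-Γ ρ⊆ st (λ A∈ → good (∈-map⁺ (family (Stage.e st)) (∈-map⁺ (disjuncts ∘ neg) A∈))))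

        evaluate : ∀ t u → live (t + u) ≡ n → Evaluated t u
        evaluate zero    u eq = evaluated (exact [] (λ ()) , eq) (stage-0 1≤s Γ conj-Γ [])
        evaluate (suc t) u eq = evaluate-suc t u (evaluate t (suc u) (trans (cong live (+-suc t u)) eq))

      module _ (Init : Line V → Set)
             (init-true : ∀ {ℓ π} → Init ℓ → Matching π → length π + 3 ≤ n →
               ∃ λ π′ → π ⊆ π′ × Matching π′ × ∃ λ b → ∃ λ v → lit b v ∈ ℓ × ∃ λ t → t ∈ terms b v × t ⊆ π′)
             (d : ℕ) {π : List (Line V)} (ref : Refutation Init π) (depth : DepthAtMost d π)
             where

        refute : ∀ {ρ} (st : Stage (proof-conjunctions π) (suc d) ρ) →
          Restriction ρ 0 (map (family (Stage.e st)) (map line-disjuncts (nonempty-lines π))) → ⊥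
        refute st (restriction {ρ′} ρ⊆ (ex , live-eq) good) = Rules.no-refutation e ρ′ literal Init 2≤s
          (≤-trans (+-monoʳ-≤ (length ρ′) enough) (≤-reflexive live-eq)) init-true (Exact.matching ex) ref
          (λ {ℓ} → known ℓ) (λ {ℓ} → line-good ℓ)
          where
          open Stage st
          rank-bound : ∀ A → InΣ d A → rankΣ A ⊔ rankΠ A ≤ suc d
          rank-bound A q = ⊔-lub (≤-trans (InΣ⇒rankΣ d q) (n≤1+n d)) (≤-trans (rankΠ≤ A) (s≤s (InΣ⇒rankΣ d q)))
          known-formula : ∀ ℓ A → ℓ ∈ π → A ∈ ℓ → Rules.Known e ρ′ literal A
          known-formula ℓ A ℓ∈ A∈ Z∈ = sound-mono {e = e} {e′ = e} ρ⊆ refl (λ _ → refl)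
            (sound (∈-concatMap (concatMap conjunctions) ℓ∈ (∈-concatMap conjunctions A∈ Z∈))
              (≤-trans (conjunctions-rank A Z∈) (rank-bound A (All.lookup (All.lookup depth ℓ∈) A∈))))
          known : ∀ ℓ → ℓ ∈ π → All (Rules.Known e ρ′ literal) ℓ
          known ℓ ℓ∈ = All.tabulate (λ {A} → known-formula ℓ A ℓ∈)
          line-good : ∀ ℓ → ℓ ∈ π → ¬ Bad (family e (line-disjuncts ℓ)) s ρ′
          line-good []      ℓ∈ = ¬bad-[]
          line-good (A ∷ ℓ) ℓ∈ = good (∈-map⁺ (family e) (∈-map⁺ line-disjuncts (∈-nonempty-lines π ℓ∈)))

        proof-conjunction : ∀ {A} → A ∈ proof-conjunctions π → Conjunction A
        proof-conjunction A∈ with ∈-concatMap⁻′ (concatMap conjunctions) π A∈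
        ... | ℓ , _ , q with ∈-concatMap⁻′ conjunctions ℓ q
        ...   | A , _ , r = conjunctions-conjunction A r

        -- Formulas of depth `d` contain conjunctions or duals of conjunctions of rank up to
        -- `suc d`, which take `suc d` rounds; one more round makes the lines themselves decidable.
        size-bound : live (2 + d) ≡ n → ¬ proofSize π < 2 ^ s
        size-bound eq small = finish (evaluate (proof-conjunctions π) proof-conjunction
          (≤-<-trans (length-proof-conjunctions π) small) (suc d) 1 (trans (cong live (cong suc (+-comm d 1))) eq))
          where
          finish : Evaluated (proof-conjunctions π) proof-conjunction (≤-<-trans (length-proof-conjunctions π) small) (suc d) 1 → ⊥
          finish (evaluated lv st) = refute st (restrict-families 0 st (map line-disjuncts (nonempty-lines π)) lv
            (subst (_< 2 ^ s) (sym (length-map line-disjuncts (nonempty-lines π))) (≤-<-trans (length-nonempty-lines π) small)))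
-- The pigeonhole principle as a linear system: cell i j is g if pigeon i sits in hole j and ε if not,
-- rowsum i and colsum j are the partial sums of row i and of column j, up to a common shift.
module Pigeonhole (G : FinAbGroup) (M pad : ℕ) (g : Fin (FinAbGroup.k G)) (g≢ε : g ≢ FinAbGroup.ε G) where
  open FinAbGroup G using (k; isAbelianGroup)
  open Board M

  abelianGroup : AbelianGroup _ _
  abelianGroup = record { isAbelianGroup = isAbelianGroup }

  open AbelianGroup abelianGroup using (_∙_; ε; _⁻¹; assoc; comm; identityˡ; identityʳ; inverseˡ; inverseʳ)
  open GroupProperties (AbelianGroup.group abelianGroup) using (∙-cancelˡ; x∙y⁻¹≈ε⇒x≈y; ⁻¹-injective; ⁻¹-anti-homo-∙; ε⁻¹≈ε)
  open CommutativeMonoidSum (AbelianGroup.commutativeMonoid abelianGroup) using (∑-comm; sum-cong-≗) renaming (sum to ∑)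

  -- Variables and equations of the linear system.

  data Var : Set where
    cell : Fin (suc M) → Fin M → Var
    rowsum : Fin (suc M) → Fin (suc M) → Var
    colsum : Fin (suc (suc M)) → Fin M → Var
    idle : Fin pad → Var

  size-x size-y size-z vars : ℕ
  size-x = suc M * M
  size-y = suc M * suc M
  size-z = suc (suc M) * M
  vars   = size-x + (size-y + (size-z + pad))

  grid : ∀ {a b} → (Fin a → Fin b → Var) → Fin (a * b) → Var
  grid {a} {b} f c = f (proj₁ (Fin.remQuot {a} b c)) (proj₂ (Fin.remQuot {a} b c))

  grid-combine : ∀ {a b} (f : Fin a → Fin b → Var) i j → grid f (Fin.combine i j) ≡ f i j
  grid-combine f i j = cong (λ q → f (proj₁ q) (proj₂ q)) (Fin.remQuot-combine i j)

  split : ∀ {a b} → (Fin a → Var) → (Fin b → Var) → Fin (a + b) → Var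
  split {a} f f′ c = [ f , f′ ]′ (Fin.splitAt a c)

  split-↑ˡ : ∀ {a b} (f : Fin a → Var) (f′ : Fin b → Var) c → split f f′ (c Fin.↑ˡ b) ≡ f c
  split-↑ˡ {a} {b} f f′ c = cong [ f , f′ ]′ (Fin.splitAt-↑ˡ a c b)

  split-↑ʳ : ∀ {a b} (f : Fin a → Var) (f′ : Fin b → Var) c → split f f′ (a Fin.↑ʳ c) ≡ f′ c
  split-↑ʳ {a} {b} f f′ c = cong [ f , f′ ]′ (Fin.splitAt-↑ʳ a b c)

  view-z : Fin (size-z + pad) → Var
  view-z = split (grid colsum) idle

  view-y : Fin (size-y + (size-z + pad)) → Var
  view-y = split (grid rowsum) view-z

  view : Fin vars → Var
  view = split (grid cell) view-y

  code : Var → Fin vars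
  code (cell i j) = Fin.combine i j Fin.↑ˡ (size-y + (size-z + pad))
  code (rowsum i j) = size-x Fin.↑ʳ (Fin.combine i j Fin.↑ˡ (size-z + pad))
  code (colsum i j) = size-x Fin.↑ʳ (size-y Fin.↑ʳ (Fin.combine i j Fin.↑ˡ pad))
  code (idle c)   = size-x Fin.↑ʳ (size-y Fin.↑ʳ (size-z Fin.↑ʳ c))

  view-code : ∀ v → view (code v) ≡ v
  view-code (cell i j) = trans (split-↑ˡ (grid cell) view-y (Fin.combine i j)) (grid-combine cell i j)
  view-code (rowsum i j) = trans (split-↑ʳ (grid cell) view-y _)
    (trans (split-↑ˡ (grid rowsum) view-z (Fin.combine i j)) (grid-combine rowsum i j))
  view-code (colsum i j) = trans (split-↑ʳ (grid cell) view-y _) (trans (split-↑ʳ (grid rowsum) view-z _)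
    (trans (split-↑ˡ (grid colsum) idle (Fin.combine i j)) (grid-combine colsum i j)))
  view-code (idle c)   = trans (split-↑ʳ (grid cell) view-y _) (trans (split-↑ʳ (grid rowsum) view-z _) (split-↑ʳ (grid colsum) idle c))

  pattern 0ℤ = ℤ.+ 0
  pattern 1ℤ = ℤ.+ 1
  pattern -1ℤ = ℤ.-[1+ 0 ]

  eqn : ℤ → ℤ → ℤ → Fin k → Fin vars → Fin vars → Fin vars → Eqn k vars
  eqn c₁ c₂ c₃ r a₁ a₂ a₃ = record { z₁ = c₁ ; z₂ = c₂ ; z₃ = c₃ ; g = r ; x₁ = a₁ ; x₂ = a₂ ; x₃ = a₃ }

  -- One equation per variable, so that the equations are distinct because their first variables are.
  equation : Fin vars → Var → Eqn k vars
  equation a (rowsum i zero)    = eqn 1ℤ -1ℤ 0ℤ (g ⁻¹) a (code (rowsum i (Fin.fromℕ M))) a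
  equation a (rowsum i (suc j)) = eqn 1ℤ -1ℤ -1ℤ ε a (code (rowsum i (Fin.inject₁ j))) (code (cell i j))
  equation a (colsum zero j)    = eqn 1ℤ -1ℤ 0ℤ (g ⁻¹) a (code (colsum (Fin.fromℕ (suc M)) j)) a
  equation a (colsum (suc i) j) = eqn 1ℤ -1ℤ -1ℤ ε a (code (colsum (Fin.inject₁ i) j)) (code (cell i j))
  equation a (cell _ _)       = eqn 0ℤ 0ℤ 0ℤ ε a a a
  equation a (idle _)         = eqn 0ℤ 0ℤ 0ℤ ε a a a

  equation-first : ∀ a v → Eqn.x₁ (equation a v) ≡ a
  equation-first a (cell _ _)       = refl
  equation-first a (rowsum _ zero)    = refl
  equation-first a (rowsum _ (suc _)) = refl
  equation-first a (colsum zero _)    = refl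
  equation-first a (colsum (suc _) _) = refl
  equation-first a (idle _)         = refl

  system : Instance G
  system = record
    { N        = vars
    ; eqs      = tabulate (λ a → equation a (view a))
    ; distinct = AllPairs.tabulate⁺ (λ {a} {b} a≢b same → a≢b
        (trans (sym (equation-first a (view a))) (trans (proj₁ same) (equation-first b (view b)))))
    }

  telescope : ∀ {m} (f : Fin (suc m) → Fin k) (a : Fin m → Fin k) →
    (∀ j → f (suc j) ≡ f (Fin.inject₁ j) ∙ a j) → f (Fin.fromℕ m) ≡ f zero ∙ ∑ a
  telescope {zero}  f a _ = sym (identityʳ (f zero))
  telescope {suc m} f a h = trans (telescope (f ∘ suc) (a ∘ suc) (h ∘ suc))
    (trans (cong (_∙ ∑ (a ∘ suc)) (h zero)) (assoc (f zero) (a zero) _))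

  difference-zero : ∀ {a b c} → ((a ∙ ε) ∙ (b ∙ ε) ⁻¹) ∙ (c ∙ ε) ⁻¹ ≡ ε → a ≡ b ∙ c
  difference-zero {a} {b} {c} h rewrite identityʳ a | identityʳ b | identityʳ c = begin
    a                   ≡⟨ identityʳ a ⟨
    a ∙ ε               ≡⟨ cong (a ∙_) (inverseˡ b) ⟨
    a ∙ (b ⁻¹ ∙ b)      ≡⟨ assoc a (b ⁻¹) b ⟨
    (a ∙ b ⁻¹) ∙ b      ≡⟨ cong (_∙ b) (x∙y⁻¹≈ε⇒x≈y (a ∙ b ⁻¹) c h) ⟩
    c ∙ b               ≡⟨ comm c b ⟩
    b ∙ c               ∎
    where open ≡-Reasoning

  zero-difference : ∀ {a b c} → a ≡ b ∙ c → ((a ∙ ε) ∙ (b ∙ ε) ⁻¹) ∙ (c ∙ ε) ⁻¹ ≡ ε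
  zero-difference {b = b} {c} refl rewrite identityʳ (b ∙ c) | identityʳ b | identityʳ c = begin
    ((b ∙ c) ∙ b ⁻¹) ∙ c ⁻¹     ≡⟨ cong (λ w → (w ∙ b ⁻¹) ∙ c ⁻¹) (comm b c) ⟩
    ((c ∙ b) ∙ b ⁻¹) ∙ c ⁻¹     ≡⟨ cong (_∙ c ⁻¹) (assoc c b (b ⁻¹)) ⟩
    (c ∙ (b ∙ b ⁻¹)) ∙ c ⁻¹     ≡⟨ cong (λ w → (c ∙ w) ∙ c ⁻¹) (inverseʳ b) ⟩
    (c ∙ ε) ∙ c ⁻¹              ≡⟨ cong (_∙ c ⁻¹) (identityʳ c) ⟩
    c ∙ c ⁻¹                    ≡⟨ inverseʳ c ⟩
    ε                           ∎
    where open ≡-Reasoning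

  -- The first partial sum of a chain has no predecessor, so its equation is the one that closes the
  -- chain: first minus last is the inverse of `g`. The unknown starting value `a` cancels.
  total-difference : ∀ {a b s} → ((a ∙ ε) ∙ (b ∙ ε) ⁻¹) ∙ ε ≡ g ⁻¹ → b ≡ a ∙ s → s ≡ g
  total-difference {a} {s = s} h refl rewrite identityʳ a | identityʳ (a ∙ s) | identityʳ (a ∙ (a ∙ s) ⁻¹) =
    ⁻¹-injective (begin
      s ⁻¹                      ≡⟨ identityʳ (s ⁻¹) ⟨
      s ⁻¹ ∙ ε                  ≡⟨ cong (s ⁻¹ ∙_) (inverseˡ a) ⟨
      s ⁻¹ ∙ (a ⁻¹ ∙ a)         ≡⟨ assoc (s ⁻¹) (a ⁻¹) a ⟨
      (s ⁻¹ ∙ a ⁻¹) ∙ a         ≡⟨ cong (_∙ a) (⁻¹-anti-homo-∙ a s) ⟨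
      (a ∙ s) ⁻¹ ∙ a            ≡⟨ comm ((a ∙ s) ⁻¹) a ⟩
      a ∙ (a ∙ s) ⁻¹            ≡⟨ h ⟩
      g ⁻¹                      ∎)
    where open ≡-Reasoning

  module _ (h : Fin vars → Fin k)
           (sat : All (λ e → Holds G e (h (Eqn.x₁ e)) (h (Eqn.x₂ e)) (h (Eqn.x₃ e))) (Instance.eqs system)) where

    satisfied : ∀ v → Holds G (equation (code v) v) (h (code v)) (h (Eqn.x₂ (equation (code v) v))) (h (Eqn.x₃ (equation (code v) v)))
    satisfied v = subst₂ (λ w a → Holds G (equation (code v) w) (h a) (h (Eqn.x₂ (equation (code v) w))) (h (Eqn.x₃ (equation (code v) w))))
      (view-code v) (equation-first (code v) (view (code v)))
      (All.tabulate⁻ sat (code v))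

    row : ∀ i → ∑ (λ j → h (code (cell i j))) ≡ g
    row i = total-difference (satisfied (rowsum i zero))
      (telescope (λ j → h (code (rowsum i j))) (λ j → h (code (cell i j))) (λ j → difference-zero (satisfied (rowsum i (suc j)))))

    column : ∀ j → ∑ (λ i → h (code (cell i j))) ≡ g
    column j = total-difference (satisfied (colsum zero j))
      (telescope (λ i → h (code (colsum i j))) (λ i → h (code (cell i j))) (λ i → difference-zero (satisfied (colsum (suc i) j))))

    g≡ε : g ≡ ε
    g≡ε = ∙-cancelˡ s g ε (begin
      s ∙ g                                             ≡⟨ comm s g ⟩
      -- A sum of `suc M` copies unfolds to `g ∙ s`, so commutativity is all that the preceding step
      -- uses.
      ∑ {suc M} (λ _ → g)                               ≡⟨ sum-cong-≗ row ⟨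
      ∑ {suc M} (λ i → ∑ {M} (λ j → h (code (cell i j))))  ≡⟨ ∑-comm {suc M} {M} (λ i j → h (code (cell i j))) ⟩
      ∑ {M} (λ j → ∑ {suc M} (λ i → h (code (cell i j))))  ≡⟨ sum-cong-≗ column ⟩
      s                                                 ≡⟨ identityʳ s ⟨
      s ∙ ε                                             ∎)
      where
      open ≡-Reasoning
      s : Fin k
      s = ∑ {M} (λ _ → g)

  unsatisfiable : Unsat system
  unsatisfiable (h , sat) = g≢ε (g≡ε h sat)


  -- Reading the values of variables off a matching.

  indicator : {P : Set} → Dec P → Fin k
  indicator (yes _) = g
  indicator (no _)  = ε

  -- The value of a variable is read off the edge at its pigeon (cell and rowsum) or at its hole (colsum).
  value : Var → Edge → Fin k
  value (cell i j) e = indicator (proj₂ e Fin.≟ j)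
  value (rowsum i j) e = indicator (toℕ (proj₂ e) <? toℕ j)
  value (colsum i j) e = indicator (toℕ (proj₁ e) <? toℕ i)
  value (idle c)   e = ε

  star : Var → Edges
  star (cell i j) = map (i ,_) (allFin M)
  star (rowsum i j) = map (i ,_) (allFin M)
  star (colsum i j) = map (_, j) (allFin (suc M))
  -- Idle variables are attached to pigeon 0, all of whose edges give them the value ε, so that they
  -- too are decided by one edge.
  star (idle c)   = map (zero ,_) (allFin M)

  in-row : ∀ {i : Fin (suc M)} {e} → e ∈ map (i ,_) (allFin M) → proj₁ e ≡ i
  in-row {i} e∈ = cong proj₁ (proj₂ (proj₂ (∈-map⁻ (i ,_) e∈)))

  in-column : ∀ {j : Fin M} {e} → e ∈ map (_, j) (allFin (suc M)) → proj₂ e ≡ j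
  in-column {j} e∈ = cong proj₂ (proj₂ (proj₂ (∈-map⁻ (_, j) e∈)))

  star-unique : ∀ v {e f} → e ∈ star v → f ∈ star v → Compat e f → e ≡ f
  star-unique (cell i j) p q c = proj₁ c (trans (in-row p) (sym (in-row q)))
  star-unique (rowsum i j) p q c = proj₁ c (trans (in-row p) (sym (in-row q)))
  star-unique (colsum i j) p q c = proj₂ c (trans (in-column p) (sym (in-column q)))
  star-unique (idle _)   p q c = proj₁ c (trans (in-row p) (sym (in-row q)))

  reach-row : ∀ i {π} → Matching π → length π < M → ∃ λ e → e ∈ map (i ,_) (allFin M) × Matching (e ∷ π)
  reach-row i m l with extend-pigeon i m l
  ... | h , m′ = (i , h) , ∈-map⁺ (i ,_) (∈-allFin h) , m′

  reach-star : ∀ v {π} → Matching π → length π < M → ∃ λ e → e ∈ star v × Matching (e ∷ π)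
  reach-star (cell i j) = reach-row i
  reach-star (rowsum i j) = reach-row i
  reach-star (idle _)   = reach-row zero
  reach-star (colsum i j) m l with extend-hole j m l
  ... | q , m′ = (q , j) , ∈-map⁺ (_, j) (∈-allFin q) , m′

  Agrees : Bool → Fin k → Fin k → Set
  Agrees true  c w = w ≡ c
  Agrees false c w = w ≢ c

  agrees? : ∀ b c w → Dec (Agrees b c w)
  agrees? true  c w = w Fin.≟ c
  agrees? false c w = ¬? (w Fin.≟ c)

  agrees-not : ∀ b {c w} → Agrees b c w → ¬ Agrees (not b) c w
  agrees-not true  q r = r q
  agrees-not false q r = q r

  agrees-or-not : ∀ b c w → Agrees b c w ⊎ Agrees (not b) c w
  agrees-or-not true c w with w Fin.≟ c
  ... | yes q = inj₁ q
  ... | no ¬q = inj₂ ¬q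
  agrees-or-not false c w with w Fin.≟ c
  ... | yes q = inj₂ q
  ... | no ¬q = inj₁ ¬q

  literal-terms : Bool → CVar system → List Edges
  literal-terms b (a , c) = map [_] (filter (λ e → agrees? b c (value (view a) e)) (star (view a)))

  ∈-literal-terms⁺ : ∀ b a c {e} → e ∈ star (view a) → Agrees b c (value (view a) e) → [ e ] ∈ literal-terms b (a , c)
  ∈-literal-terms⁺ b a c e∈ q = ∈-map⁺ [_] (∈-filter⁺ (λ e → agrees? b c (value (view a) e)) e∈ q)

  ∈-literal-terms⁻ : ∀ b a c {t} → t ∈ literal-terms b (a , c) →
    ∃ λ e → t ≡ [ e ] × e ∈ star (view a) × Agrees b c (value (view a) e)
  ∈-literal-terms⁻ b a c t∈ with ∈-map⁻ [_] t∈
  ... | e , e∈ , eq with ∈-filter⁻ (λ e → agrees? b c (value (view a) e)) {v = e} {xs = star (view a)} e∈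
  ...   | q , r = e , eq , q , r

  literals : Literals (CVar system)
  literals = record
    { terms      = literal-terms
    ; singletons = λ {b} {v} → short b v
    ; exclusive  = λ {b} {v} → apart b v
    ; exhaustive = decide
    }
    where
    short : ∀ b v {t} → t ∈ literal-terms b v → length t ≤ 1
    short b (a , c) t∈ with ∈-literal-terms⁻ b a c t∈
    ... | _ , refl , _ = ≤-refl
    apart : ∀ b v {t t′ π} → t ∈ literal-terms b v → t′ ∈ literal-terms (not b) v → t ⊆ π → t′ ⊆ π → ¬ Matching π
    apart b (a , c) t∈ t′∈ s s′ m with ∈-literal-terms⁻ b a c t∈ | ∈-literal-terms⁻ (not b) a c t′∈
    ... | e , refl , e∈ , q | f , refl , f∈ , r with star-unique (view a) e∈ f∈ (m (s (here refl)) (s′ (here refl)))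
    ...   | refl = agrees-not b q r
    decide : ∀ b v {π} → Matching π → length π < M →
      ∃ λ π′ → π ⊆ π′ × Matching π′ × length π′ ≤ 1 + length π × ∃ λ t → (t ∈ literal-terms b v ⊎ t ∈ literal-terms (not b) v) × t ⊆ π′
    decide b (a , c) {π} m l with reach-star (view a) m l
    ... | e , e∈ , m′ = e ∷ π , there , m′ , ≤-refl , [ e ] , side (agrees-or-not b c (value (view a) e)) , λ { (here refl) → here refl }
      where
      side : Agrees b c (value (view a) e) ⊎ Agrees (not b) c (value (view a) e) → [ e ] ∈ literal-terms b (a , c) ⊎ [ e ] ∈ literal-terms (not b) (a , c)
      side (inj₁ q) = inj₁ (∈-literal-terms⁺ b a c e∈ q)
      side (inj₂ q) = inj₂ (∈-literal-terms⁺ (not b) a c e∈ q)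

  -- Being below b + 1 splits into the exclusive cases below b and equal to b. The equality is
  -- replaced by an equivalent `P`, since in a column it is tested at the other end of an edge; `c`
  -- accommodates the image of `inject₁`.
  indicator-suc : ∀ {P : Set} a b {c} (d : Dec (a < suc b)) (d′ : Dec (a < c)) (d″ : Dec P) → c ≡ b →
    (P → a ≡ b) → (a ≡ b → P) → indicator d ≡ indicator d′ ∙ indicator d″
  indicator-suc a b (yes _) (yes l) (yes q) refl to _ = ⊥-elim (<-irrefl (to q) l)
  indicator-suc a b (yes _) (yes _) (no _) refl _ _ = sym (identityʳ g)
  indicator-suc a b (yes _) (no _) (yes _) refl _ _ = sym (identityˡ g)
  indicator-suc a b (yes l) (no n) (no q) refl _ from = ⊥-elim (q (from (≤-antisym (≤-pred l) (≮⇒≥ n))))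
  indicator-suc a b (no n) (yes l) _ refl _ _ = ⊥-elim (n (m≤n⇒m≤1+n l))
  indicator-suc a b (no n) (no _) (yes q) refl to _ = ⊥-elim (n (s≤s (≤-reflexive (to q))))
  indicator-suc a b (no _) (no _) (no _) refl _ _ = sym (identityʳ ε)

  indicator-yes : ∀ {P : Set} (d : Dec P) → P → indicator d ≡ g
  indicator-yes (yes _) _ = refl
  indicator-yes (no ¬q) q = ⊥-elim (¬q q)

  total-edge : ((ε ∙ ε) ∙ (g ∙ ε) ⁻¹) ∙ ε ≡ g ⁻¹
  total-edge = trans (identityʳ _) (trans (cong₂ (λ a b → a ∙ b ⁻¹) (identityʳ ε) (identityʳ g)) (identityˡ _))

  -- In a row all three variables read the edge at the same pigeon. In a column the partial sums
  -- read the edge at hole j and the cell the edge at pigeon i; compatibility makes these two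
  -- coincide as soon as either joins i to j.
  local : ∀ a v {e₁ e₂ e₃} → view a ≡ v →
    e₁ ∈ star (view a) → e₂ ∈ star (view (Eqn.x₂ (equation a v))) → e₃ ∈ star (view (Eqn.x₃ (equation a v))) →
    Compat e₁ e₂ → Compat e₁ e₃ →
    Holds G (equation a v) (value (view a) e₁) (value (view (Eqn.x₂ (equation a v))) e₂) (value (view (Eqn.x₃ (equation a v))) e₃)
  local a (cell _ _) _ _ _ _ _ _ = trans (identityʳ _) (identityʳ ε)
  local a (idle _)   _ _ _ _ _ _ = trans (identityʳ _) (identityʳ ε)
  -- No hole is below 0 and every hole is below M, so the two ends of the chain have values ε and
  -- `g`.
  local a (rowsum i zero) {e₁} {e₂} eq s₁ s₂ s₃ c₂ c₃ rewrite eq | view-code (rowsum i (Fin.fromℕ M)) =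
    trans (cong (λ w → ((ε ∙ ε) ∙ (w ∙ ε) ⁻¹) ∙ ε)
      (indicator-yes (toℕ (proj₂ e₂) <? toℕ (Fin.fromℕ M)) (<-≤-trans (Fin.toℕ<n (proj₂ e₂)) (≤-reflexive (sym (Fin.toℕ-fromℕ M)))))) total-edge
  local a (colsum zero j) {e₁} {e₂} eq s₁ s₂ s₃ c₂ c₃ rewrite eq | view-code (colsum (Fin.fromℕ (suc M)) j) =
    trans (cong (λ w → ((ε ∙ ε) ∙ (w ∙ ε) ⁻¹) ∙ ε)
      (indicator-yes (toℕ (proj₁ e₂) <? toℕ (Fin.fromℕ (suc M))) (<-≤-trans (Fin.toℕ<n (proj₁ e₂)) (≤-reflexive (sym (Fin.toℕ-fromℕ (suc M))))))) total-edge
  local a (rowsum i (suc j)) {e₁} {e₂} {e₃} eq s₁ s₂ s₃ c₂ c₃ rewrite eq | view-code (rowsum i (Fin.inject₁ j)) | view-code (cell i j)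
    with proj₁ c₂ (trans (in-row s₁) (sym (in-row s₂))) | proj₁ c₃ (trans (in-row s₁) (sym (in-row s₃)))
  ... | refl | refl = zero-difference (indicator-suc (toℕ (proj₂ e₁)) (toℕ j) (toℕ (proj₂ e₁) <? suc (toℕ j)) (toℕ (proj₂ e₁) <? toℕ (Fin.inject₁ j)) (proj₂ e₁ Fin.≟ j)
    (Fin.toℕ-inject₁ j) (cong toℕ) Fin.toℕ-injective)
  local a (colsum (suc i) j) {e₁} {e₂} {e₃} eq s₁ s₂ s₃ c₂ c₃ rewrite eq | view-code (colsum (Fin.inject₁ i) j) | view-code (cell i j)
    with proj₂ c₂ (trans (in-column s₁) (sym (in-column s₂)))
  ... | refl = zero-difference (indicator-suc (toℕ (proj₁ e₁)) (toℕ i) (toℕ (proj₁ e₁) <? suc (toℕ i)) (toℕ (proj₁ e₁) <? toℕ (Fin.inject₁ i)) (proj₂ e₃ Fin.≟ j)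
    (Fin.toℕ-inject₁ i) to from)
    where
    to : proj₂ e₃ ≡ j → toℕ (proj₁ e₁) ≡ toℕ i
    to q = cong toℕ (trans (cong proj₁ (proj₂ c₃ (trans (in-column s₁) (sym q)))) (in-row s₃))
    from : toℕ (proj₁ e₁) ≡ toℕ i → proj₂ e₃ ≡ j
    from q = trans (cong proj₂ (sym (proj₁ c₃ (trans (Fin.toℕ-injective q) (sym (in-row s₃)))))) (in-column s₁)

  initial-true : ∀ {ℓ π} → CNF system ℓ → Matching π → length π + 3 ≤ M →
    ∃ λ π′ → π ⊆ π′ × Matching π′ × ∃ λ b → ∃ λ v → lit b v ∈ ℓ × ∃ λ t → t ∈ literal-terms b v × t ⊆ π′
  initial-true {π = π} (total a) m l with reach-star (view a) m (≤-trans (≤-reflexive (+-comm 1 (length π))) (≤-trans (+-monoʳ-≤ (length π) (s≤s z≤n)) l))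
  ... | e , e∈ , m′ = e ∷ π , there , m′ , true , (a , value (view a) e) , ∈-map⁺ (λ b → lit true (a , b)) (∈-allFin _)
      , [ e ] , ∈-literal-terms⁺ true a _ e∈ refl , λ { (here refl) → here refl }
  initial-true {π = π} (functional a b₀ b₁ b₀≢b₁) m l
    with reach-star (view a) m (≤-trans (≤-reflexive (+-comm 1 (length π))) (≤-trans (+-monoʳ-≤ (length π) (s≤s z≤n)) l))
  ... | e , e∈ , m′ with value (view a) e Fin.≟ b₀
  ...   | yes q = e ∷ π , there , m′ , false , (a , b₁) , there (here refl)
          , [ e ] , ∈-literal-terms⁺ false a b₁ e∈ (λ r → b₀≢b₁ (trans (sym q) r)) , λ { (here refl) → here refl }
  ...   | no ¬q = e ∷ π , there , m′ , false , (a , b₀) , here refl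
          , [ e ] , ∈-literal-terms⁺ false a b₀ e∈ ¬q , λ { (here refl) → here refl }
  initial-true {π = π} (constraint eq eq∈ b₁ b₂ b₃ ¬holds) m l = third (reach-star (view x₁) m (shrink 0 (s≤s z≤n)))
    where
    x₁ x₂ x₃ : Fin vars
    x₁ = Eqn.x₁ eq
    x₂ = Eqn.x₂ eq
    x₃ = Eqn.x₃ eq
    ℓ : Line (CVar system)
    ℓ = lit false (x₁ , b₁) ∷ lit false (x₂ , b₂) ∷ lit false (x₃ , b₃) ∷ []
    Goal : Set
    Goal = ∃ λ π′ → π ⊆ π′ × Matching π′ × ∃ λ b → ∃ λ v → lit b v ∈ ℓ × ∃ λ t → t ∈ literal-terms b v × t ⊆ π′
    shrink : ∀ c → c < 3 → c + length π < M
    shrink c c< = ≤-trans (≤-reflexive (+-comm (suc c) (length π))) (≤-trans (+-monoʳ-≤ (length π) c<) l)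
    holds : ∀ {e₁ e₂ e₃} → e₁ ∈ star (view x₁) → e₂ ∈ star (view x₂) → e₃ ∈ star (view x₃) → Compat e₁ e₂ → Compat e₁ e₃ →
      Holds G eq (value (view x₁) e₁) (value (view x₂) e₂) (value (view x₃) e₃)
    holds s₁ s₂ s₃ c₂ c₃ with ∈-tabulate⁻ {f = λ a → equation a (view a)} eq∈
    ... | a , refl = subst (λ w → Holds G (equation a (view a)) (value (view w) _) (value (view x₂) _) (value (view x₃) _))
      (sym (equation-first a (view a)))
      (local a (view a) refl (subst (λ w → _ ∈ star (view w)) (equation-first a (view a)) s₁) s₂ s₃ c₂ c₃)
    third : (∃ λ e₁ → e₁ ∈ star (view x₁) × Matching (e₁ ∷ π)) → Goal
    third (e₁ , s₁ , m₁) with reach-star (view x₂) m₁ (shrink 1 (s≤s (s≤s z≤n)))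
    ... | e₂ , s₂ , m₂ with reach-star (view x₃) m₂ (shrink 2 (s≤s (s≤s (s≤s z≤n))))
    ...   | e₃ , s₃ , m₃ = verdict (value (view x₁) e₁ Fin.≟ b₁) (value (view x₂) e₂ Fin.≟ b₂) (value (view x₃) e₃ Fin.≟ b₃)
      where
      found : ∀ a b {e} → lit false (a , b) ∈ ℓ → e ∈ star (view a) → e ∈ e₃ ∷ e₂ ∷ e₁ ∷ π → value (view a) e ≢ b → Goal
      found a b {e} lit∈ s e∈ q = e₃ ∷ e₂ ∷ e₁ ∷ π , there ∘ there ∘ there , m₃ , false , (a , b) , lit∈
        , [ e ] , ∈-literal-terms⁺ false a b s q , λ { (here refl) → e∈ }
      verdict : Dec (value (view x₁) e₁ ≡ b₁) → Dec (value (view x₂) e₂ ≡ b₂) → Dec (value (view x₃) e₃ ≡ b₃) → Goal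
      verdict (no q) _ _ = found x₁ b₁ (here refl) s₁ (there (there (here refl))) q
      verdict _ (no q) _ = found x₂ b₂ (there (here refl)) s₂ (there (here refl)) q
      verdict _ _ (no q) = found x₃ b₃ (there (there (here refl))) s₃ (here refl) q
      verdict (yes refl) (yes refl) (yes refl) = ⊥-elim (¬holds (holds s₁ s₂ s₃
        (m₃ (there (there (here refl))) (there (here refl))) (m₃ (there (there (here refl))) (here refl))))

-- Choice of the parameters.

root : ∀ e → 1 ≤ e → ∀ n → ∃ λ u → u ^ e ≤ n × n < suc u ^ e
root (suc e) _ zero = 0 , z≤n , ≤-reflexive (sym (^-zeroˡ (suc e)))
root e 1≤e (suc n) with root e 1≤e n
... | u , u≤ , <u with suc n <? suc u ^ e
...   | yes l = u , m≤n⇒m≤1+n u≤ , l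
...   | no ¬l = suc u , ≮⇒≥ ¬l , ≤-<-trans <u (^-monoˡ-< e {{>-nonZero 1≤e}} ≤-refl)

^-cancelˡ-< : ∀ e {a b n} → a ^ e ≤ n → n < b ^ e → a < b
^-cancelˡ-< e l l′ = ≰⇒> λ b≤a → <⇒≱ l′ (≤-trans (^-monoˡ-≤ e b≤a) l)

-- With terms of length at most 2s, the switching lemma asks for at most 144 s l⁴ edges, using l + 1
-- ≤ 2l and l + 1 + s ≤ 3l; the l holes that remain add at most s l⁴. Hence the constant 145 and the
-- fifth power.
quintic-room : ∀ s l → 1 ≤ s → 145 * s ≤ l →
  l + 2 * (suc l * l * (2 * (2 * s * ((suc l + s) * (suc l + s))))) ≤ l ^ 5
quintic-room s l 1≤s 145s≤l = begin
  l + 2 * (suc l * l * (2 * (2 * s * ((suc l + s) * (suc l + s)))))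
    ≤⟨ +-mono-≤ l≤ (*-monoʳ-≤ 2 (*-mono-≤ (*-monoˡ-≤ l suc-l) (*-monoʳ-≤ 2 (*-monoʳ-≤ (2 * s) (*-mono-≤ sum≤ sum≤))))) ⟩
  s * l ^ 4 + 2 * (2 * l * l * (2 * (2 * s * (3 * l * (3 * l)))))
    ≡⟨ solve 2 (λ s l → s :* l :^ 4 :+ con 2 :* (con 2 :* l :* l :* (con 2 :* (con 2 :* s :* (con 3 :* l :* (con 3 :* l)))))
         := con 145 :* s :* l :^ 4) refl s l ⟩
  145 * s * l ^ 4
    ≤⟨ *-monoˡ-≤ (l ^ 4) 145s≤l ⟩
  l ^ 5 ∎
  where
  open ≤-Reasoning
  open +-*-Solver
  s≤l : s ≤ l
  s≤l = ≤-trans (m≤m+n s (144 * s)) 145s≤l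
  1≤l : 1 ≤ l
  1≤l = ≤-trans 1≤s s≤l
  l≤ : l ≤ s * l ^ 4
  l≤ = ≤-trans (≤-reflexive (trans (sym (*-identityʳ l)) (sym (+-identityʳ (l * 1)))))
    (*-mono-≤ 1≤s (*-monoʳ-≤ l (≤-trans (≤-reflexive (sym (^-zeroˡ 3))) (^-monoˡ-≤ 3 1≤l))))
  suc-l : suc l ≤ 2 * l
  suc-l = ≤-trans (+-monoˡ-≤ l 1≤l) (≤-reflexive (cong (l +_) (sym (+-identityʳ l))))
  sum≤ : suc l + s ≤ 3 * l
  sum≤ = ≤-trans (+-mono-≤ suc-l s≤l) (≤-reflexive (solve 1 (λ l → con 2 :* l :+ l := con 3 :* l) refl l))

module _ {n : ℕ} {V : Set} (L : Board.Literals n V) (s u : ℕ) (1≤s : 1 ≤ s) (145s≤u : 145 * s ≤ u) where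
  open Board.Evaluation n L s using (Schedule)

  power-schedule : Schedule
  power-schedule = record
    { live     = live
    ; gap      = λ t → live (suc t) ∸ live t
    ; live-suc = λ t → sym (m∸n+n≡m {live (suc t)} {live t} (≤-trans (m≤m+n (live t) _) (room t)))
    ; positive = λ t → ≤-trans (≤-trans 1≤s (m≤m+n s (144 * s))) (live-large t)
    ; large    = λ t → m≤n⇒m≤1+n (m+n≤o⇒m≤o∸n _ (≤-trans (≤-reflexive (+-comm _ (live t))) (room t)))
    ; enough   = ≤-trans (≤-trans (≤-reflexive (sym (*-assoc 4 2 s))) (*-monoˡ-≤ s {8} {145} (m≤m+n 8 137))) (live-large 0)
    }
    where
    -- Each round back in time raises the number of free holes to the fifth power, starting from `u`
    -- at the end.
    live : ℕ → ℕ
    live t = u ^ (5 ^ t)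
    live-large : ∀ t → 145 * s ≤ live t
    live-large t = ≤-trans 145s≤u (≤-trans (≤-reflexive (sym (*-identityʳ u)))
      (^-monoʳ-≤ u {{>-nonZero (≤-trans (≤-trans 1≤s (m≤m+n s (144 * s))) 145s≤u)}} (m^n>0 5 t)))
    room : ∀ t → live t + 2 * (suc (live t) * live t * (2 * (2 * s * ((suc (live t) + s) * (suc (live t) + s))))) ≤ live (suc t)
    room t = ≤-trans (quintic-room s (live t) 1≤s (live-large t))
      (≤-reflexive (trans (^-*-assoc u (5 ^ t) 5) (cong (u ^_) (*-comm (5 ^ t) 5))))

nontrivial : ∀ {k} → 2 ≤ k → (a : Fin k) → ∃ λ b → b ≢ a
nontrivial {suc (suc _)} _ zero    = suc zero , λ ()
nontrivial {suc (suc _)} _ (suc _) = zero , λ ()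
nontrivial {suc zero} (s≤s ()) _

-- Squaring absorbs the constant: from m = 148 on, 145 (m + 2) is at most m², and for smaller m the
-- bound 145 · 149 on `u` suffices.
square-room : ∀ m u → m * m ≤ u → 145 * 149 ≤ u → 145 * (2 + m) ≤ u
square-room m u mm≤u big with m ≤? 147
... | yes small = ≤-trans (*-monoʳ-≤ 145 (+-monoʳ-≤ 2 small)) big
... | no ¬small = begin
  145 * (2 + m)       ≡⟨ *-distribˡ-+ 145 2 m ⟩
  290 + 145 * m       ≤⟨ +-monoˡ-≤ (145 * m) (≤-trans (m≤m+n 290 6) (*-monoʳ-≤ 2 148≤m)) ⟩
  2 * m + 145 * m     ≡⟨ *-distribʳ-+ m 2 145 ⟨
  147 * m             ≤⟨ *-monoˡ-≤ m (≤-trans (n≤1+n 147) 148≤m) ⟩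
  m * m               ≤⟨ mm≤u ⟩
  u                   ∎
  where
  open ≤-Reasoning
  148≤m : 148 ≤ m
  148≤m = ≰⇒> ¬small

-- The family of instances and the final bound.

module Family (d : ℕ) (G : FinAbGroup) (nontriv : 2 ≤ FinAbGroup.k G) where

  exponent : ℕ
  exponent = 5 ^ (2 + d)

  1≤2*exponent : 1 ≤ 2 * exponent
  1≤2*exponent = ≤-trans (m^n>0 5 (2 + d)) (m≤m+n exponent _)

  -- `base n` is the number of holes left after the last round. The factor 2 in the order of the
  -- root makes the square of `holes n` at most `n`, so that the quadratically many variables of the
  -- system stay linear in `n`.
  base : ℕ → ℕ
  base n = proj₁ (root (2 * exponent) 1≤2*exponent n)

  base-≤ : ∀ n → base n ^ (2 * exponent) ≤ n
  base-≤ n = proj₁ (proj₂ (root (2 * exponent) 1≤2*exponent n))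

  base-> : ∀ n → n < suc (base n) ^ (2 * exponent)
  base-> n = proj₂ (proj₂ (root (2 * exponent) 1≤2*exponent n))

  holes : ℕ → ℕ
  holes n = base n ^ exponent

  generator : ∃ λ g → g ≢ FinAbGroup.ε G
  generator = nontrivial nontriv (FinAbGroup.ε G)

  module P n = Pigeonhole G (holes n) n (proj₁ generator) (proj₂ generator)

  -- Padding with n idle variables makes the number of variables linear in n.
  𝔸 : ℕ → Instance G
  𝔸 n = P.system n

  holes-² : ∀ n → holes n * holes n ≤ n
  holes-² n = ≤-trans (≤-reflexive (trans (sym (^-distribˡ-+-* (base n) exponent exponent))
    (cong (λ e → base n ^ (exponent + e)) (sym (+-identityʳ exponent))))) (base-≤ n)

  1≤holes : ∀ n → 1 ≤ n → 1 ≤ holes n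
  1≤holes n 1≤n = ≤-trans (≤-reflexive (sym (^-zeroˡ exponent))) (^-monoˡ-≤ exponent
    (≤-pred (^-cancelˡ-< (2 * exponent) (≤-trans (≤-reflexive (^-zeroˡ (2 * exponent))) 1≤n) (base-> n))))

  vars-linear : ∀ n → 1 ≤ n → n ≤ 1 * P.vars n × P.vars n ≤ 10 * n
  vars-linear n 1≤n = ≤-trans n≤vars (≤-reflexive (sym (*-identityˡ (P.vars n)))) , (begin
    suc M * M + (suc M * suc M + (suc (suc M) * M + n))
      ≤⟨ +-mono-≤ (*-monoˡ-≤ M suc-M) (+-mono-≤ (*-mono-≤ suc-M suc-M) (+-monoˡ-≤ n (*-monoˡ-≤ M (+-mono-≤ 1≤M suc-M)))) ⟩
    2 * M * M + (2 * M * (2 * M) + ((M + 2 * M) * M + n))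
      ≡⟨ solve 2 (λ M n → con 2 :* M :* M :+ (con 2 :* M :* (con 2 :* M) :+ ((M :+ con 2 :* M) :* M :+ n))
           := con 9 :* (M :* M) :+ n) refl M n ⟩
    9 * (M * M) + n
      ≤⟨ +-monoˡ-≤ n (*-monoʳ-≤ 9 (holes-² n)) ⟩
    9 * n + n
      ≡⟨ +-comm (9 * n) n ⟩
    10 * n ∎)
    where
    open ≤-Reasoning
    open +-*-Solver
    M : ℕ
    M = holes n
    n≤vars : n ≤ P.vars n
    n≤vars = ≤-trans (m≤n+m n (suc (suc M) * M)) (≤-trans (m≤n+m (suc (suc M) * M + n) (suc M * suc M)) (m≤n+m _ (suc M * M)))
    1≤M : 1 ≤ M
    1≤M = 1≤holes n 1≤n
    suc-M : suc M ≤ 2 * M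
    suc-M = ≤-trans (+-monoˡ-≤ M 1≤M) (≤-reflexive (cong (M +_) (sym (+-identityʳ M))))

  eqs-linear : ∀ n → 1 ≤ n → n ≤ 1 * length (Instance.eqs (𝔸 n)) × length (Instance.eqs (𝔸 n)) ≤ 10 * n
  eqs-linear n 1≤n = subst (λ c → n ≤ 1 * c × c ≤ 10 * n) (sym (length-tabulate (λ a → P.equation n a (P.view n a)))) (vars-linear n 1≤n)

  size-bound : ∀ n → (145 * 149) ^ (2 * exponent) ≤ n → (π : List (Line (CVar (𝔸 n)))) → Refutation (CNF (𝔸 n)) π →
    DepthAtMost d π → ∀ m → m ^ (2 * (2 * exponent)) ≤ n ^ 1 → 2 ^ m ≤ proofSize π
  size-bound n large π ref depth m m≤ = ≤-trans (^-monoʳ-≤ 2 (m≤n+m m 2)) (≮⇒≥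
    -- Here s = m + 2, so that 2 ≤ s holds even for m = 0. The final `refl` works because the
    -- schedule at 2 + d is by definition `base n ^ exponent`, the number of holes.
    (Board.Evaluation.LowerBound.size-bound (holes n) (P.literals n) (2 + m)
      (power-schedule (P.literals n) (2 + m) (base n) (s≤s z≤n) (square-room m (base n) mm≤ big))
      (s≤s (s≤s z≤n)) (CNF (𝔸 n)) (P.initial-true n) d ref depth refl))
    where
    big : 145 * 149 ≤ base n
    big = ≤-pred (^-cancelˡ-< (2 * exponent) large (base-> n))
    -- Both sides are compared through their powers of order `2 * exponent`: that of m² is at most
    -- n, and that of `suc (base n)` exceeds n.
    mm≤ : m * m ≤ base n
    mm≤ = ≤-pred (^-cancelˡ-< (2 * exponent) (≤-trans (≤-reflexive (trans (cong (λ a → (m * a) ^ (2 * exponent)) (sym (*-identityʳ m)))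
      (^-*-assoc m 2 (2 * exponent)))) (≤-trans m≤ (≤-reflexive (*-identityʳ n)))) (base-> n))

theorem6p3 : (d : ℕ) (G : FinAbGroup) → 2 ≤ FinAbGroup.k G →
    Σ ℕ λ p → Σ ℕ λ q → 1 ≤ p × 1 ≤ q ×
    Σ (ℕ → Instance G) λ 𝔸 →
    (∀ n → 1 ≤ n → Unsat (𝔸 n)) ×
    IsΘn (λ n → Instance.N (𝔸 n)) ×
    IsΘn (λ n → length (Instance.eqs (𝔸 n))) ×
    (Σ ℕ λ n₀ → ∀ n → n₀ ≤ n →
    (π : List (Line (CVar (𝔸 n)))) → Refutation (CNF (𝔸 n)) π → DepthAtMost d π →
    ∀ m → m ^ q ≤ n ^ p → 2 ^ m ≤ proofSize π)
-- Here δ = p / q = 1 / (4 · 5^(d+2)): one factor 2 keeps M² within n, the other keeps m² within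
-- `base n`.
theorem6p3 d G nontriv = 1 , 2 * (2 * exponent) , ≤-refl , ≤-trans 1≤2*exponent (m≤m+n _ _) , 𝔸
  , (λ n _ → P.unsatisfiable n) , (1 , 10 , 1 , vars-linear) , (1 , 10 , 1 , eqs-linear)
  , (145 * 149) ^ (2 * exponent) , size-bound
  where open Family d G nontriv
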